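{- There is a polynomial-time algorithm and a function $\varepsilon:\mathbb{N}\to\mathbb{R}_{\ge 0}$ with $\varepsilon(N)\to 0$ as $N\to\infty$ such that the following holds. Given an instance of the CSCP with graph $G=(V,E)$ on $n$ vertices, common sink $t$, edge capacities $c_e$ and commodities $S_1,\dots,S_k$, and given a feasible solution $d$ to the linear program MCP-LP for this instance, the algorithm produces a fractional laminar cut family $\mathcal{C}$ that is feasible for the CSCP on $G$ with edge capacities $c_e+\varepsilon(nk)$.
   Context: CSCP (common-sink $s$-$t$ cut packing): an undirected graph $G=(V,E)$ with positive integral edge capacities $c_e$, a sink $t\in V$, and $k$ commodities $S_1,\dots,S_k$, each consisting of exactly two terminals, one residing at $t$; terminal $i$ resides at vertex $r_i$, and the two terminals of a commodity reside at different vertices. MCP-LP: for each $a\in[k]$, a nonnegative symmetric function $d_a$ on $V\times V$ with $d_a(v,v)=0$ satisfying $d_a(u,v)\le d_a(u,w)+d_a(w,v)$ for all $u,v,w\in V$; $d_a(r_i,r_j)\ge 1$ for all $i\ne j$ in $S_a$; $\sum_a d_a(e)\le c_e$ for all $e\in E$; and $d_a(e)\in[0,1]$ for all $a\in[k]$, $e\in E$ (where $d_a(e)=d_a(u,v)$ for $e=(u,v)$). A cut is a set $C$ with $\emptyset\subsetneq C\subsetneq V$; $\delta(C)$ is the set of edges with exactly one endpoint in $C$. Two cuts $C_1,C_2$ cross if $C_1\cap C_2$, $C_1\setminus C_2$, $C_2\setminus C_1$ are all non-empty. A collection of cuts is laminar if no two of its members cross. A fractional laminar cut family $\mathcal{C}$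 for a terminal set $T$ with weight function $w\geq 0$ is a laminar collection of cuts, each cut being associated with a unique terminal of $T$ (the same vertex set may occur several times, for the same or different terminals), such that, writing $\mathcal{C}_i$ for the cuts associated with $i$, every $C\in\mathcal{C}_i$ contains $r_i$, and $\sum_{C\in\mathcal{C}_i}w(C)=1$ for every $i\in T$. Its load on $e$ is $\ell_e^{\mathcal{C}}=\sum_{C\in\mathcal{C}:\,e\in\delta(C)}w(C)$. The family is feasible for the CSCP with edge capacities $c'_e$ if (1) $T$ is the set of all terminals in $\bigcup_a S_a$ other than those at the sink $t$; (2) $t\notin\bigcup_{C\in\mathcal{C}}C$; (3) $\ell_e^{\mathcal{C}}\le c'_e$ for every $e\in E$. -}

module Defs where

open import Data.Bool.Base using (Bool; true; false; _xor_)
open import Data.Fin.Base using (Fin; toℕ)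
open import Data.Fin.Properties as Finₚ using ()
open import Data.Fin.Subset using (Subset; _∈_; _∉_; _⊂_; _∩_; _─_; Nonempty; ⊤; ⊥)
open import Data.Fin.Subset.Properties using (_∈?_)
open import Data.Integer.Base using (ℤ; +_; -[1+_])
open import Data.List.Base as List using (List; []; _∷_; map; filter; foldr)
open import Data.List.Membership.Propositional using () renaming (_∈_ to _∈ˡ_)
open import Data.Nat.Base as ℕ using (ℕ; zero; suc)
open import Data.Nat.Binary.Base as ℕᵇ using (ℕᵇ; 2[1+_]; 1+[2_])
open import Data.Product.Base using (∃-syntax; _×_; _,_; proj₁; proj₂)
open import Data.Rational.Base using (ℚ; 0ℚ; 1ℚ; _+_; _≤_; _<_; _/_; ↥_; ↧ₙ_)
open import Data.Sum.Base using (_⊎_; inj₁; inj₂)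
open import Data.Sum.Properties using (≡-dec)
open import Data.Vec.Base as Vec using (Vec; []; _∷_; lookup; tabulate)
open import Relation.Binary.Definitions using (DecidableEquality)
open import Relation.Binary.PropositionalEquality using (_≡_; _≢_)
open import Relation.Nullary.Negation.Core using (¬_)

------------------------------------------------------------------------
-- Polynomial-time computation
--
-- Algorithms are first-order recursive (pure Lisp) programs over binary
-- trees.  Every evaluation rule costs one unit, which is the cost on a
-- machine that stores trees as shared cons cells.  Sharing lets t steps
-- build a tree with exponentially many nodes, so a polynomial bound on the
-- size of the output is demanded together with the bound on the time; with
-- both, the notion agrees with polynomial time on Turing machines.

infixr 5 _∙_

data Tree : Set where
  nil : Tree
  _∙_ : Tree → Tree → Tree

size : Tree → ℕ
size nil     = 1
size (x ∙ y) = suc (size x ℕ.+ size y)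

-- F is the number of functions of the program, all of them unary; n is the
-- number of variables in scope, with zero the most recently bound one.

data Exp (F n : ℕ) : Set where
  var   : Fin n → Exp F n
  nil   : Exp F n
  cons  : Exp F n → Exp F n → Exp F n
  match : Exp F n → Exp F n → Exp F (suc (suc n)) → Exp F n
  bind  : Exp F n → Exp F (suc n) → Exp F n
  call  : Fin F → Exp F n → Exp F n

record Program : Set where
  field
    functions : ℕ
    body      : Fin functions → Exp functions 1
    main      : Exp functions 1

-- Eval P ρ e v τ: in the environment ρ, e evaluates to v in τ steps.

data Eval (P : Program) : {n : ℕ} → Vec Tree n →
          Exp (Program.functions P) n → Tree → ℕ → Set where

  var : ∀ {n} {ρ : Vec Tree n} (x : Fin n) →
        Eval P ρ (var x) (lookup ρ x) 1

  nil : ∀ {n} {ρ : Vec Tree n} →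
        Eval P ρ nil nil 1

  cons : ∀ {n} {ρ : Vec Tree n} {e₁ e₂ v₁ v₂ τ₁ τ₂} →
         Eval P ρ e₁ v₁ τ₁ →
         Eval P ρ e₂ v₂ τ₂ →
         Eval P ρ (cons e₁ e₂) (v₁ ∙ v₂) (suc (τ₁ ℕ.+ τ₂))

  match-nil : ∀ {n} {ρ : Vec Tree n} {e e₁ e₂ v τ₁ τ₂} →
              Eval P ρ e nil τ₁ →
              Eval P ρ e₁ v τ₂ →
              Eval P ρ (match e e₁ e₂) v (suc (τ₁ ℕ.+ τ₂))

  match-cons : ∀ {n} {ρ : Vec Tree n} {e e₁ e₂ x y v τ₁ τ₂} →
               Eval P ρ e (x ∙ y) τ₁ →
               Eval P (x ∷ y ∷ ρ) e₂ v τ₂ →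
               Eval P ρ (match e e₁ e₂) v (suc (τ₁ ℕ.+ τ₂))

  bind : ∀ {n} {ρ : Vec Tree n} {e₁ e₂ v₁ v₂ τ₁ τ₂} →
         Eval P ρ e₁ v₁ τ₁ →
         Eval P (v₁ ∷ ρ) e₂ v₂ τ₂ →
         Eval P ρ (bind e₁ e₂) v₂ (suc (τ₁ ℕ.+ τ₂))

  call : ∀ {n} {ρ : Vec Tree n} {f e v w τ₁ τ₂} →
         Eval P ρ e v τ₁ →
         Eval P (v ∷ []) (Program.body P f) w τ₂ →
         Eval P ρ (call f e) w (suc (τ₁ ℕ.+ τ₂))

-- On input x, P halts within b steps with output y, which has size at most b.

OutputsWithin : Program → ℕ → Tree → Tree → Set
OutputsWithin P b x y =
  (∃[ τ ] (Eval P (x ∷ []) (Program.main P) y τ × τ ℕ.≤ b)) × size y ℕ.≤ b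

data Polynomial : Set where
  con     : ℕ → Polynomial
  X       : Polynomial
  _⊕_ _⊗_ : Polynomial → Polynomial → Polynomial

⟦_⟧ : Polynomial → ℕ → ℕ
⟦ con c ⟧ s = c
⟦ X ⟧     s = s
⟦ p ⊕ q ⟧ s = ⟦ p ⟧ s ℕ.+ ⟦ q ⟧ s
⟦ p ⊗ q ⟧ s = ⟦ p ⟧ s ℕ.* ⟦ q ⟧ s

------------------------------------------------------------------------
-- Rational numbers

fromℕ : ℕ → ℚ
fromℕ a = + a / 1

sum : List ℚ → ℚ
sum = foldr _+_ 0ℚ

∑ : {n : ℕ} → (Fin n → ℚ) → ℚ
∑ f = sum (List.tabulate f)

TendsToZero : (ℕ → ℚ) → Set
TendsToZero ε = ∀ (η : ℚ) → 0ℚ < η → ∃[ N₀ ] (∀ N → N₀ ℕ.≤ N → ε N < η)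

------------------------------------------------------------------------
-- Common-sink s-t cut packing

-- The a-th commodity is S_a = {source a, sink a}, and sink a is the one of
-- its two terminals that resides at t.

Terminal : ℕ → Set
Terminal k = Fin k ⊎ Fin k

pattern source a = inj₁ a
pattern sink a   = inj₂ a

commodity : {k : ℕ} → Terminal k → Fin k
commodity (source a) = a
commodity (sink a)   = a

_≟ᵀ_ : {k : ℕ} → DecidableEquality (Terminal k)
_≟ᵀ_ = ≡-dec Finₚ._≟_ Finₚ._≟_

record Instance : Set where
  field
    n m k : ℕ                      -- V = Fin n, E = Fin m
    ends  : Fin m → Fin n × Fin n  -- the orientation is immaterial
    c     : Fin m → ℕ
    t     : Fin n
    s     : Fin k → Fin n          -- residence of source a
    c-pos : ∀ e → 0 ℕ.< c e
    s≢t   : ∀ a → s a ≢ t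

  r : Terminal k → Fin n
  r (source a) = s a
  r (sink a)   = t

  δ : Subset n → Subset m
  δ C = tabulate λ e →
    lookup C (proj₁ (ends e)) xor lookup C (proj₂ (ends e))

LPPoint : Instance → Set
LPPoint I = Fin k → Fin n → Fin n → ℚ
  where open Instance I

record MCP-LP (I : Instance) (d : LPPoint I) : Set where
  open Instance I

  dᵉ : Fin k → Fin m → ℚ
  dᵉ a e = d a (proj₁ (ends e)) (proj₂ (ends e))

  field
    nonneg   : ∀ a u v → 0ℚ ≤ d a u v
    diagonal : ∀ a v → d a v v ≡ 0ℚ
    symm     : ∀ a u v → d a u v ≡ d a v u
    triangle : ∀ a u v w → d a u v ≤ d a u w + d a w v
    separate : ∀ a i j → commodity i ≡ a → commodity j ≡ a → i ≢ j →
               1ℚ ≤ d a (r i) (r j)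
    capacity : ∀ e → ∑ (λ a → dᵉ a e) ≤ fromℕ (c e)
    unit     : ∀ a e → 0ℚ ≤ dᵉ a e × dᵉ a e ≤ 1ℚ

------------------------------------------------------------------------
-- Fractional laminar cut families

IsCut : {n : ℕ} → Subset n → Set
IsCut C = ⊥ ⊂ C × C ⊂ ⊤

Cross : {n : ℕ} → Subset n → Subset n → Set
Cross C D = Nonempty (C ∩ D) × Nonempty (C ─ D) × Nonempty (D ─ C)

-- An occurrence of a vertex set in a family, with its terminal and weight.

record WeightedCut (I : Instance) : Set where
  open Instance I
  field
    terminal : Terminal k
    weight   : ℚ
    set      : Subset n

open WeightedCut public

Family : Instance → Set
Family I = List (WeightedCut I)

cutsOf : {I : Instance} → Terminal (Instance.k I) → Family I → Family I
cutsOf i 𝒞 = filter (λ C → terminal C ≟ᵀ i) 𝒞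

load : (I : Instance) → Family I → Fin (Instance.m I) → ℚ
load I 𝒞 e = sum (map weight (filter (λ C → e ∈? Instance.δ I (set C)) 𝒞))

record IsFractionalLaminarCutFamily
         (I : Instance) (T : Terminal (Instance.k I) → Set)
         (𝒞 : Family I) : Set where
  open Instance I
  field
    cuts      : ∀ C → C ∈ˡ 𝒞 → IsCut (set C)
    laminar   : ∀ C D → C ∈ˡ 𝒞 → D ∈ˡ 𝒞 → ¬ Cross (set C) (set D)
    terminals : ∀ C → C ∈ˡ 𝒞 → T (terminal C)
    nonneg    : ∀ C → C ∈ˡ 𝒞 → 0ℚ ≤ weight C
    contains  : ∀ C → C ∈ˡ 𝒞 → r (terminal C) ∈ set C
    total     : ∀ i → T i → sum (map weight (cutsOf {I} i 𝒞)) ≡ 1ℚ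

record FeasibleFamily
         (I : Instance) (c′ : Fin (Instance.m I) → ℚ)
         (𝒞 : Family I) : Set where
  open Instance I
  field
    isFamily   : IsFractionalLaminarCutFamily I (λ i → r i ≢ t) 𝒞
    avoidsSink : ∀ C → C ∈ˡ 𝒞 → t ∉ set C
    loads      : ∀ e → load I 𝒞 e ≤ c′ e

------------------------------------------------------------------------
-- Encodings
--
-- Elements of Fin n, and n itself, are written in unary, which is harmless
-- as a graph on n vertices has size at least n; capacities and rational
-- numbers are written in binary.

encodeBool : Bool → Tree
encodeBool false = nil
encodeBool true  = nil ∙ nil

encodeUnary : ℕ → Tree
encodeUnary zero    = nil
encodeUnary (suc a) = nil ∙ encodeUnary a

encodeFin : {n : ℕ} → Fin n → Tree
encodeFin x = encodeUnary (toℕ x)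

encodeℕᵇ : ℕᵇ → Tree
encodeℕᵇ ℕᵇ.zero  = nil
encodeℕᵇ 2[1+ b ] = encodeBool false ∙ encodeℕᵇ b
encodeℕᵇ 1+[2 b ] = encodeBool true ∙ encodeℕᵇ b

encodeℕ : ℕ → Tree
encodeℕ a = encodeℕᵇ (ℕᵇ.fromℕ a)

encodeℤ : ℤ → Tree
encodeℤ (+ a)    = encodeBool false ∙ encodeℕ a
encodeℤ -[1+ a ] = encodeBool true ∙ encodeℕ (suc a)

encodeℚ : ℚ → Tree
encodeℚ q = encodeℤ (↥ q) ∙ encodeℕ (↧ₙ q)

encodeList : {A : Set} → (A → Tree) → List A → Tree
encodeList f []       = nil
encodeList f (x ∷ xs) = f x ∙ encodeList f xs

encodeTable : {A : Set} {n : ℕ} → (A → Tree) → (Fin n → A) → Tree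
encodeTable f g = encodeList f (List.tabulate g)

encodeTerminal : {k : ℕ} → Terminal k → Tree
encodeTerminal (source a) = encodeBool false ∙ encodeFin a
encodeTerminal (sink a)   = encodeBool true ∙ encodeFin a

encodeInput : (I : Instance) → LPPoint I → Tree
encodeInput I d =
  encodeUnary n ∙
  encodeTable encodeEdge (λ e → ends e , c e) ∙
  encodeFin t ∙
  encodeTable encodeFin s ∙
  encodeTable (encodeTable (encodeTable encodeℚ)) d
  where
  open Instance I
  encodeEdge : (Fin n × Fin n) × ℕ → Tree
  encodeEdge ((u , v) , cₑ) = encodeFin u ∙ encodeFin v ∙ encodeℕ cₑ

encodeFamily : (I : Instance) → Family I → Tree
encodeFamily I = encodeList λ C →
  encodeTerminal (terminal C) ∙
  encodeℚ (weight C) ∙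
  encodeList encodeBool (Vec.toList (set C))

{-# OPTIONS --safe #-}
-- Let N = (nk + 1)².  The balls of radius j / N around s_a in d_a, for j = 1 … N,
-- contain s_a and avoid t, as d_a (s_a , t) ≥ 1.  With weight 1 / N each, they
-- put a load of at most d_a(e) + 1 / N on e by the triangle inequality, so that
-- the total load is at most c_e + k / N.
--
-- Two crossing cuts C (of a) and D (of b) are replaced by C ∩ D and C ∪ D if one
-- of s_a and s_b lies in C ∩ D, which is then given the intersection, and by
-- C ∖ D and D ∖ C otherwise.  This does not increase any load.  The sum of the
-- squared sizes of the complements increases strictly: the complements grow in
-- the second case and convexity applies in the first.  Polynomially many
-- replacements therefore lead to a laminar family.
--
-- Polynomial-time functions on encoded data are closed under composition,
-- branching and structural recursion whose values have polynomial size, and the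
-- algorithm is built in this way.
module Submission where

-- Rounding the radii does more than make the family finite. Cuts of different weights would have to
-- be split before an exchange; with equal weights two sets are traded for two sets, every commodity
-- keeps its N cuts, and both loads and total weights become counts in ℕ. The additive error is the
-- price.
--
-- The program never tests for laminarity. A sweep over all pairs either raises the potential or
-- leaves the list as it is, in which case no pair crosses and every later sweep is idle as well. A
-- number of sweeps above the largest possible potential is therefore enough.
--
-- Distances are binary rationals but radii are unary, so membership in a ball is decided after
-- cross-multiplying digit by digit with unary numbers, and no product of binary numbers is needed.
--
-- Recursion is where polynomial size can fail, as a value that doubles at every step becomes
-- exponential. Steps of a recursion may thus enlarge the state and the result only by amounts that
-- do not depend on the value enlarged. Uncrossing does not enlarge a pair at all, which permits
-- nested and repeated sweeps.

module PolynomialTime where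

  open import Defs
  open import Algebra.Properties.CommutativeSemigroup using (x∙yz≈y∙xz)
  open import Data.Bool.Base using (Bool; true; false; if_then_else_; not; _∧_; _∨_)
  open import Data.Fin.Base using (Fin; zero; suc; _↑ˡ_; _↑ʳ_; splitAt)
  open import Data.Fin.Patterns
  open import Data.Fin.Properties using (splitAt-↑ˡ; splitAt-↑ʳ)
  open import Data.Integer.Base as ℤ using (ℤ; ∣_∣)
  open import Data.List.Base using (List; []; _∷_; _++_; foldr; map; replicate; length; drop)
  open import Data.List.Properties using (length-replicate)
  open import Data.Nat.Base hiding (_/_; less)
  open import Data.Nat.Binary.Base as ℕᵇ using (ℕᵇ; 2[1+_]; 1+[2_])
  open import Data.Nat.Binary.Properties using (fromℕ≡fromℕ')
  open import Data.Nat.Properties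
  open import Data.Nat.Tactic.RingSolver using (solve-∀)
  open import Data.Product.Base using (∃-syntax; _×_; _,_; proj₁; proj₂; uncurry)
  open import Data.Rational.Base using (ℚ; ↥_; ↧ₙ_)
  open import Data.Sum.Base using ([_,_]′)
  open import Data.Unit.Base using (⊤; tt)
  open import Data.Vec.Base using (Vec; []; _∷_; lookup)
  open import Function.Base using (_∘_; id)
  open import Relation.Binary.PropositionalEquality

  -- Polynomial bounds and evaluation within a number of steps

  ⟦⟧-mono : ∀ p {x y} → x ≤ y → ⟦ p ⟧ x ≤ ⟦ p ⟧ y
  ⟦⟧-mono (con c) x≤y = ≤-refl
  ⟦⟧-mono X       x≤y = x≤y
  ⟦⟧-mono (p ⊕ q) x≤y = +-mono-≤ (⟦⟧-mono p x≤y) (⟦⟧-mono q x≤y)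
  ⟦⟧-mono (p ⊗ q) x≤y = *-mono-≤ (⟦⟧-mono p x≤y) (⟦⟧-mono q x≤y)

  infixl 30 _⟨_⟩

  _⟨_⟩ : Polynomial → Polynomial → Polynomial
  con c   ⟨ r ⟩ = con c
  X       ⟨ r ⟩ = r
  (p ⊕ q) ⟨ r ⟩ = p ⟨ r ⟩ ⊕ q ⟨ r ⟩
  (p ⊗ q) ⟨ r ⟩ = p ⟨ r ⟩ ⊗ q ⟨ r ⟩

  ⟨⟩-correct : ∀ p r x → ⟦ p ⟨ r ⟩ ⟧ x ≡ ⟦ p ⟧ (⟦ r ⟧ x)
  ⟨⟩-correct (con c) r x = refl
  ⟨⟩-correct X       r x = refl
  ⟨⟩-correct (p ⊕ q) r x = cong₂ _+_ (⟨⟩-correct p r x) (⟨⟩-correct q r x)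
  ⟨⟩-correct (p ⊗ q) r x = cong₂ _*_ (⟨⟩-correct p r x) (⟨⟩-correct q r x)

  ⟨⟩-bound : ∀ p r {x y} → y ≤ ⟦ r ⟧ x → ⟦ p ⟧ y ≤ ⟦ p ⟨ r ⟩ ⟧ x
  ⟨⟩-bound p r {x} y≤ = ≤-trans (⟦⟧-mono p y≤) (≤-reflexive (sym (⟨⟩-correct p r x)))

  -- An upper bound replaces the exact step count of `Eval`, so that costs can be rounded up with
  -- `runs-≤` wherever the exact count would depend on data.
  Runs : (P : Program) {n : ℕ} → Vec Tree n → Exp (Program.functions P) n → Tree → ℕ → Set
  Runs P ρ e v b = ∃[ τ ] (Eval P ρ e v τ × τ ≤ b)

  module _ {P : Program} {n : ℕ} {ρ : Vec Tree n} where

    runs-≤ : ∀ {e v b b′} → b ≤ b′ → Runs P ρ e v b → Runs P ρ e v b′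
    runs-≤ b≤b′ (τ , ev , τ≤) = τ , ev , ≤-trans τ≤ b≤b′

    runs-var : ∀ x {v} → lookup ρ x ≡ v → Runs P ρ (var x) v 1
    runs-var x refl = 1 , var x , ≤-refl

    runs-nil : Runs P ρ nil nil 1
    runs-nil = 1 , nil , ≤-refl

    runs-cons : ∀ {e₁ e₂ v₁ v₂ b₁ b₂} → Runs P ρ e₁ v₁ b₁ → Runs P ρ e₂ v₂ b₂ →
                Runs P ρ (cons e₁ e₂) (v₁ ∙ v₂) (suc (b₁ + b₂))
    runs-cons (_ , ev₁ , ≤₁) (_ , ev₂ , ≤₂) = _ , cons ev₁ ev₂ , s≤s (+-mono-≤ ≤₁ ≤₂)

    runs-match-nil : ∀ {e e₁ e₂ v b₁ b₂} → Runs P ρ e nil b₁ → Runs P ρ e₁ v b₂ →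
                     Runs P ρ (match e e₁ e₂) v (suc (b₁ + b₂))
    runs-match-nil (_ , ev₁ , ≤₁) (_ , ev₂ , ≤₂) =
      _ , match-nil ev₁ ev₂ , s≤s (+-mono-≤ ≤₁ ≤₂)

    runs-match-cons : ∀ {e e₁ e₂ x y v b₁ b₂} → Runs P ρ e (x ∙ y) b₁ →
                      Runs P (x ∷ y ∷ ρ) e₂ v b₂ →
                      Runs P ρ (match e e₁ e₂) v (suc (b₁ + b₂))
    runs-match-cons (_ , ev₁ , ≤₁) (_ , ev₂ , ≤₂) =
      _ , match-cons ev₁ ev₂ , s≤s (+-mono-≤ ≤₁ ≤₂)

    runs-bind : ∀ {e₁ e₂ v₁ v₂ b₁ b₂} → Runs P ρ e₁ v₁ b₁ → Runs P (v₁ ∷ ρ) e₂ v₂ b₂ →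
                Runs P ρ (bind e₁ e₂) v₂ (suc (b₁ + b₂))
    runs-bind (_ , ev₁ , ≤₁) (_ , ev₂ , ≤₂) = _ , bind ev₁ ev₂ , s≤s (+-mono-≤ ≤₁ ≤₂)

    runs-call : ∀ {f e v w b₁ b₂} → Runs P ρ e v b₁ →
                Runs P (v ∷ []) (Program.body P f) w b₂ →
                Runs P ρ (call f e) w (suc (b₁ + b₂))
    runs-call (_ , ev₁ , ≤₁) (_ , ev₂ , ≤₂) = _ , call ev₁ ev₂ , s≤s (+-mono-≤ ≤₁ ≤₂)

  -- The bodies can be linked into any program, ι giving the places of the functions
  -- there.

  record Library : Set where
    field
      functions : ℕ
      body      : ∀ {G} → (Fin functions → Fin G) → Fin functions → Exp G 1

  open Library

  emptyLibrary : Library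
  emptyLibrary = record { functions = 0 ; body = λ ι () }

  _⊎ᴸ_ : Library → Library → Library
  L ⊎ᴸ M = record
    { functions = functions L + functions M
    ; body      = λ ι f → [ body L (ι ∘ (_↑ˡ functions M)) , body M (ι ∘ (functions L ↑ʳ_)) ]′
                          (splitAt (functions L) f)
    }

  record Links (P : Program) (L : Library)
               (ι : Fin (functions L) → Fin (Program.functions P)) : Set where
    constructor links
    field linked : ∀ f → Program.body P (ι f) ≡ body L ι f

  open Links

  module _ (L M : Library) where

    left : ∀ {G} → (Fin (functions (L ⊎ᴸ M)) → Fin G) → Fin (functions L) → Fin G
    left ι = ι ∘ (_↑ˡ functions M)

    right : ∀ {G} → (Fin (functions (L ⊎ᴸ M)) → Fin G) → Fin (functions M) → Fin G
    right ι = ι ∘ (functions L ↑ʳ_)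

    links-left : ∀ {P ι} → Links P (L ⊎ᴸ M) ι → Links P L (left ι)
    links-left {P} {ι} ok = links λ f → trans (linked ok (f ↑ˡ functions M))
      (cong [ body L (left ι) , body M (right ι) ]′ (splitAt-↑ˡ (functions L) f (functions M)))

    links-right : ∀ {P ι} → Links P (L ⊎ᴸ M) ι → Links P M (right ι)
    links-right {P} {ι} ok = links λ f → trans (linked ok (functions L ↑ʳ f))
      (cong [ body L (left ι) , body M (right ι) ]′ (splitAt-↑ʳ (functions L) (functions M) f))

  -- Encodings and closure properties of polynomial-time functions

  record Encodable (A : Set) : Set where
    constructor encodedBy
    field encode : A → Tree

  open Encodable ⦃ ... ⦄ public

  instance
    Encodable-Tree : Encodable Tree
    Encodable-Tree = encodedBy id

    Encodable-⊤ : Encodable ⊤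
    Encodable-⊤ = encodedBy λ _ → nil

    Encodable-Bool : Encodable Bool
    Encodable-Bool = encodedBy encodeBool

    Encodable-ℕ : Encodable ℕ
    Encodable-ℕ = encodedBy encodeUnary

    Encodable-ℚ : Encodable ℚ
    Encodable-ℚ = encodedBy encodeℚ

    Encodable-× : {A B : Set} → ⦃ Encodable A ⦄ → ⦃ Encodable B ⦄ → Encodable (A × B)
    Encodable-× = encodedBy λ (x , y) → encode x ∙ encode y

    Encodable-List : {A : Set} → ⦃ Encodable A ⦄ → Encodable (List A)
    Encodable-List = encodedBy (encodeList encode)

  ‖_‖ : {A : Set} → ⦃ Encodable A ⦄ → A → ℕ
  ‖ x ‖ = size (encode x)

  0<size : ∀ t → 0 < size t
  0<size nil     = z<s
  0<size (_ ∙ _) = z<s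

  literal : Tree → ∀ {G n} → Exp G n
  literal nil     = nil
  literal (x ∙ y) = cons (literal x) (literal y)

  runs-literal : ∀ t {P n} {ρ : Vec Tree n} → Runs P ρ (literal t) t (size t)
  runs-literal nil     = runs-nil
  runs-literal (x ∙ y) = runs-cons (runs-literal x) (runs-literal y)

  -- The code of a function is uniform in the variable that holds its argument, so
  -- that it can be placed in any environment.

  record PolyTime {A B : Set} ⦃ _ : Encodable A ⦄ ⦃ _ : Encodable B ⦄ (f : A → B) : Set where
    field
      library : Library
      code    : ∀ {G} → (Fin (functions library) → Fin G) → ∀ {n} → Fin n → Exp G n
      bound   : Polynomial
      runs    : ∀ {P ι} → Links P library ι → ∀ {n} {ρ : Vec Tree n} i x → lookup ρ i ≡ encode x →
                Runs P ρ (code ι i) (encode (f x)) (⟦ bound ⟧ ‖ x ‖)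
      small   : ∀ x → ‖ f x ‖ ≤ ⟦ bound ⟧ ‖ x ‖

  open PolyTime

  polyTime-cong : {A B : Set} ⦃ _ : Encodable A ⦄ ⦃ _ : Encodable B ⦄ {f g : A → B} →
                  (∀ x → f x ≡ g x) → PolyTime f → PolyTime g
  polyTime-cong {f = f} f≗g F = record
    { library = library F
    ; code    = code F
    ; bound   = bound F
    ; runs    = λ ok i x eq → subst (λ y → Runs _ _ _ (encode y) _) (f≗g x) (runs F ok i x eq)
    ; small   = λ x → subst (λ y → ‖ y ‖ ≤ _) (f≗g x) (small F x)
    }

  -- If a value and its image have the same tree, the program only has to return its variable.
  -- Constructors, and changes between types with a common encoding, are free in this way.
  recode : {A B : Set} ⦃ _ : Encodable A ⦄ ⦃ _ : Encodable B ⦄ {f : A → B} →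
           (∀ x → encode x ≡ encode (f x)) → PolyTime f
  recode f-enc = record
    { library = emptyLibrary
    ; code    = λ ι i → var i
    ; bound   = con 1 ⊕ X
    ; runs    = λ ok i x eq → runs-≤ (m≤m+n 1 _)
                  (runs-var i (trans eq (f-enc x)))
    ; small   = λ x → ≤-trans (≤-reflexive (cong size (sym (f-enc x)))) (m≤n+m _ 1)
    }

  idᴾ : {A : Set} ⦃ _ : Encodable A ⦄ → PolyTime {A} {A} id
  idᴾ = recode λ _ → refl

  infixr 9 _∘ᴾ_

  _∘ᴾ_ : {A B C : Set} ⦃ _ : Encodable A ⦄ ⦃ _ : Encodable B ⦄ ⦃ _ : Encodable C ⦄
         {g : B → C} {f : A → B} → PolyTime g → PolyTime f → PolyTime (g ∘ f)
  _∘ᴾ_ {f = f} G F = record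
    { library = library G ⊎ᴸ library F
    ; code    = λ ι i → bind (code F (right (library G) (library F) ι) i) (code G (left (library G) (library F) ι) zero)
    ; bound   = con 1 ⊕ (bound F ⊕ bound G ⟨ bound F ⟩)
    ; runs    = λ ok i x eq → runs-≤ (s≤s (+-monoʳ-≤ _ (⟨⟩-bound (bound G) (bound F) (small F x))))
                  (runs-bind (runs F (links-right (library G) (library F) ok) i x eq)
                             (runs G (links-left (library G) (library F) ok) zero (f x) refl))
    ; small   = λ x → ≤-trans (small G (f x)) (≤-trans (⟨⟩-bound (bound G) (bound F) (small F x))
                  (≤-trans (m≤n+m _ _) (m≤n+m _ 1)))
    }

  infixr 4 _,ᴾ_

  _,ᴾ_ : {A B C : Set} ⦃ _ : Encodable A ⦄ ⦃ _ : Encodable B ⦄ ⦃ _ : Encodable C ⦄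
         {f : A → B} {g : A → C} → PolyTime f → PolyTime g → PolyTime (λ x → f x , g x)
  F ,ᴾ G = record
    { library = library F ⊎ᴸ library G
    ; code    = λ ι i → cons (code F (left (library F) (library G) ι) i) (code G (right (library F) (library G) ι) i)
    ; bound   = con 1 ⊕ (bound F ⊕ bound G)
    ; runs    = λ ok i x eq →
                  runs-cons (runs F (links-left (library F) (library G) ok) i x eq)
                            (runs G (links-right (library F) (library G) ok) i x eq)
    ; small   = λ x → s≤s (+-mono-≤ (small F x) (small G x))
    }

  module _ {A B : Set} ⦃ _ : Encodable A ⦄ ⦃ _ : Encodable B ⦄ where

    fstᴾ : PolyTime {A × B} proj₁
    fstᴾ = record
      { library = emptyLibrary
      ; code    = λ ι i → match (var i) nil (var zero)
      ; bound   = con 3 ⊕ X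
      ; runs    = λ { ok {ρ = ρ} i (x , y) eq → runs-≤ (m≤m+n 3 _) (runs-match-cons
                    (runs-var i eq) (runs-var zero refl)) }
      ; small   = λ { (x , y) → ≤-trans (m≤m+n _ _) (m≤n+m _ 4) }
      }

    sndᴾ : PolyTime {A × B} proj₂
    sndᴾ = record
      { library = emptyLibrary
      ; code    = λ ι i → match (var i) nil (var (suc zero))
      ; bound   = con 3 ⊕ X
      ; runs    = λ { ok {ρ = ρ} i (x , y) eq → runs-≤ (m≤m+n 3 _) (runs-match-cons
                    (runs-var i eq) (runs-var (suc zero) refl)) }
      ; small   = λ { (x , y) → ≤-trans (m≤n+m _ _) (m≤n+m _ 4) }
      }

    consᴾ : {f : A → B} {g : A → List B} → PolyTime f → PolyTime g → PolyTime (λ x → f x ∷ g x)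
    consᴾ F G = recode {A = B × List B} {f = λ (x , xs) → x ∷ xs} (λ _ → refl) ∘ᴾ (F ,ᴾ G)

    constᴾ : (y : B) → PolyTime {A} (λ _ → y)
    constᴾ y = record
      { library = emptyLibrary
      ; code    = λ ι i → literal (encode y)
      ; bound   = con ‖ y ‖
      ; runs    = λ ok i x eq → runs-literal (encode y)
      ; small   = λ x → ≤-refl
      }

    ifᴾ : {c : A → Bool} {f g : A → B} → PolyTime c → PolyTime f → PolyTime g →
          PolyTime (λ x → if c x then f x else g x)
    ifᴾ {c} {f} {g} C F G = record
      { library = library C ⊎ᴸ FG
      ; code    = branch
      ; bound   = con 1 ⊕ (bound C ⊕ (bound F ⊕ bound G))
      ; runs    = runs-branch
      ; small   = λ x → ≤-trans (small-branch x) (≤-trans (m≤n+m _ (⟦ bound C ⟧ ‖ x ‖)) (m≤n+m _ 1))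
      }
      where
      FG : Library
      FG = library F ⊎ᴸ library G
      branch : ∀ {H} → (Fin (functions (library C ⊎ᴸ FG)) → Fin H) → ∀ {n} → Fin n → Exp H n
      -- `false` is the tree `nil` and `true` a cons, so the branch for `nil` is the else branch.
      -- The other branch binds two more variables, which shifts the argument by two.
      branch ι i = match (code C (left (library C) FG ι) i)
        (code G (right (library F) (library G) (right (library C) FG ι)) i)
        (code F (left (library F) (library G) (right (library C) FG ι)) (suc (suc i)))
      small-branch : ∀ x → ‖ if c x then f x else g x ‖ ≤ ⟦ bound F ⊕ bound G ⟧ ‖ x ‖
      small-branch x with c x
      ... | true  = ≤-trans (small F x) (m≤m+n _ _)
      ... | false = ≤-trans (small G x) (m≤n+m _ _)
      runs-branch : ∀ {P ι} → Links P (library C ⊎ᴸ FG) ι →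
                    ∀ {n} {ρ : Vec Tree n} i x → lookup ρ i ≡ encode x →
                    Runs P ρ (branch ι i) (encode (if c x then f x else g x))
                      (suc (⟦ bound C ⟧ ‖ x ‖ + ⟦ bound F ⊕ bound G ⟧ ‖ x ‖))
      runs-branch ok i x eq with c x | runs C (links-left (library C) FG ok) i x eq
      ... | true  | test = runs-≤ (s≤s (+-monoʳ-≤ (⟦ bound C ⟧ ‖ x ‖) (m≤m+n _ _)))
        (runs-match-cons test
          (runs F (links-left (library F) (library G) (links-right (library C) FG ok)) (suc (suc i)) x eq))
      ... | false | test = runs-≤ (s≤s (+-monoʳ-≤ (⟦ bound C ⟧ ‖ x ‖) (m≤n+m _ (⟦ bound F ⟧ ‖ x ‖))))
        (runs-match-nil test
          (runs G (links-right (library F) (library G) (links-right (library C) FG ok)) i x eq))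

  -- Structural recursion in polynomial time

  private
    -- Apart from the bodies and the recursive call, an iteration takes 10 steps at the end of the
    -- list and 26 at an element; 40 is a round number above both. The factor 1 is the size of the
    -- empty list.
    baseCase : ∀ f u s → 10 + f ≤ 1 * (40 + (f + (u + s)))
    baseCase f u s = ≤-trans (+-mono-≤ (m≤m+n 10 30) (m≤m+n f _)) (m≤m+n _ 0)

    inductiveCase : ∀ a l f u s → let cost = 40 + (f + (u + s)) in
      suc (1 + suc (1 + suc (1 + suc (suc (1 + suc (1 + 1)) +
        suc (suc (suc (1 + suc (u + 1)) + l * cost) + suc (suc (1 + suc (1 + suc (1 + 1))) + s))))))
      ≤ suc (a + l) * cost
    inductiveCase a l f u s = begin
      _                                              ≡⟨ rearrange u (l * cost) s ⟩
      (26 + (u + s)) + l * cost                      ≤⟨ +-monoˡ-≤ _ (+-mono-≤ (m≤m+n 26 14) (m≤n+m _ f)) ⟩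
      cost + l * cost                                ≤⟨ +-monoʳ-≤ cost (*-monoˡ-≤ cost (m≤n+m l a)) ⟩
      cost + (a + l) * cost                          ∎
      where
      open ≤-Reasoning
      cost = 40 + (f + (u + s))
      rearrange : ∀ u l s →
        suc (1 + suc (1 + suc (1 + suc (suc (1 + suc (1 + 1)) +
          suc (suc (suc (1 + suc (u + 1)) + l) + suc (suc (1 + suc (1 + suc (1 + 1))) + s)))))) ≡
        (26 + (u + s)) + l
      rearrange = solve-∀

  -- The state s is updated on the way down the list; foldr, foldl and zipWith are
  -- all of this form.

  module Recursion {E A S R : Set}
    ⦃ _ : Encodable E ⦄ ⦃ _ : Encodable A ⦄ ⦃ _ : Encodable S ⦄ ⦃ _ : Encodable R ⦄
    (fin : E × S → R) (upd : E × A × S → S) (step : E × A × S × R → R) where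

    rec : E → S → List A → R
    rec e s []       = fin (e , s)
    rec e s (a ∷ as) = step (e , a , s , rec e (upd (e , a , s)) as)

    -- `Z` bounds every argument on which `fin`, `upd` and `step` are evaluated in the course of the
    -- recursion, so that their costs can be bounded once and for all by polynomials in `Z`.
    data Within (Z : ℕ) (e : E) : S → List A → Set where
      []  : ∀ {s} → ‖ e , s ‖ ≤ Z → Within Z e s []
      _∷_ : ∀ {s a as} → ‖ e , a , s ‖ ≤ Z × ‖ e , a , s , rec e (upd (e , a , s)) as ‖ ≤ Z →
            Within Z e (upd (e , a , s)) as → Within Z e s (a ∷ as)

    module _ (Finish : PolyTime fin) (Upd : PolyTime upd) (Step : PolyTime step) where

      US bodies : Library
      US     = library Upd ⊎ᴸ library Step
      bodies = library Finish ⊎ᴸ US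

      loop : ∀ {G} → (Fin (functions bodies) → Fin G) → Fin G → Exp G 1
      loop ι self =
        match (var 0F) nil
          (match (var 1F) nil
            (match (var 1F)
              (bind (cons (var 2F) (var 0F)) (code Finish (left (library Finish) US ι) 0F))
              -- Variables 0 to 4 are now the head, the rest of the list, the state, the whole list
              -- and the environment. Each `bind` shifts them by one.
              (bind (cons (var 4F) (cons (var 0F) (var 2F)))
                (bind (call self (cons (var 5F) (cons
                        (code Upd (left (library Upd) (library Step) (right (library Finish) US ι)) 0F)
                        (var 2F))))
                  (bind (cons (var 6F) (cons (var 2F) (cons (var 4F) (var 0F))))
                    (code Step (right (library Upd) (library Step) (right (library Finish) US ι)) 0F))))))

      loopLibrary : Library
      loopLibrary = record
        { functions = suc (functions bodies)
        ; body      = λ { ι zero → loop (ι ∘ suc) (ι zero) ; ι (suc f) → body bodies (ι ∘ suc) f }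
        }

      iterationCost : ℕ → ℕ
      iterationCost Z = 40 + (⟦ bound Finish ⟧ Z + (⟦ bound Upd ⟧ Z + ⟦ bound Step ⟧ Z))

      -- Each cell of the list, the closing `nil` included, contributes at least one to the size of
      -- the list and so pays for one iteration.
      runs-loop : ∀ {P ι} → Links P loopLibrary ι → ∀ {Z e s as} → Within Z e s as →
                  Runs P (encode (e , s , as) ∷ []) (Program.body P (ι zero)) (encode (rec e s as))
                    (‖ as ‖ * iterationCost Z)
      runs-loop {P} {ι} ok {Z} {e} {s} {as} within =
        subst (λ b → Runs P _ b _ _) (sym (linked ok zero)) (go within)
        where
        okFinish : Links P (library Finish) (left (library Finish) US (ι ∘ suc))
        okFinish = links-left (library Finish) US (links (linked ok ∘ suc))
        okUS : Links P US (right (library Finish) US (ι ∘ suc))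
        okUS = links-right (library Finish) US (links (linked ok ∘ suc))
        go : ∀ {s as} → Within Z e s as →
             Runs P (encode (e , s , as) ∷ []) (loop (ι ∘ suc) (ι zero)) (encode (rec e s as))
               (‖ as ‖ * iterationCost Z)
        go {s} ([] es≤) = runs-≤ (baseCase (⟦ bound Finish ⟧ Z) (⟦ bound Upd ⟧ Z) (⟦ bound Step ⟧ Z))
          (runs-match-cons (runs-var 0F refl)
            (runs-match-cons (runs-var 1F refl)
              (runs-match-nil (runs-var 1F refl)
                (runs-bind (runs-cons (runs-var 2F refl) (runs-var 0F refl))
                  (runs-≤ (⟦⟧-mono (bound Finish) es≤) (runs Finish okFinish 0F (e , s) refl))))))
        go {s} {a ∷ as} ((eas≤ , easr≤) ∷ w) = runs-≤ (inductiveCase ‖ a ‖ ‖ as ‖ (⟦ bound Finish ⟧ Z) (⟦ bound Upd ⟧ Z) (⟦ bound Step ⟧ Z))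
          (runs-match-cons (runs-var 0F refl)
            (runs-match-cons (runs-var 1F refl)
              (runs-match-cons (runs-var 1F refl)
                (runs-bind (runs-cons (runs-var 4F refl) (runs-cons (runs-var 0F refl) (runs-var 2F refl)))
                  (runs-bind
                    (runs-call
                      (runs-cons (runs-var 5F refl) (runs-cons
                        (runs-≤ (⟦⟧-mono (bound Upd) eas≤)
                          (runs Upd (links-left (library Upd) (library Step) okUS) 0F (e , a , s) refl))
                        (runs-var 2F refl)))
                      (runs-loop ok w))
                    (runs-bind
                      (runs-cons (runs-var 6F refl) (runs-cons (runs-var 2F refl)
                        (runs-cons (runs-var 4F refl) (runs-var 0F refl))))
                      (runs-≤ (⟦⟧-mono (bound Step) easr≤)
                        (runs Step (links-right (library Upd) (library Step) okUS) 0F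
                          (e , a , s , rec e (upd (e , a , s)) as) refl))))))))

      -- The increase is bounded in terms of `e` and `a` alone. If the bound could involve `s`, the
      -- state might double at every element.
      module _ (cₛ : Polynomial) (upd-small : ∀ e a s → ‖ upd (e , a , s) ‖ ≤ ‖ s ‖ + ⟦ cₛ ⟧ ‖ e , a ‖) where

        stateᴾ : Polynomial
        stateᴾ = X ⊕ (X ⊗ cₛ ⟨ con 1 ⊕ (X ⊕ X) ⟩)

        private
          growth : ℕ → ℕ
          growth n = ⟦ cₛ ⟨ con 1 ⊕ (X ⊕ X) ⟩ ⟧ n

        -- The field `s+` is a budget: besides the present size of the state it contains one
        -- increase of `growth n` for each remaining element, of which `‖ as ‖` is an overestimate.
        -- An update moves one increase from the second summand to the first.
        record Reachable (n : ℕ) (e : E) (s : S) (as : List A) : Set where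
          constructor reachable
          field
            e≤  : ‖ e ‖ ≤ n
            as≤ : ‖ as ‖ ≤ n
            s+  : ‖ s ‖ + ‖ as ‖ * growth n ≤ ⟦ stateᴾ ⟧ n
          s≤ : ‖ s ‖ ≤ ⟦ stateᴾ ⟧ n
          s≤ = m+n≤o⇒m≤o ‖ s ‖ s+

        open Reachable

        start : ∀ e s as → Reachable ‖ e , s , as ‖ e s as
        start e s as = reachable (m≤n⇒m≤1+n (m≤m+n _ _)) as≤n
          (+-mono-≤ (m≤n⇒m≤1+n (≤-trans (m≤m+n ‖ s ‖ _) (≤-trans (n≤1+n _) (m≤n+m _ ‖ e ‖))))
                    (*-monoˡ-≤ (growth ‖ e , s , as ‖) as≤n))
          where
          as≤n : ‖ as ‖ ≤ ‖ e , s , as ‖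
          as≤n = m≤n⇒m≤1+n (≤-trans (≤-trans (m≤n+m ‖ as ‖ ‖ s ‖) (n≤1+n _)) (m≤n+m _ ‖ e ‖))

        module _ {n e s a as} (st : Reachable n e s (a ∷ as)) where

          a≤ : ‖ a ‖ ≤ n
          a≤ = ≤-trans (m≤n⇒m≤1+n (m≤m+n _ _)) (as≤ st)

          next : Reachable n e (upd (e , a , s)) as
          next = reachable (e≤ st) (≤-trans (m≤n⇒m≤1+n (m≤n+m _ ‖ a ‖)) (as≤ st)) (begin
            ‖ upd (e , a , s) ‖ + ‖ as ‖ * growth n     ≤⟨ +-monoˡ-≤ _ (upd-small e a s) ⟩
            (‖ s ‖ + ⟦ cₛ ⟧ ‖ e , a ‖) + ‖ as ‖ * growth n
              ≤⟨ +-monoˡ-≤ _ (+-monoʳ-≤ ‖ s ‖ (⟨⟩-bound cₛ (con 1 ⊕ (X ⊕ X)) (s≤s (+-mono-≤ (e≤ st) a≤)))) ⟩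
            (‖ s ‖ + growth n) + ‖ as ‖ * growth n      ≡⟨ +-assoc ‖ s ‖ _ _ ⟩
            ‖ s ‖ + suc ‖ as ‖ * growth n
              ≤⟨ +-monoʳ-≤ ‖ s ‖ (*-monoˡ-≤ (growth n) (s≤s (m≤n+m _ ‖ a ‖))) ⟩
            ‖ s ‖ + ‖ a ∷ as ‖ * growth n               ≤⟨ s+ st ⟩
            ⟦ stateᴾ ⟧ n                                ∎)
            where open ≤-Reasoning

        recursion-bounded : (qᵣ : Polynomial) → (∀ e s as → ‖ rec e s as ‖ ≤ ⟦ qᵣ ⟧ ‖ e , s , as ‖) →
                            PolyTime (λ (e , s , as) → rec e s as)
        recursion-bounded qᵣ rec-small = record
          { library = loopLibrary
          ; code    = λ ι i → call (ι zero) (var i)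
          ; bound   = (con 2 ⊕ (X ⊗ costᴾ ⟨ sizeᴾ ⟩)) ⊕ qᵣ
          ; runs    = λ ok i (e , s , as) eq → runs-≤
              (≤-trans (s≤s (s≤s (*-mono-≤ (as≤ (start e s as))
                                           (⟨⟩-bound costᴾ sizeᴾ ≤-refl)))) (m≤m+n _ _))
              (runs-call (runs-var i eq) (runs-loop ok (within (start e s as))))
          ; small   = λ (e , s , as) → ≤-trans (rec-small e s as) (m≤n+m _ _)
          }
          where
          costᴾ argᴾ sizeᴾ : Polynomial
          costᴾ = con 40 ⊕ (bound Finish ⊕ (bound Upd ⊕ bound Step))
          argᴾ  = con 2 ⊕ (X ⊕ (stateᴾ ⊕ X))
          sizeᴾ = con 3 ⊕ (X ⊕ (X ⊕ (stateᴾ ⊕ qᵣ ⟨ argᴾ ⟩)))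
          rec≤ : ∀ {n e s as} → Reachable n e s as → ‖ rec e s as ‖ ≤ ⟦ qᵣ ⟨ argᴾ ⟩ ⟧ n
          rec≤ {n} {e} {s} {as} st = ≤-trans (rec-small e s as) (⟨⟩-bound qᵣ argᴾ
            (≤-trans (s≤s (+-mono-≤ (e≤ st) (s≤s (+-mono-≤ (s≤ st) (as≤ st)))))
                     (≤-reflexive (cong suc (+-suc n _)))))
          triple≤ : ∀ {e a s r n m q} → e ≤ n → a ≤ n → s ≤ m → r ≤ q →
                    suc (e + suc (a + suc (s + r))) ≤ 3 + (n + (n + (m + q)))
          triple≤ {n = n} {m} {q} e≤ a≤ s≤ r≤ = ≤-trans
            (s≤s (+-mono-≤ e≤ (s≤s (+-mono-≤ a≤ (s≤s (+-mono-≤ s≤ r≤))))))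
            (≤-reflexive (shuffle n m q))
            where
            shuffle : ∀ n m q → suc (n + suc (n + suc (m + q))) ≡ 3 + (n + (n + (m + q)))
            shuffle = solve-∀
          within : ∀ {n e s as} → Reachable n e s as → Within (⟦ sizeᴾ ⟧ n) e s as
          within {as = []} st = [] (≤-trans
            (s≤s (+-monoʳ-≤ _ (≤-trans (m≤m+n _ 0) (≤-trans (n≤1+n _) (m≤n+m _ 1)))))
            (triple≤ (e≤ st) z≤n (s≤ st) z≤n))
          within {e = e} {s} {as = a ∷ as} st =
            (≤-trans (s≤s (+-monoʳ-≤ ‖ e ‖ (s≤s (+-monoʳ-≤ ‖ a ‖ (≤-trans (m≤m+n ‖ s ‖ 0) (n≤1+n _))))))
                     (triple≤ (e≤ st) (a≤ st) (s≤ st) z≤n) ,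
             triple≤ (e≤ st) (a≤ st) (s≤ st) (rec≤ (next st))) ∷ within (next st)

        -- The size of the result is the size of the final value plus the increases along the list.
        -- An increase may depend on the state, since `Reachable` bounds all states by a polynomial
        -- already, but not on `r`.
        recursion : (cᵣ : Polynomial) →
                    (∀ e a s r → ‖ step (e , a , s , r) ‖ ≤ ‖ r ‖ + ⟦ cᵣ ⟧ ‖ e , a , s ‖) →
                    PolyTime (λ (e , s , as) → rec e s as)
        recursion cᵣ step-small = recursion-bounded (finᴾ ⊕ (X ⊗ stepᴾ))
          (λ e s as → ≤-trans (rec≤ (start e s as))
            (+-monoʳ-≤ _ (*-monoˡ-≤ (⟦ stepᴾ ⟧ ‖ e , s , as ‖) (as≤ (start e s as)))))
          where
          finᴾ stepᴾ : Polynomial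
          finᴾ  = bound Finish ⟨ con 1 ⊕ (X ⊕ stateᴾ) ⟩
          stepᴾ = cᵣ ⟨ con 2 ⊕ (X ⊕ (X ⊕ stateᴾ)) ⟩
          rec≤ : ∀ {n e s as} → Reachable n e s as →
                 ‖ rec e s as ‖ ≤ ⟦ finᴾ ⟧ n + ‖ as ‖ * ⟦ stepᴾ ⟧ n
          rec≤ {e = e} {s} {[]} st = ≤-trans (small Finish (e , s)) (≤-trans
            (⟨⟩-bound (bound Finish) (con 1 ⊕ (X ⊕ stateᴾ)) (s≤s (+-mono-≤ (e≤ st) (s≤ st)))) (m≤m+n _ _))
          rec≤ {n} {e} {s} {a ∷ as} st = begin
            ‖ step (e , a , s , r) ‖                                 ≤⟨ step-small e a s r ⟩
            ‖ r ‖ + ⟦ cᵣ ⟧ ‖ e , a , s ‖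
              ≤⟨ +-mono-≤ (rec≤ (next st)) (⟨⟩-bound cᵣ (con 2 ⊕ (X ⊕ (X ⊕ stateᴾ)))
                   (≤-trans (s≤s (+-mono-≤ (e≤ st) (s≤s (+-mono-≤ (a≤ st) (s≤ st)))))
                            (≤-reflexive (cong suc (+-suc n _))))) ⟩
            (⟦ finᴾ ⟧ n + ‖ as ‖ * ⟦ stepᴾ ⟧ n) + ⟦ stepᴾ ⟧ n        ≡⟨ +-assoc (⟦ finᴾ ⟧ n) _ _ ⟩
            ⟦ finᴾ ⟧ n + (‖ as ‖ * ⟦ stepᴾ ⟧ n + ⟦ stepᴾ ⟧ n)        ≡⟨ cong (⟦ finᴾ ⟧ n +_) (+-comm (‖ as ‖ * _) _) ⟩
            ⟦ finᴾ ⟧ n + suc ‖ as ‖ * ⟦ stepᴾ ⟧ n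
              ≤⟨ +-monoʳ-≤ (⟦ finᴾ ⟧ n) (*-monoˡ-≤ (⟦ stepᴾ ⟧ n) (s≤s (m≤n+m _ ‖ a ‖))) ⟩
            ⟦ finᴾ ⟧ n + ‖ a ∷ as ‖ * ⟦ stepᴾ ⟧ n                    ∎
            where
            open ≤-Reasoning
            r = rec e (upd (e , a , s)) as

  module _ {E A R : Set} ⦃ _ : Encodable E ⦄ ⦃ _ : Encodable A ⦄ ⦃ _ : Encodable R ⦄
           {z : E → R} {f : E × A × R → R} (Z : PolyTime z) (F : PolyTime f) where

    private
      open module Rec = Recursion {E} {A} {⊤} {R} (z ∘ proj₁) (λ _ → tt)
                                  (λ (e , a , _ , r) → f (e , a , r))

      rec≡foldr : ∀ e as → rec e tt as ≡ foldr (λ a r → f (e , a , r)) (z e) as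
      rec≡foldr e []       = refl
      rec≡foldr e (a ∷ as) = cong (λ r → f (e , a , r)) (rec≡foldr e as)

      Finish : PolyTime {E × ⊤} (z ∘ proj₁)
      Finish = Z ∘ᴾ fstᴾ

      Step : PolyTime {E × A × ⊤ × R} (λ (e , a , _ , r) → f (e , a , r))
      Step = F ∘ᴾ (fstᴾ ,ᴾ fstᴾ ∘ᴾ sndᴾ ,ᴾ sndᴾ ∘ᴾ sndᴾ ∘ᴾ sndᴾ)

      start-with-tt : PolyTime (λ (e , as) → rec e tt as) →
                      PolyTime (λ (e , as) → foldr (λ a r → f (e , a , r)) (z e) as)
      start-with-tt = polyTime-cong λ (e , as) → rec≡foldr e as

      insert-tt : PolyTime {E × List A} (λ (e , as) → e , tt , as)
      insert-tt = fstᴾ ,ᴾ constᴾ tt ,ᴾ sndᴾ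

    foldrᴾ : (c : Polynomial) → (∀ e a r → ‖ f (e , a , r) ‖ ≤ ‖ r ‖ + ⟦ c ⟧ ‖ e , a ‖) →
             PolyTime (λ (e , as) → foldr (λ a r → f (e , a , r)) (z e) as)
    foldrᴾ c f-small = start-with-tt
      (recursion Finish (constᴾ tt) Step (con 0) (λ _ _ _ → ≤-refl) c
        (λ e a _ r → ≤-trans (f-small e a r) (+-monoʳ-≤ ‖ r ‖ (⟦⟧-mono c
          (s≤s (+-monoʳ-≤ ‖ e ‖ (≤-trans (m≤m+n ‖ a ‖ 1) (n≤1+n _)))))))
      ∘ᴾ insert-tt)

    -- For steps without a suitable bound on their increase: the size of the whole fold is bounded
    -- by other means.
    foldr-boundedᴾ : (q : Polynomial) →
      (∀ e as → ‖ foldr (λ a r → f (e , a , r)) (z e) as ‖ ≤ ⟦ q ⟧ ‖ e , as ‖) →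
      PolyTime (λ (e , as) → foldr (λ a r → f (e , a , r)) (z e) as)
    foldr-boundedᴾ q small = start-with-tt
      (recursion-bounded Finish (constᴾ tt) Step (con 0) (λ _ _ _ → ≤-refl) q
        (λ e _ as → subst (λ r → ‖ r ‖ ≤ ⟦ q ⟧ ‖ e , tt , as ‖) (sym (rec≡foldr e as))
          (≤-trans (small e as) (⟦⟧-mono q (s≤s (+-monoʳ-≤ ‖ e ‖ (m≤n+m ‖ as ‖ 2))))))
      ∘ᴾ insert-tt)

  -- Lists, unary numbers and Booleans

  module _ {A : Set} ⦃ _ : Encodable A ⦄ where

    headOr : A → List A → A
    headOr d []      = d
    headOr d (x ∷ _) = x

    tail : List A → List A
    tail []       = []
    tail (_ ∷ xs) = xs

    nonEmpty : List A → Bool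
    nonEmpty []      = false
    nonEmpty (_ ∷ _) = true

    headOrᴾ : ∀ d → PolyTime (headOr d)
    headOrᴾ d = record
      { library = emptyLibrary
      ; code    = λ ι i → match (var i) (literal (encode d)) (var 0F)
      ; bound   = con (2 + ‖ d ‖) ⊕ X
      ; runs    = λ { ok i [] eq → runs-≤ (m≤m+n _ _)
                        (runs-match-nil (runs-var i eq) (runs-literal (encode d)))
                    ; ok i (x ∷ xs) eq → runs-≤ (≤-trans (+-monoʳ-≤ 2 (≤-trans (0<size _) (m≤m+n ‖ x ‖ _)))
                                                         (+-mono-≤ (m≤m+n 2 ‖ d ‖) (n≤1+n _)))
                        (runs-match-cons (runs-var i eq) (runs-var 0F refl)) }
      ; small   = λ { [] → ≤-trans (m≤n+m _ 2) (m≤m+n _ _)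
                    ; (x ∷ xs) → ≤-trans (m≤n⇒m≤1+n (m≤m+n ‖ x ‖ _)) (m≤n+m _ (2 + ‖ d ‖)) }
      }

    tailᴾ : PolyTime tail
    tailᴾ = record
      { library = emptyLibrary
      ; code    = λ ι i → match (var i) nil (var 1F)
      ; bound   = con 3 ⊕ X
      ; runs    = λ { ok i [] eq → runs-≤ (m≤m+n 3 _) (runs-match-nil (runs-var i eq) runs-nil)
                    ; ok i (x ∷ xs) eq → runs-≤ (m≤m+n 3 _)
                        (runs-match-cons (runs-var i eq) (runs-var 1F refl)) }
      ; small   = λ { [] → m≤n+m _ 3 ; (x ∷ xs) → ≤-trans (m≤n+m _ _) (m≤n+m _ 4) }
      }

    ‖tail‖ : ∀ xs → ‖ tail xs ‖ ≤ ‖ xs ‖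
    ‖tail‖ []       = ≤-refl
    ‖tail‖ (x ∷ xs) = m≤n⇒m≤1+n (m≤n+m _ _)

    nonEmptyᴾ : PolyTime nonEmpty
    nonEmptyᴾ = record
      { library = emptyLibrary
      ; code    = λ ι i → match (var i) nil (cons nil nil)
      ; bound   = con 5
      ; runs    = λ { ok i [] eq → runs-≤ (m≤m+n 3 2) (runs-match-nil (runs-var i eq) runs-nil)
                    ; ok i (x ∷ xs) eq → runs-match-cons (runs-var i eq) (runs-cons runs-nil runs-nil) }
      ; small   = λ { [] → m≤m+n 1 4 ; (x ∷ xs) → m≤m+n 3 2 }
      }

  ‖++‖ : {A : Set} ⦃ _ : Encodable A ⦄ (xs ys : List A) → ‖ xs ++ ys ‖ ≤ ‖ ys ‖ + ‖ xs ‖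
  ‖++‖ []       ys = m≤m+n _ _
  ‖++‖ (x ∷ xs) ys = begin
    suc (‖ x ‖ + ‖ xs ++ ys ‖)       ≤⟨ s≤s (+-monoʳ-≤ ‖ x ‖ (‖++‖ xs ys)) ⟩
    suc (‖ x ‖ + (‖ ys ‖ + ‖ xs ‖))  ≡⟨ cong suc (x∙yz≈y∙xz +-commutativeSemigroup ‖ x ‖ (‖ ys ‖) (‖ xs ‖)) ⟩
    suc (‖ ys ‖ + (‖ x ‖ + ‖ xs ‖))  ≡⟨ +-suc _ _ ⟨
    ‖ ys ‖ + suc (‖ x ‖ + ‖ xs ‖)    ∎
    where
    open ≤-Reasoning

  ‖∷‖ : {A : Set} ⦃ _ : Encodable A ⦄ (x : A) (xs : List A) → ‖ x ∷ xs ‖ ≡ ‖ xs ‖ + suc ‖ x ‖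
  ‖∷‖ x xs = trans (cong suc (+-comm ‖ x ‖ _)) (sym (+-suc _ _))

  module _ {E A B : Set} ⦃ _ : Encodable E ⦄ ⦃ _ : Encodable A ⦄ ⦃ _ : Encodable B ⦄ where

    mapᴾ : {f : E × A → B} → PolyTime f → PolyTime (λ (e , as) → map (λ a → f (e , a)) as)
    mapᴾ {f} F = polyTime-cong (λ (e , as) → foldr≡map e as) (foldrᴾ
      (constᴾ []) (consᴾ (F ∘ᴾ (fstᴾ ,ᴾ fstᴾ ∘ᴾ sndᴾ)) (sndᴾ ∘ᴾ sndᴾ)) (con 1 ⊕ bound F)
      λ e a r → ≤-trans (≤-reflexive (‖∷‖ (f (e , a)) r)) (+-monoʳ-≤ ‖ r ‖ (s≤s (small F (e , a)))))
      where
      foldr≡map : ∀ e as → foldr (λ a → f (e , a) ∷_) [] as ≡ map (λ a → f (e , a)) as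
      foldr≡map e []       = refl
      foldr≡map e (a ∷ as) = cong (f (e , a) ∷_) (foldr≡map e as)

  module _ {A : Set} ⦃ _ : Encodable A ⦄ where

    appendᴾ : PolyTime {List A × List A} (λ (xs , ys) → xs ++ ys)
    appendᴾ = polyTime-cong (λ (ys , xs) → foldr≡++ ys xs)
      (foldrᴾ {E = List A} idᴾ (consᴾ (fstᴾ ∘ᴾ sndᴾ) (sndᴾ ∘ᴾ sndᴾ)) (con 1 ⊕ X) λ ys a r →
        ≤-trans (≤-reflexive (‖∷‖ a r)) (+-monoʳ-≤ ‖ r ‖ (s≤s (m≤n⇒m≤1+n (m≤n+m _ _))))) ∘ᴾ (sndᴾ ,ᴾ fstᴾ)
      where
      foldr≡++ : ∀ ys xs → foldr _∷_ ys xs ≡ xs ++ ys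
      foldr≡++ ys []       = refl
      foldr≡++ ys (x ∷ xs) = cong (x ∷_) (foldr≡++ ys xs)

  -- A unary number and a list of units have the same tree. Recursion on numbers is thereby
  -- recursion on lists.
  unitsᴾ : PolyTime (λ n → replicate n tt)
  unitsᴾ = recode encode-units
    where
    encode-units : ∀ n → encodeUnary n ≡ encode (replicate n tt)
    encode-units zero    = refl
    encode-units (suc n) = cong (nil ∙_) (encode-units n)

  count-unitsᴾ : PolyTime {List ⊤} length
  count-unitsᴾ = recode encode-length
    where
    encode-length : (us : List ⊤) → encode us ≡ encodeUnary (length us)
    encode-length []       = refl
    encode-length (_ ∷ us) = cong (nil ∙_) (encode-length us)

  sucᴾ : PolyTime suc
  sucᴾ = recode {A = ⊤ × ℕ} {f = λ (_ , n) → suc n} (λ _ → refl) ∘ᴾ (constᴾ tt ,ᴾ idᴾ)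

  module _ {A : Set} ⦃ _ : Encodable A ⦄ where

    lengthᴾ : PolyTime {List A} length
    lengthᴾ = polyTime-cong length-map-tt (count-unitsᴾ ∘ᴾ mapᴾ {E = ⊤} (constᴾ tt) ∘ᴾ (constᴾ tt ,ᴾ idᴾ))
      where
      length-map-tt : (xs : List A) → length (map (λ _ → tt) xs) ≡ length xs
      length-map-tt []       = refl
      length-map-tt (_ ∷ xs) = cong suc (length-map-tt xs)

    dropᴾ : PolyTime {ℕ × List A} (λ (n , xs) → drop n xs)
    dropᴾ = polyTime-cong (λ (n , xs) → rec≡drop n xs)
      (recursion sndᴾ (tailᴾ ∘ᴾ sndᴾ ∘ᴾ sndᴾ) (sndᴾ ∘ᴾ sndᴾ ∘ᴾ sndᴾ)
        (con 0) (λ _ _ xs → ≤-trans (‖tail‖ xs) (m≤m+n _ 0)) (con 0) (λ _ _ _ r → m≤m+n ‖ r ‖ 0)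
      ∘ᴾ (constᴾ tt ,ᴾ sndᴾ ,ᴾ unitsᴾ ∘ᴾ fstᴾ))
      where
      open Recursion {⊤} {⊤} {List A} {List A} proj₂ (λ (_ , _ , xs) → tail xs) (λ (_ , _ , _ , r) → r)
      rec≡drop : ∀ n xs → rec tt xs (replicate n tt) ≡ drop n xs
      rec≡drop zero    xs       = refl
      rec≡drop (suc n) (x ∷ xs) = rec≡drop n xs
      rec≡drop (suc n) []       = trans (rec≡drop n []) (drop-[] n)
        where
        drop-[] : ∀ n → drop {A = A} n [] ≡ []
        drop-[] zero    = refl
        drop-[] (suc n) = refl

    nth : A → List A → ℕ → A
    nth d xs n = headOr d (drop n xs)

    nthᴾ : ∀ d → PolyTime (λ (xs , n) → nth d xs n)
    nthᴾ d = headOrᴾ d ∘ᴾ dropᴾ ∘ᴾ (sndᴾ ,ᴾ fstᴾ)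

  ∸ᴾ : PolyTime {ℕ × ℕ} (λ (m , n) → m ∸ n)
  ∸ᴾ = polyTime-cong (λ (m , n) → length-drop-units m n)
    (count-unitsᴾ ∘ᴾ dropᴾ ∘ᴾ (sndᴾ ,ᴾ unitsᴾ ∘ᴾ fstᴾ))
    where
    length-drop-units : ∀ m n → length (drop n (replicate m tt)) ≡ m ∸ n
    length-drop-units m       zero    = length-replicate m
    length-drop-units zero    (suc n) = refl
    length-drop-units (suc m) (suc n) = length-drop-units m n

  +ᴾ : PolyTime {ℕ × ℕ} (λ (m , n) → m + n)
  +ᴾ = polyTime-cong (λ (m , n) → length-++-units m n)
    (count-unitsᴾ ∘ᴾ appendᴾ ∘ᴾ (unitsᴾ ∘ᴾ fstᴾ ,ᴾ unitsᴾ ∘ᴾ sndᴾ))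
    where
    length-++-units : ∀ m n → length (replicate m tt ++ replicate n tt) ≡ m + n
    length-++-units zero    n = length-replicate n
    length-++-units (suc m) n = cong suc (length-++-units m n)

  ‖+‖ : ∀ m n → ‖ m + n ‖ ≤ ‖ n ‖ + ‖ m ‖
  ‖+‖ zero    n = m≤m+n _ _
  ‖+‖ (suc m) n = ≤-trans (s≤s (s≤s (‖+‖ m n)))
    (≤-reflexive (sym (trans (+-suc ‖ n ‖ _) (cong suc (+-suc ‖ n ‖ ‖ m ‖)))))

  *ᴾ : PolyTime {ℕ × ℕ} (λ (m , n) → m * n)
  *ᴾ = polyTime-cong (λ (m , n) → foldr≡* m n)
    (foldrᴾ {E = ℕ} {A = ⊤} (constᴾ 0) (+ᴾ ∘ᴾ (fstᴾ ,ᴾ sndᴾ ∘ᴾ sndᴾ)) X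
      (λ n _ r → ≤-trans (‖+‖ n r) (+-monoʳ-≤ ‖ r ‖ (m≤n⇒m≤1+n (m≤m+n _ _))))
    ∘ᴾ (sndᴾ ,ᴾ unitsᴾ ∘ᴾ fstᴾ))
    where
    foldr≡* : ∀ m n → foldr (λ _ r → n + r) 0 (replicate m tt) ≡ m * n
    foldr≡* zero    n = refl
    foldr≡* (suc m) n = cong (n +_) (foldr≡* m n)

  ∧ᴾ : PolyTime {Bool × Bool} (λ (x , y) → x ∧ y)
  ∧ᴾ = polyTime-cong (λ { (true , y) → refl ; (false , y) → refl }) (ifᴾ fstᴾ sndᴾ (constᴾ false))

  ∨ᴾ : PolyTime {Bool × Bool} (λ (x , y) → x ∨ y)
  ∨ᴾ = polyTime-cong (λ { (true , y) → refl ; (false , y) → refl }) (ifᴾ fstᴾ (constᴾ true) sndᴾ)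

  notᴾ : PolyTime not
  notᴾ = polyTime-cong (λ { true → refl ; false → refl }) (ifᴾ idᴾ (constᴾ false) (constᴾ true))

  -- A single recursion, which toggles the flag at every unit, rounds either way.
  halve : Bool → ℕ → ℕ
  halve roundUp n = if roundUp then ⌈ n /2⌉ else ⌊ n /2⌋

  halveᴾ : PolyTime (uncurry halve)
  halveᴾ = polyTime-cong (λ (b , n) → rec≡halve b n)
    (recursion (constᴾ 0) (notᴾ ∘ᴾ sndᴾ ∘ᴾ sndᴾ)
      (ifᴾ (fstᴾ ∘ᴾ sndᴾ ∘ᴾ sndᴾ) (sucᴾ ∘ᴾ sndᴾ ∘ᴾ sndᴾ ∘ᴾ sndᴾ) (sndᴾ ∘ᴾ sndᴾ ∘ᴾ sndᴾ))
      (con 2) (λ { _ _ true → m≤m+n 1 _ ; _ _ false → ≤-refl })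
      (con 2) (λ { _ _ true r → ≤-reflexive (+-comm 2 _) ; _ _ false r → m≤m+n _ 2 })
    ∘ᴾ (constᴾ tt ,ᴾ fstᴾ ,ᴾ unitsᴾ ∘ᴾ sndᴾ))
    where
    open Recursion {⊤} {⊤} {Bool} {ℕ} (λ _ → 0) (λ (_ , _ , b) → not b)
                   (λ (_ , _ , b , r) → if b then suc r else r)
    rec≡halve : ∀ b n → rec tt b (replicate n tt) ≡ halve b n
    rec≡halve true  zero    = refl
    rec≡halve false zero    = refl
    rec≡halve true  (suc n) = cong suc (rec≡halve false n)
    rec≡halve false (suc n) = rec≡halve true n

  positive : ℕ → Bool
  positive zero    = false
  positive (suc _) = true

  positiveᴾ : PolyTime positive
  positiveᴾ = polyTime-cong (λ { zero → refl ; (suc _) → refl }) (nonEmptyᴾ ∘ᴾ unitsᴾ)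

  enumFrom : ℕ → ℕ → List ℕ
  enumFrom i zero    = []
  enumFrom i (suc n) = i ∷ enumFrom (suc i) n

  enumFromᴾ : PolyTime (uncurry enumFrom)
  enumFromᴾ = polyTime-cong (λ (i , n) → rec≡enumFrom i n)
    (recursion (constᴾ []) (sucᴾ ∘ᴾ sndᴾ ∘ᴾ sndᴾ) (consᴾ (fstᴾ ∘ᴾ sndᴾ ∘ᴾ sndᴾ) (sndᴾ ∘ᴾ sndᴾ ∘ᴾ sndᴾ))
      (con 2) (λ _ _ i → ≤-reflexive (+-comm 2 _))
      X (λ _ _ i r → ≤-trans (≤-reflexive (‖∷‖ i r)) (+-monoʳ-≤ ‖ r ‖ (m≤n+m (suc ‖ i ‖) 3)))
    ∘ᴾ (constᴾ tt ,ᴾ fstᴾ ,ᴾ unitsᴾ ∘ᴾ sndᴾ))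
    where
    open Recursion {⊤} {⊤} {ℕ} {List ℕ} (λ _ → []) (λ (_ , _ , i) → suc i) (λ (_ , _ , i , r) → i ∷ r)
    rec≡enumFrom : ∀ i n → rec tt i (replicate n tt) ≡ enumFrom i n
    rec≡enumFrom i zero    = refl
    rec≡enumFrom i (suc n) = cong (i ∷_) (rec≡enumFrom (suc i) n)

  -- Binary numerals, rational numbers and comparison

  ‖Bool‖≤3 : (b : Bool) → ‖ b ‖ ≤ 3
  ‖Bool‖≤3 true  = ≤-refl
  ‖Bool‖≤3 false = m≤m+n 1 2

  -- The least significant digit comes first.  As in ℕᵇ, the digit true
  -- stands for 1 and the digit false for 2.

  digits : ℕᵇ → List Bool
  digits ℕᵇ.zero   = []
  digits 2[1+ b ]  = false ∷ digits b
  digits 1+[2 b ]  = true ∷ digits b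

  encode-digits : ∀ b → encodeℕᵇ b ≡ encode (digits b)
  encode-digits ℕᵇ.zero  = refl
  encode-digits 2[1+ b ] = cong (nil ∙_) (encode-digits b)
  encode-digits 1+[2 b ] = cong ((nil ∙ nil) ∙_) (encode-digits b)

  -- With digits 1 and 2, a carry turns 1 into 2 and stops, and turns 2 into 3 = 1 + 2, that is,
  -- into 1 with a new carry. Either way the digit is negated, and only `false` passes the carry on.
  increment : Bool → List Bool → List Bool
  increment carry []       = if carry then true ∷ [] else []
  increment carry (b ∷ bs) = (if carry then not b else b) ∷ increment (carry ∧ not b) bs

  increment-false : ∀ bs → increment false bs ≡ bs
  increment-false []       = refl
  increment-false (b ∷ bs) = cong (b ∷_) (increment-false bs)

  digits-suc : ∀ b → digits (ℕᵇ.suc b) ≡ increment true (digits b)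
  digits-suc ℕᵇ.zero  = refl
  digits-suc 2[1+ b ] = cong (true ∷_) (digits-suc b)
  digits-suc 1+[2 b ] = cong (false ∷_) (sym (increment-false (digits b)))

  incrementᴾ : PolyTime (increment true)
  incrementᴾ = polyTime-cong (rec≡increment true)
    (recursion (ifᴾ sndᴾ (constᴾ (true ∷ [])) (constᴾ []))
      (∧ᴾ ∘ᴾ (sndᴾ ∘ᴾ sndᴾ ,ᴾ notᴾ ∘ᴾ fstᴾ ∘ᴾ sndᴾ))
      (consᴾ (ifᴾ (fstᴾ ∘ᴾ sndᴾ ∘ᴾ sndᴾ) (notᴾ ∘ᴾ fstᴾ ∘ᴾ sndᴾ) (fstᴾ ∘ᴾ sndᴾ))
             (sndᴾ ∘ᴾ sndᴾ ∘ᴾ sndᴾ))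
      (con 3) (λ _ b c → ≤-trans (‖Bool‖≤3 (c ∧ not b)) (m≤n+m 3 _))
      (con 4) (λ _ b c r → ≤-trans (≤-reflexive (‖∷‖ (if c then not b else b) r))
        (+-monoʳ-≤ ‖ r ‖ (s≤s (‖Bool‖≤3 (if c then not b else b)))))
    ∘ᴾ (constᴾ tt ,ᴾ constᴾ true ,ᴾ idᴾ))
    where
    open Recursion {⊤} {Bool} {Bool} {List Bool} (λ (_ , c) → if c then true ∷ [] else [])
      (λ (_ , b , c) → c ∧ not b) (λ (_ , b , c , r) → (if c then not b else b) ∷ r)
    rec≡increment : ∀ c bs → rec tt c bs ≡ increment c bs
    rec≡increment c []       = refl
    rec≡increment c (b ∷ bs) = cong (_ ∷_) (rec≡increment (c ∧ not b) bs)

  length-increment : ∀ c bs → length (increment c bs) ≤ suc (length bs)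
  length-increment true  []       = ≤-refl
  length-increment false []       = z≤n
  length-increment c     (b ∷ bs) = s≤s (length-increment (c ∧ not b) bs)

  ‖List-Bool‖ : (bs : List Bool) → ‖ bs ‖ ≤ suc (length bs * 4)
  ‖List-Bool‖ []       = ≤-refl
  ‖List-Bool‖ (b ∷ bs) = s≤s (≤-trans (+-mono-≤ (‖Bool‖≤3 b) (‖List-Bool‖ bs)) (≤-reflexive (+-suc 3 _)))

  -- A carry can turn a long run of `false` into `true`, whose trees are larger, so one increment
  -- has no bound on its increase that is independent of the numeral. Its length, however, grows by
  -- at most one, and bounds its size.
  digitsᴾ : PolyTime (λ n → digits (ℕᵇ.fromℕ n))
  digitsᴾ = polyTime-cong foldr≡digits
    (foldr-boundedᴾ {E = ⊤} {A = ⊤} (constᴾ []) (incrementᴾ ∘ᴾ sndᴾ ∘ᴾ sndᴾ) (con 1 ⊕ (X ⊗ con 4))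
      (λ _ us → ≤-trans (‖List-Bool‖ (foldr (λ _ → increment true) [] us))
        (s≤s (*-monoˡ-≤ 4 (≤-trans (length≤ us) (m≤n+m _ 2)))))
    ∘ᴾ (constᴾ tt ,ᴾ unitsᴾ))
    where
    foldr≡digits : ∀ n → foldr (λ _ → increment true) [] (replicate n tt) ≡ digits (ℕᵇ.fromℕ n)
    foldr≡digits n = trans (foldr≡digits′ n) (cong digits (sym (fromℕ≡fromℕ' n)))
      where
      foldr≡digits′ : ∀ n → foldr (λ _ → increment true) [] (replicate n tt) ≡ digits (ℕᵇ.fromℕ' n)
      foldr≡digits′ zero    = refl
      foldr≡digits′ (suc n) = trans (cong (increment true) (foldr≡digits′ n)) (sym (digits-suc (ℕᵇ.fromℕ' n)))
    length≤ : (us : List ⊤) → length (foldr (λ _ → increment true) [] us) ≤ ‖ us ‖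
    length≤ []       = z≤n
    length≤ (_ ∷ us) = ≤-trans (length-increment true (foldr (λ _ → increment true) [] us)) (s≤s (m≤n⇒m≤1+n (length≤ us)))

  numeratorᴾ : PolyTime (λ q → digits (ℕᵇ.fromℕ ∣ ↥ q ∣))
  numeratorᴾ = sndᴾ ∘ᴾ fstᴾ ∘ᴾ
    recode {B = (Tree × List Bool) × Tree} {f = λ q → (sign (↥ q) , digits (ℕᵇ.fromℕ ∣ ↥ q ∣)) , encodeℕ (↧ₙ q)}
      (λ q → cong (_∙ encodeℕ (↧ₙ q)) (encode-signed (↥ q)))
    where
    sign : ℤ → Tree
    sign (ℤ.+ _)     = encodeBool false
    sign ℤ.-[1+ _ ]  = encodeBool true
    encode-signed : ∀ i → encodeℤ i ≡ sign i ∙ encode (digits (ℕᵇ.fromℕ ∣ i ∣))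
    encode-signed (ℤ.+ n)    = cong (_ ∙_) (encode-digits (ℕᵇ.fromℕ n))
    encode-signed ℤ.-[1+ n ] = cong (_ ∙_) (encode-digits (ℕᵇ.fromℕ (suc n)))

  denominatorᴾ : PolyTime (λ q → digits (ℕᵇ.fromℕ (↧ₙ q)))
  denominatorᴾ = sndᴾ ∘ᴾ recode {B = Tree × List Bool} {f = λ q → encodeℤ (↥ q) , digits (ℕᵇ.fromℕ (↧ₙ q))}
    (λ q → cong (encodeℤ (↥ q) ∙_) (encode-digits (ℕᵇ.fromℕ (↧ₙ q))))

  -- sumLess a b xs ys decides a + Σ xsᵢ 2ⁱ < b + Σ ysᵢ 2ⁱ, if ys is not longer than
  -- xs: with d the difference of a + xs₀ and b + ys₀, half of it is carried to
  -- the larger side, rounded up on the right since 2 x < 2 y + d iff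
  -- x < y + ⌈ d /2⌉, and down on the left since 2 x + d < 2 y iff x + ⌊ d /2⌋ < y.

  sumLess : ℕ → ℕ → List ℕ → List ℕ → Bool
  sumLess a b []       ys = positive (b ∸ a)
  sumLess a b (x ∷ xs) ys =
    sumLess ⌊ (a + x) ∸ (b + headOr 0 ys) /2⌋ ⌈ (b + headOr 0 ys) ∸ (a + x) /2⌉ xs (tail ys)

  sumLessᴾ : PolyTime (λ (xs , ys) → sumLess 0 0 xs ys)
  sumLessᴾ = polyTime-cong (λ (xs , ys) → rec≡sumLess 0 0 xs ys)
    (recursion (positiveᴾ ∘ᴾ ∸ᴾ ∘ᴾ (fstᴾ ∘ᴾ sndᴾ ∘ᴾ sndᴾ ,ᴾ fstᴾ ∘ᴾ sndᴾ)) Upd (sndᴾ ∘ᴾ sndᴾ ∘ᴾ sndᴾ)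
      X upd-small (con 0) (λ _ _ _ r → m≤m+n ‖ r ‖ 0)
    ∘ᴾ (constᴾ tt ,ᴾ (constᴾ 0 ,ᴾ constᴾ 0 ,ᴾ sndᴾ) ,ᴾ fstᴾ))
    where
    State : Set
    State = ℕ × ℕ × List ℕ
    left′ right′ : ⊤ × ℕ × State → ℕ
    left′  (_ , x , a , b , ys) = a + x
    right′ (_ , x , a , b , ys) = b + headOr 0 ys
    Left : PolyTime left′
    Left = +ᴾ ∘ᴾ (fstᴾ ∘ᴾ sndᴾ ∘ᴾ sndᴾ ,ᴾ fstᴾ ∘ᴾ sndᴾ)
    Right : PolyTime right′
    Right = +ᴾ ∘ᴾ (fstᴾ ∘ᴾ sndᴾ ∘ᴾ sndᴾ ∘ᴾ sndᴾ ,ᴾ headOrᴾ 0 ∘ᴾ sndᴾ ∘ᴾ sndᴾ ∘ᴾ sndᴾ ∘ᴾ sndᴾ)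
    upd : ⊤ × ℕ × State → State
    upd z@(_ , x , a , b , ys) = ⌊ left′ z ∸ right′ z /2⌋ , ⌈ right′ z ∸ left′ z /2⌉ , tail ys
    Upd : PolyTime upd
    Upd = halveᴾ ∘ᴾ (constᴾ false ,ᴾ ∸ᴾ ∘ᴾ (Left ,ᴾ Right)) ,ᴾ
          halveᴾ ∘ᴾ (constᴾ true ,ᴾ ∸ᴾ ∘ᴾ (Right ,ᴾ Left)) ,ᴾ
          tailᴾ ∘ᴾ sndᴾ ∘ᴾ sndᴾ ∘ᴾ sndᴾ ∘ᴾ sndᴾ
    open Recursion {⊤} {ℕ} {State} {Bool} (λ (_ , a , b , ys) → positive (b ∸ a)) upd (λ (_ , _ , _ , r) → r)
    ‖ℕ‖-mono : ∀ {m n} → m ≤ n → ‖ m ‖ ≤ ‖ n ‖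
    ‖ℕ‖-mono {n = n} z≤n = 0<size (encode n)
    ‖ℕ‖-mono (s≤s m≤n)   = s≤s (s≤s (‖ℕ‖-mono m≤n))
    -- The head of `ys` that is added to `b` leaves the list at the same time, so `x` is the only
    -- new contribution to the state.
    upd-small : ∀ e x s → ‖ upd (e , x , s) ‖ ≤ ‖ s ‖ + ‖ e , x ‖
    upd-small e x s@(a , b , ys) = begin
      suc (‖ a′ ‖ + suc (‖ b′ ‖ + ‖ tail ys ‖))
        ≤⟨ s≤s (+-mono-≤ a′-small (s≤s (b′-small ys))) ⟩
      suc ((‖ x ‖ + ‖ a ‖) + suc (‖ b ‖ + ‖ ys ‖))          ≡⟨ cong suc (+-assoc ‖ x ‖ (‖ a ‖) _) ⟩
      suc (‖ x ‖ + (‖ a ‖ + suc (‖ b ‖ + ‖ ys ‖)))          ≡⟨ +-comm _ (‖ a ‖ + suc (‖ b ‖ + ‖ ys ‖)) ⟩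
      (‖ a ‖ + suc (‖ b ‖ + ‖ ys ‖)) + suc ‖ x ‖            ≤⟨ +-mono-≤ (n≤1+n _) (n≤1+n _) ⟩
      ‖ s ‖ + ‖ e , x ‖                                     ∎
      where
      open ≤-Reasoning
      a′ b′ : ℕ
      a′ = proj₁ (upd (e , x , s))
      b′ = proj₁ (proj₂ (upd (e , x , s)))
      a′-small : ‖ a′ ‖ ≤ ‖ x ‖ + ‖ a ‖
      a′-small = ≤-trans (‖ℕ‖-mono (≤-trans (⌊n/2⌋≤n _) (m∸n≤m (a + x) (b + headOr 0 ys)))) (‖+‖ a x)
      b′-small : ∀ ys → ‖ ⌈ (b + headOr 0 ys) ∸ (a + x) /2⌉ ‖ + ‖ tail ys ‖ ≤ ‖ b ‖ + ‖ ys ‖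
      b′-small []       = +-monoˡ-≤ 1 (‖ℕ‖-mono
        (≤-trans (⌈n/2⌉≤n _) (≤-trans (m∸n≤m (b + 0) (a + x)) (≤-reflexive (+-identityʳ b)))))
      b′-small (y ∷ ys) = begin
        ‖ ⌈ (b + y) ∸ (a + x) /2⌉ ‖ + ‖ ys ‖
          ≤⟨ +-monoˡ-≤ ‖ ys ‖ (≤-trans (‖ℕ‖-mono (≤-trans (⌈n/2⌉≤n _) (m∸n≤m (b + y) (a + x)))) (‖+‖ b y)) ⟩
        (‖ y ‖ + ‖ b ‖) + ‖ ys ‖   ≡⟨ cong (_+ ‖ ys ‖) (+-comm ‖ y ‖ _) ⟩
        (‖ b ‖ + ‖ y ‖) + ‖ ys ‖   ≡⟨ +-assoc ‖ b ‖ _ _ ⟩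
        ‖ b ‖ + (‖ y ‖ + ‖ ys ‖)   ≤⟨ +-monoʳ-≤ ‖ b ‖ (n≤1+n _) ⟩
        ‖ b ‖ + ‖ y ∷ ys ‖         ∎
    rec≡sumLess : ∀ a b xs ys → rec tt (a , b , ys) xs ≡ sumLess a b xs ys
    rec≡sumLess a b []       ys = refl
    rec≡sumLess a b (x ∷ xs) ys = rec≡sumLess _ _ xs (tail ys)

-- The algorithm: balls around the sources

module Algorithm where

  open import Defs
  open import Data.Bool.Base using (Bool; true; false; if_then_else_; not; _∧_; _∨_)
  open import Data.Bool.ListAction using (any)
  open import Data.Integer.Base using (∣_∣)
  open import Data.List.Base using (List; []; _∷_; _++_; foldr; map; replicate; length; zipWith)
  open import Data.List.Properties using (length-++; length-map)
  open import Data.Nat.Base hiding (less)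
  open import Data.Nat.Binary.Base as ℕᵇ using (ℕᵇ; 2[1+_]; 1+[2_])
  open import Data.Nat.Binary.Properties using (toℕ-fromℕ)
  open import Data.Nat.DivMod using (_/_; m<n*o⇒m/o<n; m*n/n≡m; /-monoˡ-≤)
  open import Data.Nat.Properties
  open import Data.Nat.Tactic.RingSolver using (solve-∀)
  open import Data.Product.Base using (_×_; _,_; proj₁; proj₂; uncurry)
  open import Data.Rational.Base using (ℚ; ↥_; ↧ₙ_)
  open import Data.Sum.Base using (inj₁; inj₂)
  open import Data.Unit.Base using (⊤; tt)
  open import Function.Base using (_∘_; id; flip)
  open import Function.Bundles using (_⇔_; mk⇔; Equivalence)
  open import Function.Properties.Equivalence using () renaming (sym to ⇔-sym; trans to ⇔-trans)
  open import Relation.Binary.PropositionalEquality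
  open import Relation.Nullary.Decidable using (proof)
  open import Relation.Nullary.Reflects using (Reflects; ofʸ; ofⁿ; det)

  open PolynomialTime
  open PolyTime

  -- Multiplication digit by digit, without carries: the digits are unary numbers.
  scale : ℕ → List Bool → List ℕ
  scale c = map (λ b → if b then c else c + c)

  scaleᴾ : PolyTime (uncurry scale)
  scaleᴾ = mapᴾ (ifᴾ sndᴾ fstᴾ (+ᴾ ∘ᴾ (fstᴾ ,ᴾ fstᴾ)))

  numerator denominator : ℚ → List Bool
  numerator q   = digits (ℕᵇ.fromℕ ∣ ↥ q ∣)
  denominator q = digits (ℕᵇ.fromℕ (↧ₙ q))

  -- The test `q < j / N` for nonnegative `q`, cross-multiplied. The zeros, one for each digit of
  -- the denominator, ensure that the first list is at least as long as the second, as `sumLess`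
  -- requires.
  below : ℕ → ℕ → ℚ → Bool
  below N j q = sumLess 0 0 (scale N (numerator q) ++ map (λ _ → 0) (denominator q))
                            (scale j (denominator q))

  belowᴾ : PolyTime (λ ((N , j) , q) → below N j q)
  belowᴾ = sumLessᴾ ∘ᴾ
    ( appendᴾ ∘ᴾ ( scaleᴾ ∘ᴾ (fstᴾ ∘ᴾ fstᴾ ,ᴾ numeratorᴾ ∘ᴾ sndᴾ)
                ,ᴾ mapᴾ {E = ⊤} (constᴾ 0) ∘ᴾ (constᴾ tt ,ᴾ denominatorᴾ ∘ᴾ sndᴾ))
    ,ᴾ scaleᴾ ∘ᴾ (sndᴾ ∘ᴾ fstᴾ ,ᴾ denominatorᴾ ∘ᴾ sndᴾ))

  -- A cut is given by the index of its commodity, the residence of the source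
  -- of that commodity and the characteristic vector of the set.
  Cut : Set
  Cut = ℕ × ℕ × List Bool

  ballCuts : ℕ → ℕ → ℕ → List (List ℚ) → List Cut
  -- Balls are open. Radius 0 would give the empty set and is left out, while the largest radius, N
  -- / N = 1, still excludes the sink.
  ballCuts N a s D = map (λ j → a , s , map (below N j) (nth [] D s)) (enumFrom 1 N)

  ballCutsᴾ : PolyTime (λ (N , a , s , D) → ballCuts N a s D)
  ballCutsᴾ = mapᴾ Ball ∘ᴾ (idᴾ ,ᴾ enumFromᴾ ∘ᴾ (constᴾ 1 ,ᴾ fstᴾ))
    where
    Ball : PolyTime {(ℕ × ℕ × ℕ × List (List ℚ)) × ℕ} {Cut}
             (λ ((N , a , s , D) , j) → a , s , map (below N j) (nth [] D s))
    Ball = fstᴾ ∘ᴾ sndᴾ ∘ᴾ fstᴾ ,ᴾ fstᴾ ∘ᴾ sndᴾ ∘ᴾ sndᴾ ∘ᴾ fstᴾ ,ᴾ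
           mapᴾ belowᴾ ∘ᴾ ((fstᴾ ∘ᴾ fstᴾ ,ᴾ sndᴾ) ,ᴾ
             nthᴾ [] ∘ᴾ (sndᴾ ∘ᴾ sndᴾ ∘ᴾ sndᴾ ∘ᴾ fstᴾ ,ᴾ fstᴾ ∘ᴾ sndᴾ ∘ᴾ sndᴾ ∘ᴾ fstᴾ))

  allBallCuts : ℕ → ℕ → List ℕ → List (List (List ℚ)) → List Cut
  allBallCuts N a ss []       = []
  allBallCuts N a ss (D ∷ Ds) = ballCuts N a (headOr 0 ss) D ++ allBallCuts N (suc a) (tail ss) Ds

  allBallCutsᴾ : PolyTime (λ (N , ss , Ds) → allBallCuts N 0 ss Ds)
  allBallCutsᴾ = polyTime-cong (λ (N , ss , Ds) → rec≡allBallCuts N 0 ss Ds)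
    (recursion (constᴾ [])
      (sucᴾ ∘ᴾ fstᴾ ∘ᴾ sndᴾ ∘ᴾ sndᴾ ,ᴾ tailᴾ ∘ᴾ sndᴾ ∘ᴾ sndᴾ ∘ᴾ sndᴾ)
      (appendᴾ ∘ᴾ (New ∘ᴾ (fstᴾ ,ᴾ fstᴾ ∘ᴾ sndᴾ ,ᴾ fstᴾ ∘ᴾ sndᴾ ∘ᴾ sndᴾ) ,ᴾ sndᴾ ∘ᴾ sndᴾ ∘ᴾ sndᴾ))
      (con 2) (λ { _ _ (a , ss) → ≤-trans (s≤s (s≤s (s≤s (+-monoʳ-≤ ‖ a ‖ (‖tail‖ ss)))))
                                          (≤-reflexive (+-comm 2 _)) })
      (bound New) (λ N D s r → ≤-trans (‖++‖ (new (N , D , s)) r) (+-monoʳ-≤ ‖ r ‖ (small New (N , D , s))))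
    ∘ᴾ (fstᴾ ,ᴾ (constᴾ 0 ,ᴾ fstᴾ ∘ᴾ sndᴾ) ,ᴾ sndᴾ ∘ᴾ sndᴾ))
    where
    new : ℕ × List (List ℚ) × ℕ × List ℕ → List Cut
    new (N , D , a , ss) = ballCuts N a (headOr 0 ss) D
    New : PolyTime new
    New = ballCutsᴾ ∘ᴾ (fstᴾ ,ᴾ fstᴾ ∘ᴾ sndᴾ ∘ᴾ sndᴾ ,ᴾ
                        headOrᴾ 0 ∘ᴾ sndᴾ ∘ᴾ sndᴾ ∘ᴾ sndᴾ ,ᴾ fstᴾ ∘ᴾ sndᴾ)
    open Recursion {ℕ} {List (List ℚ)} {ℕ × List ℕ} {List Cut} (λ _ → [])
      (λ (_ , _ , a , ss) → suc a , tail ss) (λ (N , D , s , r) → new (N , D , s) ++ r)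
    rec≡allBallCuts : ∀ N a ss Ds → rec N (a , ss) Ds ≡ allBallCuts N a ss Ds
    rec≡allBallCuts N a ss []       = refl
    rec≡allBallCuts N a ss (D ∷ Ds) = cong (ballCuts N a (headOr 0 ss) D ++_)
                                           (rec≡allBallCuts N (suc a) (tail ss) Ds)

  -- The algorithm: uncrossing and sweeps

  _without_ : Bool → Bool → Bool
  x without y = x ∧ not y

  zipWithᴾ : {f : Bool → Bool → Bool} → PolyTime (uncurry f) → PolyTime (uncurry (zipWith f))
  zipWithᴾ {f} F = polyTime-cong (λ (xs , ys) → rec≡zipWith xs ys)
    (recursion (constᴾ []) (tailᴾ ∘ᴾ sndᴾ ∘ᴾ sndᴾ)
      (ifᴾ (nonEmptyᴾ ∘ᴾ fstᴾ ∘ᴾ sndᴾ ∘ᴾ sndᴾ)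
           (consᴾ (F ∘ᴾ (fstᴾ ∘ᴾ sndᴾ ,ᴾ headOrᴾ false ∘ᴾ fstᴾ ∘ᴾ sndᴾ ∘ᴾ sndᴾ)) (sndᴾ ∘ᴾ sndᴾ ∘ᴾ sndᴾ))
           (constᴾ []))
      (con 0) (λ _ _ ys → ≤-trans (‖tail‖ ys) (m≤m+n _ 0))
      (con 4) step-small
    ∘ᴾ (constᴾ tt ,ᴾ sndᴾ ,ᴾ fstᴾ))
    where
    step : ⊤ × Bool × List Bool × List Bool → List Bool
    step (_ , x , ys , r) = if nonEmpty ys then f x (headOr false ys) ∷ r else []
    step-small : ∀ e x ys r → ‖ step (e , x , ys , r) ‖ ≤ ‖ r ‖ + 4
    step-small e x []       r = m≤n⇒m≤o+n ‖ r ‖ (m≤m+n 1 3)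
    step-small e x (y ∷ ys) r = ≤-trans (≤-reflexive (‖∷‖ (f x y) r))
                                        (+-monoʳ-≤ ‖ r ‖ (s≤s (‖Bool‖≤3 (f x y))))
    open Recursion {⊤} {Bool} {List Bool} {List Bool} (λ _ → []) (λ (_ , _ , ys) → tail ys) step
    rec≡zipWith : ∀ xs ys → rec tt ys xs ≡ zipWith f xs ys
    rec≡zipWith []       ys       = refl
    rec≡zipWith (x ∷ xs) []       = refl
    rec≡zipWith (x ∷ xs) (y ∷ ys) = cong (f x y ∷_) (rec≡zipWith xs ys)

  ∩ᴾ : PolyTime (uncurry (zipWith _∧_))
  ∩ᴾ = zipWithᴾ ∧ᴾ

  ∪ᴾ : PolyTime (uncurry (zipWith _∨_))
  ∪ᴾ = zipWithᴾ ∨ᴾ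

  ─ᴾ : PolyTime (uncurry (zipWith _without_))
  ─ᴾ = zipWithᴾ (∧ᴾ ∘ᴾ (fstᴾ ,ᴾ notᴾ ∘ᴾ sndᴾ))

  flip-─ᴾ : PolyTime (uncurry (zipWith (flip _without_)))
  flip-─ᴾ = zipWithᴾ (∧ᴾ ∘ᴾ (sndᴾ ,ᴾ notᴾ ∘ᴾ fstᴾ))

  anyᴾ : PolyTime {List Bool} (any id)
  anyᴾ = polyTime-cong foldr≡any
    (foldrᴾ {E = ⊤} (constᴾ false) (∨ᴾ ∘ᴾ sndᴾ) (con 3)
      (λ _ b r → ≤-trans (‖Bool‖≤3 (b ∨ r)) (m≤n+m 3 _)) ∘ᴾ (constᴾ tt ,ᴾ idᴾ))
    where
    foldr≡any : ∀ bs → foldr _∨_ false bs ≡ any id bs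
    foldr≡any []       = refl
    foldr≡any (b ∷ bs) = cong (b ∨_) (foldr≡any bs)

  crossing : List Bool → List Bool → Bool
  crossing C D = any id (zipWith _∧_ C D) ∧ (any id (zipWith _without_ C D) ∧ any id (zipWith (flip _without_) C D))

  crossingᴾ : PolyTime (uncurry crossing)
  crossingᴾ = ∧ᴾ ∘ᴾ (anyᴾ ∘ᴾ ∩ᴾ ,ᴾ ∧ᴾ ∘ᴾ (anyᴾ ∘ᴾ ─ᴾ ,ᴾ anyᴾ ∘ᴾ flip-─ᴾ))

  -- The residences `r` and `q` always lie in their own sets `C` and `D`, so one look at the other
  -- set decides whether they lie in the intersection. If both do, the first cut receives the
  -- intersection.
  uncrossed : ℕ → List Bool → ℕ → List Bool → List Bool × List Bool
  uncrossed r C q D =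
    if nth false D r then zipWith _∧_ C D , zipWith _∨_ C D else
    if nth false C q then zipWith _∨_ C D , zipWith _∧_ C D else
    (zipWith _without_ C D , zipWith (flip _without_) C D)

  uncross : Cut × Cut → Cut × Cut
  uncross x@((a , r , C) , (b , q , D)) =
    if crossing C D
    then ((a , r , proj₁ (uncrossed r C q D)) , (b , q , proj₂ (uncrossed r C q D)))
    else x

  uncrossᴾ : PolyTime uncross
  uncrossᴾ = ifᴾ (crossingᴾ ∘ᴾ (Cᴾ ,ᴾ Dᴾ))
    ((fstᴾ ∘ᴾ fstᴾ ,ᴾ fstᴾ ∘ᴾ sndᴾ ∘ᴾ fstᴾ ,ᴾ fstᴾ ∘ᴾ Pair) ,ᴾ
     (fstᴾ ∘ᴾ sndᴾ ,ᴾ fstᴾ ∘ᴾ sndᴾ ∘ᴾ sndᴾ ,ᴾ sndᴾ ∘ᴾ Pair))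
    idᴾ
    where
    Cᴾ : PolyTime {Cut × Cut} (λ ((_ , _ , C) , _) → C)
    Cᴾ = sndᴾ ∘ᴾ sndᴾ ∘ᴾ fstᴾ
    Dᴾ : PolyTime {Cut × Cut} (λ (_ , (_ , _ , D)) → D)
    Dᴾ = sndᴾ ∘ᴾ sndᴾ ∘ᴾ sndᴾ
    Pair : PolyTime {Cut × Cut} (λ ((_ , r , C) , (_ , q , D)) → uncrossed r C q D)
    Pair = ifᴾ (nthᴾ false ∘ᴾ (Dᴾ ,ᴾ fstᴾ ∘ᴾ sndᴾ ∘ᴾ fstᴾ)) (∩ᴾ ∘ᴾ (Cᴾ ,ᴾ Dᴾ) ,ᴾ ∪ᴾ ∘ᴾ (Cᴾ ,ᴾ Dᴾ))
      (ifᴾ (nthᴾ false ∘ᴾ (Cᴾ ,ᴾ fstᴾ ∘ᴾ sndᴾ ∘ᴾ sndᴾ)) (∪ᴾ ∘ᴾ (Cᴾ ,ᴾ Dᴾ) ,ᴾ ∩ᴾ ∘ᴾ (Cᴾ ,ᴾ Dᴾ))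
        (─ᴾ ∘ᴾ (Cᴾ ,ᴾ Dᴾ) ,ᴾ flip-─ᴾ ∘ᴾ (Cᴾ ,ᴾ Dᴾ)))

  module _ {f g : Bool → Bool → Bool} (fg-small : ∀ x y → ‖ f x y ‖ + ‖ g x y ‖ ≤ ‖ x ‖ + ‖ y ‖) where

    ‖zipWith‖ : ∀ xs ys → ‖ zipWith f xs ys ‖ + ‖ zipWith g xs ys ‖ ≤ ‖ xs ‖ + ‖ ys ‖
    ‖zipWith‖ []      ys       = s≤s (0<size (encode ys))
    ‖zipWith‖ (x ∷ xs) []      = +-monoˡ-≤ 1 {1} (s≤s z≤n)
    ‖zipWith‖ (x ∷ xs) (y ∷ ys) = begin
      suc (‖ f x y ‖ + ‖ zipWith f xs ys ‖) + suc (‖ g x y ‖ + ‖ zipWith g xs ys ‖)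
        ≡⟨ medial (‖ f x y ‖) (‖ zipWith f xs ys ‖) (‖ g x y ‖) (‖ zipWith g xs ys ‖) ⟩
      2 + ((‖ f x y ‖ + ‖ g x y ‖) + (‖ zipWith f xs ys ‖ + ‖ zipWith g xs ys ‖))
        ≤⟨ +-monoʳ-≤ 2 (+-mono-≤ (fg-small x y) (‖zipWith‖ xs ys)) ⟩
      2 + ((‖ x ‖ + ‖ y ‖) + (‖ xs ‖ + ‖ ys ‖))               ≡⟨ medial (‖ x ‖) (‖ xs ‖) (‖ y ‖) (‖ ys ‖) ⟨
      ‖ x ∷ xs ‖ + ‖ y ∷ ys ‖                                 ∎
      where
      open ≤-Reasoning
      medial : ∀ a b c d → suc (a + b) + suc (c + d) ≡ 2 + ((a + c) + (b + d))
      medial = solve-∀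

  -- Intersection and union together have as many entries `true` as the two sets, and the
  -- differences have no more. An exact bound is essential: with many replacements in a row, even a
  -- constant factor would compound.
  ‖uncross‖ : ∀ p → ‖ uncross p ‖ ≤ ‖ p ‖
  ‖uncross‖ p@((a , r , C) , (b , q , D)) with crossing C D
  ... | false = ≤-refl
  ... | true  = begin
      ‖ (a , r , C′) , (b , q , D′) ‖
        ≡⟨ rearrange (‖ a ‖) (‖ r ‖) (‖ C′ ‖) (‖ b ‖) (‖ q ‖) (‖ D′ ‖) ⟩
      (5 + (‖ a ‖ + (‖ r ‖ + (‖ b ‖ + ‖ q ‖)))) + (‖ C′ ‖ + ‖ D′ ‖)
        ≤⟨ +-monoʳ-≤ (5 + (‖ a ‖ + (‖ r ‖ + (‖ b ‖ + ‖ q ‖)))) sets-small ⟩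
      (5 + (‖ a ‖ + (‖ r ‖ + (‖ b ‖ + ‖ q ‖)))) + (‖ C ‖ + ‖ D ‖)
        ≡⟨ rearrange (‖ a ‖) (‖ r ‖) (‖ C ‖) (‖ b ‖) (‖ q ‖) (‖ D ‖) ⟨
      ‖ p ‖ ∎
    where
    open ≤-Reasoning
    C′ D′ : List Bool
    C′ = proj₁ (uncrossed r C q D)
    D′ = proj₂ (uncrossed r C q D)
    rearrange : ∀ a r c b q d → suc (suc (a + suc (r + c)) + suc (b + suc (q + d))) ≡
                                (5 + (a + (r + (b + q)))) + (c + d)
    rearrange = solve-∀
    sets-small : ‖ C′ ‖ + ‖ D′ ‖ ≤ ‖ C ‖ + ‖ D ‖
    sets-small with nth false D r
    ... | true = ‖zipWith‖ {f = _∧_} {g = _∨_}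
      (λ { true true → ≤-refl ; true false → m≤m+n 4 0 ; false true → ≤-refl ; false false → ≤-refl }) C D
    ... | false with nth false C q
    ...   | true = ‖zipWith‖ {f = _∨_} {g = _∧_}
      (λ { true true → ≤-refl ; true false → ≤-refl ; false true → ≤-refl ; false false → ≤-refl }) C D
    ...   | false = ‖zipWith‖ {f = _without_} {g = flip _without_}
      (λ { true true → m≤m+n 2 4 ; true false → ≤-refl ; false true → ≤-refl ; false false → ≤-refl }) C D

  -- Sweeps over a list, applying u to every pair once.

  module Sweep {A : Set} (u : A × A → A × A) where

    passStep : A × A × List A → A × List A
    passStep (y , x , ys) = proj₁ (u (x , y)) , proj₂ (u (x , y)) ∷ ys

    -- `x` meets the entries from the last to the first and may be changed by each of them.
    pass : A → List A → A × List A
    pass x = foldr (λ y r → passStep (y , r)) (x , [])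

    sweepStep : A × List A → List A
    sweepStep (x , ys) = proj₁ (pass x ys) ∷ proj₂ (pass x ys)

    sweep : List A → List A
    sweep = foldr (λ x ys → sweepStep (x , ys)) []

    -- A later change of one element can undo what was achieved for an earlier pair that contains
    -- it, hence the repetition.
    sweeps : ℕ → List A → List A
    sweeps T xs = foldr (λ _ → sweep) xs (replicate T tt)

  module _ {A : Set} ⦃ _ : Encodable A ⦄ {u : A × A → A × A}
           (U : PolyTime u) (u-small : ∀ p → ‖ u p ‖ ≤ ‖ p ‖) where
    open Sweep u

    private
      ‖passStep‖ : ∀ y x ys → ‖ passStep (y , x , ys) ‖ ≤ ‖ x , ys ‖ + suc ‖ y ‖
      ‖passStep‖ y x ys = s≤s (begin
        ‖ x′ ‖ + suc (‖ y′ ‖ + ‖ ys ‖)      ≡⟨ rearrange (‖ x′ ‖) (‖ y′ ‖) (‖ ys ‖) ⟩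
        suc (‖ x′ ‖ + ‖ y′ ‖) + ‖ ys ‖      ≤⟨ +-monoˡ-≤ (‖ ys ‖) (u-small (x , y)) ⟩
        suc (‖ x ‖ + ‖ y ‖) + ‖ ys ‖        ≡⟨ rearrange′ (‖ x ‖) (‖ y ‖) (‖ ys ‖) ⟩
        (‖ x ‖ + ‖ ys ‖) + suc ‖ y ‖        ∎)
        where
        open ≤-Reasoning
        x′ y′ : A
        x′ = proj₁ (u (x , y))
        y′ = proj₂ (u (x , y))
        rearrange : ∀ x y z → x + suc (y + z) ≡ suc (x + y) + z
        rearrange = solve-∀
        rearrange′ : ∀ x y z → suc (x + y) + z ≡ (x + z) + suc y
        rearrange′ = solve-∀

      ‖pass‖ : ∀ x ys → ‖ pass x ys ‖ ≤ suc (‖ x ‖ + ‖ ys ‖)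
      ‖pass‖ x []       = ≤-refl
      ‖pass‖ x (y ∷ ys) = begin
        ‖ pass x (y ∷ ys) ‖                ≤⟨ ‖passStep‖ y (proj₁ (pass x ys)) (proj₂ (pass x ys)) ⟩
        ‖ pass x ys ‖ + suc ‖ y ‖          ≤⟨ +-monoˡ-≤ (suc ‖ y ‖) (‖pass‖ x ys) ⟩
        suc ((‖ x ‖ + ‖ ys ‖) + suc ‖ y ‖) ≡⟨ cong suc (+-assoc (‖ x ‖) (‖ ys ‖) _) ⟩
        suc (‖ x ‖ + (‖ ys ‖ + suc ‖ y ‖)) ≡⟨ cong (λ n → suc (‖ x ‖ + n)) (‖∷‖ y ys) ⟨
        suc (‖ x ‖ + ‖ y ∷ ys ‖)           ∎
        where open ≤-Reasoning

      ‖sweepStep‖ : ∀ x ys → ‖ sweepStep (x , ys) ‖ ≤ ‖ x ∷ ys ‖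
      ‖sweepStep‖ = ‖pass‖

      ‖sweep‖ : ∀ xs → ‖ sweep xs ‖ ≤ ‖ xs ‖
      ‖sweep‖ []       = ≤-refl
      ‖sweep‖ (x ∷ xs) = ≤-trans (‖sweepStep‖ x (sweep xs)) (s≤s (+-monoʳ-≤ (‖ x ‖) (‖sweep‖ xs)))

      passᴾ : PolyTime (uncurry pass)
      passᴾ = foldrᴾ (idᴾ ,ᴾ constᴾ [])
        ((fstᴾ ∘ᴾ U′ ,ᴾ consᴾ (sndᴾ ∘ᴾ U′) (sndᴾ ∘ᴾ sndᴾ)) ∘ᴾ sndᴾ)
        X (λ _ y (x , ys) → ≤-trans (‖passStep‖ y x ys) (+-monoʳ-≤ (‖ x , ys ‖) (s≤s (m≤n+m _ _))))
        where
        U′ : PolyTime {A × A × List A} (λ (y , x , _) → u (x , y))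
        U′ = U ∘ᴾ (fstᴾ ∘ᴾ sndᴾ ,ᴾ fstᴾ)

      sweepStepᴾ : PolyTime sweepStep
      sweepStepᴾ = consᴾ (fstᴾ ∘ᴾ passᴾ) (sndᴾ ∘ᴾ passᴾ)

      sweepᴾ : PolyTime sweep
      sweepᴾ = foldrᴾ {E = ⊤} (constᴾ []) (sweepStepᴾ ∘ᴾ sndᴾ) X
        (λ _ x ys → ≤-trans (‖sweepStep‖ x ys) (≤-trans (≤-reflexive (‖∷‖ x ys))
                      (+-monoʳ-≤ (‖ ys ‖) (s≤s (m≤n+m _ 1)))))
        ∘ᴾ (constᴾ tt ,ᴾ idᴾ)

    sweepsᴾ : PolyTime (uncurry sweeps)
    sweepsᴾ = foldrᴾ {E = List A} {A = ⊤} idᴾ (sweepᴾ ∘ᴾ sndᴾ ∘ᴾ sndᴾ) (con 0)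
      (λ _ _ ys → ≤-trans (‖sweep‖ ys) (m≤m+n _ 0)) ∘ᴾ (sndᴾ ,ᴾ unitsᴾ ∘ᴾ fstᴾ)

  open Sweep uncross using (sweeps)

  -- The edges and the sink are kept as uninterpreted trees: both are irrelevant,
  -- since the balls avoid the sink and uncrossing raises the load of no edge.
  Input Output : Set
  Input  = ℕ × Tree × Tree × List ℕ × List (List (List ℚ))
  Output = List ((Bool × ℕ) × ((Bool × List Bool) × List Bool) × List Bool)

  -- The cuts weigh 1 / N with N = (n k + 1)², which makes the rounding error
  -- k / N of a load at most 1 / (n k + 1).
  units : ℕ → ℕ → ℕ
  units n k = suc (n * k) * suc (n * k)

  -- The potential of uncrossing, the sum of the squared sizes of the complements,
  -- is at most |cs| n² and grows in every sweep that meets a crossing pair.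
  rounds : ℕ → List Cut → ℕ
  rounds n cs = suc (length cs * (n * n))

  laminarize : ℕ × List Cut → List Cut
  laminarize (n , cs) = sweeps (rounds n cs) cs

  laminarizeᴾ : PolyTime laminarize
  laminarizeᴾ = sweepsᴾ uncrossᴾ ‖uncross‖ ∘ᴾ
    (sucᴾ ∘ᴾ *ᴾ ∘ᴾ (lengthᴾ ∘ᴾ sndᴾ ,ᴾ *ᴾ ∘ᴾ (fstᴾ ,ᴾ fstᴾ)) ,ᴾ sndᴾ)

  output : ℕ × List Cut → Output
  output (N , cs) = map (λ (a , _ , C) →
    (false , a) , ((false , true ∷ []) , digits (ℕᵇ.fromℕ N)) , C) cs

  outputᴾ : PolyTime output
  outputᴾ = mapᴾ {E = ℕ} {A = Cut}
    ( (constᴾ false ,ᴾ fstᴾ ∘ᴾ sndᴾ)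
    ,ᴾ (constᴾ (false , true ∷ []) ,ᴾ digitsᴾ ∘ᴾ fstᴾ)
    ,ᴾ sndᴾ ∘ᴾ sndᴾ ∘ᴾ sndᴾ )

  ballFamily : ℕ → Input → List Cut
  ballFamily N (_ , _ , _ , ss , Ds) = allBallCuts N 0 ss Ds

  algorithm : Input → Output
  algorithm x@(n , _ , _ , ss , _) = output (N , laminarize (n , ballFamily N x))
    where N = units n (length ss)

  abstract

    algorithmᴾ : PolyTime algorithm
    algorithmᴾ = outputᴾ ∘ᴾ (Units ,ᴾ laminarizeᴾ ∘ᴾ (fstᴾ ,ᴾ
      allBallCutsᴾ ∘ᴾ (Units ,ᴾ fstᴾ ∘ᴾ sndᴾ ∘ᴾ sndᴾ ∘ᴾ sndᴾ ,ᴾ sndᴾ ∘ᴾ sndᴾ ∘ᴾ sndᴾ ∘ᴾ sndᴾ)))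
      where
      M : PolyTime {Input} (λ (n , _ , _ , ss , _) → suc (n * length ss))
      M = sucᴾ ∘ᴾ *ᴾ ∘ᴾ (fstᴾ ,ᴾ lengthᴾ ∘ᴾ fstᴾ ∘ᴾ sndᴾ ∘ᴾ sndᴾ ∘ᴾ sndᴾ)
      Units : PolyTime {Input} (λ (n , _ , _ , ss , _) → units n (length ss))
      Units = *ᴾ ∘ᴾ (M ,ᴾ M)

  -- Correctness of the comparison

  reflects-⇔ : {P Q : Set} {b : Bool} → P ⇔ Q → Reflects P b → Reflects Q b
  reflects-⇔ P⇔Q (ofʸ p)  = ofʸ (Equivalence.to P⇔Q p)
  reflects-⇔ P⇔Q (ofⁿ ¬p) = ofⁿ (¬p ∘ Equivalence.from P⇔Q)

  ⌈n/2⌉≤1+⌊n/2⌋ : ∀ n → ⌈ n /2⌉ ≤ suc ⌊ n /2⌋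
  ⌈n/2⌉≤1+⌊n/2⌋ zero          = z≤n
  ⌈n/2⌉≤1+⌊n/2⌋ (suc zero)    = ≤-refl
  ⌈n/2⌉≤1+⌊n/2⌋ (suc (suc n)) = s≤s (⌈n/2⌉≤1+⌊n/2⌋ n)

  n≤⌈n/2⌉*2 : ∀ n → n ≤ 2 * ⌈ n /2⌉
  n≤⌈n/2⌉*2 n = begin
    n                          ≡⟨ ⌊n/2⌋+⌈n/2⌉≡n n ⟨
    ⌊ n /2⌋ + ⌈ n /2⌉          ≤⟨ +-mono-≤ (⌊n/2⌋≤⌈n/2⌉ n) (m≤m+n _ 0) ⟩
    2 * ⌈ n /2⌉                ∎
    where open ≤-Reasoning

  ⌈n/2⌉*2≤1+n : ∀ n → 2 * ⌈ n /2⌉ ≤ suc n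
  ⌈n/2⌉*2≤1+n n = begin
    2 * ⌈ n /2⌉                ≤⟨ +-mono-≤ (⌈n/2⌉≤1+⌊n/2⌋ n) (≤-reflexive (+-identityʳ _)) ⟩
    suc (⌊ n /2⌋ + ⌈ n /2⌉)    ≡⟨ cong suc (⌊n/2⌋+⌈n/2⌉≡n n) ⟩
    suc n                      ∎
    where open ≤-Reasoning

  ⌊n/2⌋*2≤n : ∀ n → 2 * ⌊ n /2⌋ ≤ n
  ⌊n/2⌋*2≤n n = begin
    2 * ⌊ n /2⌋                ≤⟨ +-monoʳ-≤ ⌊ n /2⌋ (≤-trans (≤-reflexive (+-identityʳ _)) (⌊n/2⌋≤⌈n/2⌉ n)) ⟩
    ⌊ n /2⌋ + ⌈ n /2⌉          ≡⟨ ⌊n/2⌋+⌈n/2⌉≡n n ⟩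
    n                          ∎
    where open ≤-Reasoning

  n≤1+⌊n/2⌋*2 : ∀ n → n ≤ suc (2 * ⌊ n /2⌋)
  n≤1+⌊n/2⌋*2 n = begin
    n                          ≡⟨ ⌊n/2⌋+⌈n/2⌉≡n n ⟨
    ⌊ n /2⌋ + ⌈ n /2⌉          ≤⟨ +-monoʳ-≤ ⌊ n /2⌋ (⌈n/2⌉≤1+⌊n/2⌋ n) ⟩
    ⌊ n /2⌋ + suc ⌊ n /2⌋      ≡⟨ rearrange ⌊ n /2⌋ ⟩
    suc (2 * ⌊ n /2⌋)          ∎
    where
    open ≤-Reasoning
    rearrange : ∀ m → m + suc m ≡ suc (2 * m)
    rearrange = solve-∀

  carry-right : ∀ d x y → (2 * x < d + 2 * y) ⇔ (x < ⌈ d /2⌉ + y)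
  carry-right d x y = mk⇔ to from
    where
    open ≤-Reasoning
    to : 2 * x < d + 2 * y → x < ⌈ d /2⌉ + y
    to lt = ≰⇒> λ ge → <⇒≱ lt (begin
      d + 2 * y              ≤⟨ +-monoˡ-≤ (2 * y) (n≤⌈n/2⌉*2 d) ⟩
      2 * ⌈ d /2⌉ + 2 * y    ≡⟨ *-distribˡ-+ 2 ⌈ d /2⌉ y ⟨
      2 * (⌈ d /2⌉ + y)      ≤⟨ *-monoʳ-≤ 2 ge ⟩
      2 * x                  ∎)
    from : x < ⌈ d /2⌉ + y → 2 * x < d + 2 * y
    from lt = s≤s⁻¹ (begin
      suc (suc (2 * x))      ≡⟨ *-suc 2 x ⟨
      2 * suc x              ≤⟨ *-monoʳ-≤ 2 lt ⟩
      2 * (⌈ d /2⌉ + y)      ≡⟨ *-distribˡ-+ 2 ⌈ d /2⌉ y ⟩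
      2 * ⌈ d /2⌉ + 2 * y    ≤⟨ +-monoˡ-≤ (2 * y) (⌈n/2⌉*2≤1+n d) ⟩
      suc (d + 2 * y)        ∎)

  carry-left : ∀ d x y → (d + 2 * x < 2 * y) ⇔ (⌊ d /2⌋ + x < y)
  carry-left d x y = mk⇔ to from
    where
    open ≤-Reasoning
    to : d + 2 * x < 2 * y → ⌊ d /2⌋ + x < y
    to lt = ≰⇒> λ ge → <⇒≱ lt (begin
      2 * y                  ≤⟨ *-monoʳ-≤ 2 ge ⟩
      2 * (⌊ d /2⌋ + x)      ≡⟨ *-distribˡ-+ 2 ⌊ d /2⌋ x ⟩
      2 * ⌊ d /2⌋ + 2 * x    ≤⟨ +-monoˡ-≤ (2 * x) (⌊n/2⌋*2≤n d) ⟩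
      d + 2 * x              ∎)
    from : ⌊ d /2⌋ + x < y → d + 2 * x < 2 * y
    from lt = begin
      suc (d + 2 * x)              ≤⟨ s≤s (+-monoˡ-≤ (2 * x) (n≤1+⌊n/2⌋*2 d)) ⟩
      2 + (2 * ⌊ d /2⌋ + 2 * x)    ≡⟨ cong (2 +_) (*-distribˡ-+ 2 ⌊ d /2⌋ x) ⟨
      2 + 2 * (⌊ d /2⌋ + x)        ≡⟨ *-suc 2 (⌊ d /2⌋ + x) ⟨
      2 * suc (⌊ d /2⌋ + x)        ≤⟨ *-monoʳ-≤ 2 lt ⟩
      2 * y                        ∎

  cancel : ∀ c {m n} → (m < n) ⇔ (c + m < c + n)
  cancel c = mk⇔ (+-monoʳ-< c) (+-cancelˡ-< c _ _)

  -- One of the two truncated differences vanishes. Subtracting the smaller of `u` and `v` from both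
  -- sides leaves an inequality with a carry on one side only.
  carry : ∀ u v x y → (⌊ u ∸ v /2⌋ + x < ⌈ v ∸ u /2⌉ + y) ⇔ (u + 2 * x < v + 2 * y)
  carry u v x y with ≤-total u v
  ... | inj₁ u≤v rewrite m≤n⇒m∸n≡0 u≤v =
    subst (λ w → (x < ⌈ v ∸ u /2⌉ + y) ⇔ (u + 2 * x < w))
      (trans (sym (+-assoc u (v ∸ u) (2 * y))) (cong (_+ 2 * y) (m+[n∸m]≡n u≤v)))
      (⇔-trans (⇔-sym (carry-right (v ∸ u) x y)) (cancel u))
  ... | inj₂ v≤u rewrite m≤n⇒m∸n≡0 v≤u =
    subst (λ w → (⌊ u ∸ v /2⌋ + x < y) ⇔ (w < v + 2 * y))
      (trans (sym (+-assoc v (u ∸ v) (2 * x))) (cong (_+ 2 * x) (m+[n∸m]≡n v≤u)))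
      (⇔-trans (⇔-sym (carry-left (u ∸ v) x y)) (cancel v))

  binaryValue : List ℕ → ℕ
  binaryValue []       = 0
  binaryValue (x ∷ xs) = x + 2 * binaryValue xs

  binaryValue-tail : ∀ ys → binaryValue ys ≡ headOr 0 ys + 2 * binaryValue (tail ys)
  binaryValue-tail []       = refl
  binaryValue-tail (y ∷ ys) = refl

  positive-reflects : ∀ a b → Reflects (a + 0 < b + 0) (positive (b ∸ a))
  positive-reflects zero    zero    = ofⁿ λ ()
  positive-reflects zero    (suc b) = ofʸ z<s
  positive-reflects (suc a) zero    = ofⁿ λ ()
  positive-reflects (suc a) (suc b) = reflects-⇔ (cancel 1) (positive-reflects a b)

  -- The recursion stops at the end of `xs` and would ignore any digits of `ys` beyond it; the
  -- hypothesis on the lengths excludes such digits.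
  sumLess-reflects : ∀ a b xs ys → length ys ≤ length xs →
                     Reflects (a + binaryValue xs < b + binaryValue ys) (sumLess a b xs ys)
  sumLess-reflects a b []       []       _   = positive-reflects a b
  sumLess-reflects a b (x ∷ xs) ys       ys≤ =
    subst₂ (λ m n → Reflects (m < n) (sumLess a b (x ∷ xs) ys))
      (+-assoc a x _) (trans (+-assoc b _ _) (cong (b +_) (sym (binaryValue-tail ys))))
      (reflects-⇔ (carry (a + x) (b + headOr 0 ys) (binaryValue xs) (binaryValue (tail ys)))
        (sumLess-reflects _ _ xs (tail ys) (tail≤ ys ys≤)))
    where
    tail≤ : ∀ ys → length ys ≤ suc (length xs) → length (tail ys) ≤ length xs
    tail≤ []       _   = z≤n
    tail≤ (y ∷ ys) ys≤ = s≤s⁻¹ ys≤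

  binaryValue-scale : ∀ c b → binaryValue (scale c (digits b)) ≡ c * ℕᵇ.toℕ b
  binaryValue-scale c ℕᵇ.zero  = sym (*-zeroʳ c)
  binaryValue-scale c 2[1+ b ] = trans (cong (λ v → c + c + 2 * v) (binaryValue-scale c b)) (arith c (ℕᵇ.toℕ b))
    where
    arith : ∀ c b → c + c + 2 * (c * b) ≡ c * (2 * suc b)
    arith = solve-∀
  binaryValue-scale c 1+[2 b ] = trans (cong (λ v → c + 2 * v) (binaryValue-scale c b)) (arith c (ℕᵇ.toℕ b))
    where
    arith : ∀ c b → c + 2 * (c * b) ≡ c * suc (2 * b)
    arith = solve-∀

  binaryValue-pad : ∀ xs (bs : List Bool) → binaryValue (xs ++ map (λ _ → 0) bs) ≡ binaryValue xs
  binaryValue-pad []       []       = refl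
  binaryValue-pad []       (b ∷ bs) = cong (2 *_) (binaryValue-pad [] bs)
  binaryValue-pad (x ∷ xs) bs       = cong (λ v → x + 2 * v) (binaryValue-pad xs bs)

  below-reflects : ∀ N j q → Reflects (N * ∣ ↥ q ∣ < j * ↧ₙ q) (below N j q)
  below-reflects N j q = subst₂ (λ m n → Reflects (m < n) (below N j q))
    (trans (binaryValue-pad (scale N (numerator q)) (denominator q)) (value N ∣ ↥ q ∣))
    (value j (↧ₙ q))
    (sumLess-reflects 0 0 (scale N (numerator q) ++ map (λ _ → 0) (denominator q))
      (scale j (denominator q)) length≤)
    where
    value : ∀ c n → binaryValue (scale c (digits (ℕᵇ.fromℕ n))) ≡ c * n
    value c n = trans (binaryValue-scale c (ℕᵇ.fromℕ n)) (cong (c *_) (toℕ-fromℕ n))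
    open ≤-Reasoning
    length≤ : length (scale j (denominator q)) ≤
              length (scale N (numerator q) ++ map (λ _ → 0) (denominator q))
    length≤ = begin
      length (scale j (denominator q))          ≡⟨ length-map _ (denominator q) ⟩
      length (denominator q)                    ≡⟨ length-map (λ _ → 0) (denominator q) ⟨
      length (map (λ _ → 0) (denominator q))    ≤⟨ m≤n+m _ _ ⟩
      _                                         ≡⟨ length-++ (scale N (numerator q)) ⟨
      _                                         ∎

  scaledFloor : ℕ → ℚ → ℕ
  scaledFloor N q = (N * ∣ ↥ q ∣) / ↧ₙ q

  -- Membership in the balls around a source thus depends on the distance only through its rounded
  -- value, a natural number that is a threshold for `j`. The balls that separate two vertices can
  -- then be counted in ℕ.
  below-scaledFloor : ∀ N j q → below N j q ≡ (scaledFloor N q <ᵇ j)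
  below-scaledFloor N j q = det (below-reflects N j q) (reflects-⇔ (mk⇔ to (m<n*o⇒m/o<n))
    (proof (scaledFloor N q <? j)))
    where
    to : scaledFloor N q < j → N * ∣ ↥ q ∣ < j * ↧ₙ q
    to lt = ≰⇒> λ ge → <⇒≱ lt (≤-trans (≤-reflexive (sym (m*n/n≡m j (↧ₙ q)))) (/-monoˡ-≤ (↧ₙ q) ge))

-- Invariants and progress of sweeps

module Uncrossing where

  open import Defs hiding (sum)
  open import Data.Bool.Base using (Bool; true; false; if_then_else_; not; _∧_; _∨_; _xor_)
  open import Data.Bool.ListAction using (any)
  open import Data.Bool.Properties using (∨-zeroʳ)
  open import Data.Fin.Base using (Fin; zero; suc; toℕ)
  open import Data.Fin.Properties as Finₚ using ()
  open import Data.Fin.Subset using (Subset; _∈_; _─_; Nonempty)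
  open import Data.Fin.Subset.Properties using (∩-comm)
  open import Data.List.Base using (List; []; _∷_; map; zipWith)
  open import Data.List.Relation.Unary.All using (All; []; _∷_)
  open import Data.List.Relation.Unary.AllPairs using (AllPairs; []; _∷_)
  open import Data.Nat.Base hiding (less)
  open import Data.Nat.ListAction using (sum)
  open import Data.Nat.Properties
  open import Data.Nat.Tactic.RingSolver using (solve-∀)
  open import Data.Product.Base using (_×_; _,_; proj₁; proj₂; uncurry)
  open import Data.Sum.Base using (_⊎_; inj₁; inj₂)
  open import Data.Vec.Base as Vec using (Vec; []; _∷_; lookup; toList)
  open import Data.Vec.Properties using (lookup-zipWith; zipWith-comm)
  open import Function.Base using (_∘_; id; flip)
  open import Relation.Binary.PropositionalEquality
  open import Relation.Nullary.Decidable using (Dec; does; toWitness; map′; _×-dec_)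
  open import Relation.Nullary.Negation.Core using (¬_; contradiction)

  open PolynomialTime
  open Algorithm

  total : {A : Set} → (A → ℕ) → List A → ℕ
  total φ xs = sum (map φ xs)

  module SweepProperties {A : Set} (u : A × A → A × A) where
    open Sweep u

    module _ (P : A → Set) (u-P : ∀ x y → P x → P y → P (proj₁ (u (x , y))) × P (proj₂ (u (x , y)))) where

      pass-All : ∀ {x ys} → P x → All P ys → P (proj₁ (pass x ys)) × All P (proj₂ (pass x ys))
      pass-All px []         = px , []
      pass-All px (py ∷ pys) with pass-All px pys
      ... | px′ , pys′ with u-P _ _ px′ py
      ...   | px″ , py′ = px″ , py′ ∷ pys′

      sweep-All : ∀ {xs} → All P xs → All P (sweep xs)
      sweep-All []         = []
      sweep-All (px ∷ pxs) = uncurry _∷_ (pass-All px (sweep-All pxs))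

      sweeps-All : ∀ T {xs} → All P xs → All P (sweeps T xs)
      sweeps-All zero    pxs = pxs
      sweeps-All (suc T) pxs = sweep-All (sweeps-All T pxs)

    -- The relation is a parameter because three are needed: `_≡_` for the number of cuts of a
    -- commodity, `_≤_` for the number of cuts that an edge crosses, and `_≥_` for the potential.
    module _ {_∼_ : ℕ → ℕ → Set} (∼-refl : ∀ {m} → m ∼ m) (∼-trans : ∀ {m n o} → m ∼ n → n ∼ o → m ∼ o)
             (+-mono : ∀ {m n o p} → m ∼ n → o ∼ p → (m + o) ∼ (n + p)) (φ : A → ℕ)
             (u-∼ : ∀ x y → (φ (proj₁ (u (x , y))) + φ (proj₂ (u (x , y)))) ∼ (φ x + φ y)) where

      private
        ∼-reflexive : ∀ {m n} → m ≡ n → m ∼ n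
        ∼-reflexive refl = ∼-refl

      pass-total : ∀ x ys → (φ (proj₁ (pass x ys)) + total φ (proj₂ (pass x ys))) ∼ (φ x + total φ ys)
      pass-total x []       = ∼-refl
      pass-total x (y ∷ ys) =
        ∼-trans (∼-reflexive (sym (+-assoc (φ (proj₁ (u (x′ , y)))) (φ (proj₂ (u (x′ , y)))) (total φ ys′))))
          (∼-trans (+-mono (u-∼ x′ y) ∼-refl)
            (∼-trans (∼-reflexive (swap (φ x′) (φ y) _))
              (∼-trans (+-mono (pass-total x ys) ∼-refl) (∼-reflexive (swap′ (φ x) (φ y) _)))))
        where
        x′  = proj₁ (pass x ys)
        ys′ = proj₂ (pass x ys)
        swap : ∀ a b c → (a + b) + c ≡ (a + c) + b
        swap = solve-∀
        swap′ : ∀ a b c → (a + c) + b ≡ a + (b + c)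
        swap′ = solve-∀

      sweep-total : ∀ xs → total φ (sweep xs) ∼ total φ xs
      sweep-total []       = ∼-refl
      sweep-total (x ∷ xs) = ∼-trans (pass-total x (sweep xs)) (+-mono ∼-refl (sweep-total xs))

      sweeps-total : ∀ T xs → total φ (sweeps T xs) ∼ total φ xs
      sweeps-total zero    xs = ∼-refl
      sweeps-total (suc T) xs = ∼-trans (sweep-total (sweeps T xs)) (sweeps-total T xs)

    -- If u moves every pair outside N up in a potential and fixes the others,
    -- a sweep that leaves the potential unchanged finds all pairs in N.
    module _ {N : A → A → Set} (φ : A → ℕ)
             (progress : ∀ x y → φ x + φ y < φ (proj₁ (u (x , y))) + φ (proj₂ (u (x , y))) ⊎
                                 (u (x , y) ≡ (x , y) × N x y)) where

      private
        u-≥ : ∀ x y → φ (proj₁ (u (x , y))) + φ (proj₂ (u (x , y))) ≥ φ x + φ y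
        u-≥ x y with progress x y
        ... | inj₁ lt       = <⇒≤ lt
        ... | inj₂ (eq , _) = ≤-reflexive (cong (λ (x , y) → φ x + φ y) (sym eq))

        ≥-sweep : ∀ xs → total φ (sweep xs) ≥ total φ xs
        ≥-sweep = sweep-total {_≥_} ≤-refl (flip ≤-trans) +-mono-≤ φ u-≥

      pass-progress : ∀ x ys → φ x + total φ ys < φ (proj₁ (pass x ys)) + total φ (proj₂ (pass x ys)) ⊎
                               (pass x ys ≡ (x , ys) × All (N x) ys)
      pass-progress x []       = inj₂ (refl , [])
      pass-progress x (y ∷ ys) with pass x ys | pass-progress x ys
      -- A gain made earlier in the pass survives the encounter with `y`, since `u` never lowers the
      -- potential.
      ... | x′ , ys′ | inj₁ lt = inj₁ (begin-strict
        φ x + (φ y + total φ ys)         ≡⟨ swap (φ x) (φ y) _ ⟩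
        (φ x + total φ ys) + φ y         <⟨ +-monoˡ-< (φ y) lt ⟩
        (φ x′ + total φ ys′) + φ y       ≡⟨ swap′ (φ x′) (φ y) _ ⟩
        (φ x′ + φ y) + total φ ys′       ≤⟨ +-monoˡ-≤ _ (u-≥ x′ y) ⟩
        (φ (proj₁ (u (x′ , y))) + φ (proj₂ (u (x′ , y)))) + total φ ys′  ≡⟨ +-assoc (φ (proj₁ (u (x′ , y)))) (φ (proj₂ (u (x′ , y)))) (total φ ys′) ⟩
        _ ∎)
        where
        open ≤-Reasoning
        swap : ∀ a b c → a + (b + c) ≡ (a + c) + b
        swap = solve-∀
        swap′ : ∀ a b c → (a + c) + b ≡ (a + b) + c
        swap′ = solve-∀
      ... | _ | inj₂ (refl , Nys) with u (x , y) | progress x y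
      ...   | x′ , y′ | inj₁ lt          = inj₁ (begin-strict
        φ x + (φ y + total φ ys)         ≡⟨ +-assoc (φ x) (φ y) _ ⟨
        (φ x + φ y) + total φ ys         <⟨ +-monoˡ-< (total φ ys) lt ⟩
        (φ x′ + φ y′) + total φ ys       ≡⟨ +-assoc (φ x′) (φ y′) _ ⟩
        φ x′ + (φ y′ + total φ ys)       ∎)
        where open ≤-Reasoning
      ...   | _       | inj₂ (refl , Ny) = inj₂ (refl , Ny ∷ Nys)

      sweep-progress : ∀ xs → total φ xs < total φ (sweep xs) ⊎ (sweep xs ≡ xs × AllPairs N xs)
      sweep-progress []       = inj₂ (refl , [])
      sweep-progress (x ∷ xs) with sweep xs | sweep-progress xs | ≥-sweep xs
      ... | xs′ | inj₁ lt | _ with pass x xs′ | pass-total {_≥_} ≤-refl (flip ≤-trans) +-mono-≤ φ u-≥ x xs′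
      ...   | _ | ge = inj₁ (≤-trans (+-monoʳ-< (φ x) lt) ge)
      sweep-progress (x ∷ xs) | _ | inj₂ (refl , pairs) | _ with pass x xs | pass-progress x xs
      ...   | _ | inj₁ lt          = inj₁ lt
      ...   | _ | inj₂ (refl , Nx) = inj₂ (refl , Nx ∷ pairs)

      -- Either every sweep so far has raised the potential by at least one, or some sweep was idle
      -- and its list has been a fixed point ever since.
      sweeps-progress : ∀ T xs → T ≤ total φ (sweeps T xs) ⊎
                        (sweep (sweeps T xs) ≡ sweeps T xs × AllPairs N (sweeps T xs))
      sweeps-progress zero    xs = inj₁ z≤n
      sweeps-progress (suc T) xs with sweeps T xs | sweeps-progress T xs
      ... | ys | inj₂ (fixed , pairs) =
        inj₂ (cong sweep fixed , subst (AllPairs N) (sym fixed) pairs)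
      ... | ys | inj₁ T≤ with sweep-progress ys
      ...   | inj₁ lt              = inj₁ (≤-trans (s≤s T≤) lt)
      ...   | inj₂ (fixed , pairs) = inj₂ (cong sweep fixed , subst (AllPairs N) (sym fixed) pairs)

  module _ {A B : Set} (u : A × A → A × A) (v : B × B → B × B) (h : A → B)
           (commutes : ∀ x y → v (h x , h y) ≡ (h (proj₁ (u (x , y))) , h (proj₂ (u (x , y))))) where
    private
      module U = Sweep u
      module V = Sweep v

    pass-map : ∀ x ys → V.pass (h x) (map h ys) ≡ (h (proj₁ (U.pass x ys)) , map h (proj₂ (U.pass x ys)))
    pass-map x []       = refl
    pass-map x (y ∷ ys) rewrite pass-map x ys | commutes (proj₁ (U.pass x ys)) y = refl

    sweep-map : ∀ xs → V.sweep (map h xs) ≡ map h (U.sweep xs)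
    sweep-map []       = refl
    sweep-map (x ∷ xs) rewrite sweep-map xs | pass-map x (U.sweep xs) = refl

    -- Transfers what is proved for labelled subsets of `Fin n` to the lists of Booleans on which
    -- the program works.
    sweeps-map : ∀ T xs → V.sweeps T (map h xs) ≡ map h (U.sweeps T xs)
    sweeps-map zero    xs = refl
    sweeps-map (suc T) xs = trans (cong V.sweep (sweeps-map T xs)) (sweep-map (U.sweeps T xs))

  -- The potential, and crossing sets

  count : {n : ℕ} → (Bool → ℕ) → Subset n → ℕ
  count w []      = 0
  count w (x ∷ C) = w x + count w C

  indicator : Bool → ℕ
  indicator b = if b then 1 else 0

  ∣_∣ᶜ : {n : ℕ} → Subset n → ℕ
  ∣ C ∣ᶜ = count (indicator ∘ not) C

  module _ {n : ℕ} (C D : Subset n) where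

    both left-only right-only neither : ℕ
    both       = count indicator (Vec.zipWith _∧_ C D)
    left-only  = count indicator (Vec.zipWith _without_ C D)
    right-only = count indicator (Vec.zipWith (flip _without_) C D)
    neither    = count indicator (Vec.zipWith (λ x y → not x ∧ not y) C D)

  -- A set formed entry by entry from `C` and `D` is a union of some of the four cells of their Venn
  -- diagram, so all counts are linear in the four cell sizes.
  count-zipWith : ∀ {n} w f (C D : Subset n) → count w (Vec.zipWith f C D) ≡
    ((w (f true true) * both C D + w (f true false) * left-only C D) +
     w (f false true) * right-only C D) + w (f false false) * neither C D
  count-zipWith w f C D = mix C D
    where
    a₁ a₂ a₃ a₄ : ℕ
    a₁ = w (f true true)
    a₂ = w (f true false)
    a₃ = w (f false true)
    a₄ = w (f false false)
    zeros : ∀ a b c d → 0 ≡ ((a * 0 + b * 0) + c * 0) + d * 0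
    zeros = solve-∀
    one₁ : ∀ a b c d i j k m → a + (((a * i + b * j) + c * k) + d * m) ≡ ((a * suc i + b * j) + c * k) + d * m
    one₁ = solve-∀
    one₂ : ∀ a b c d i j k m → b + (((a * i + b * j) + c * k) + d * m) ≡ ((a * i + b * suc j) + c * k) + d * m
    one₂ = solve-∀
    one₃ : ∀ a b c d i j k m → c + (((a * i + b * j) + c * k) + d * m) ≡ ((a * i + b * j) + c * suc k) + d * m
    one₃ = solve-∀
    one₄ : ∀ a b c d i j k m → d + (((a * i + b * j) + c * k) + d * m) ≡ ((a * i + b * j) + c * k) + d * suc m
    one₄ = solve-∀
    mix : ∀ {n} (C D : Subset n) → count w (Vec.zipWith f C D) ≡
          ((a₁ * both C D + a₂ * left-only C D) + a₃ * right-only C D) + a₄ * neither C D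
    mix []          []          = zeros a₁ a₂ a₃ a₄
    mix (true ∷ C)  (true ∷ D)  = trans (cong (a₁ +_) (mix C D))
      (one₁ a₁ a₂ a₃ a₄ (both C D) (left-only C D) (right-only C D) (neither C D))
    mix (true ∷ C)  (false ∷ D) = trans (cong (a₂ +_) (mix C D))
      (one₂ a₁ a₂ a₃ a₄ (both C D) (left-only C D) (right-only C D) (neither C D))
    mix (false ∷ C) (true ∷ D)  = trans (cong (a₃ +_) (mix C D))
      (one₃ a₁ a₂ a₃ a₄ (both C D) (left-only C D) (right-only C D) (neither C D))
    mix (false ∷ C) (false ∷ D) = trans (cong (a₄ +_) (mix C D))
      (one₄ a₁ a₂ a₃ a₄ (both C D) (left-only C D) (right-only C D) (neither C D))

  zipWith-left : ∀ {n} (C D : Subset n) → Vec.zipWith (λ x _ → x) C D ≡ C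
  zipWith-left []      []      = refl
  zipWith-left (x ∷ C) (_ ∷ D) = cong (x ∷_) (zipWith-left C D)

  zipWith-right : ∀ {n} (C D : Subset n) → Vec.zipWith (λ _ y → y) C D ≡ D
  zipWith-right []      []      = refl
  zipWith-right (_ ∷ C) (y ∷ D) = cong (y ∷_) (zipWith-right C D)

  potential : {n : ℕ} → Subset n → ℕ
  potential C = ∣ C ∣ᶜ * ∣ C ∣ᶜ

  module _ {n : ℕ} (C D : Subset n) where

    private
      i a b o : ℕ
      i = both C D
      a = left-only C D
      b = right-only C D
      o = neither C D

      complement : ∀ f {k} →
        ((indicator (not (f true true)) * i + indicator (not (f true false)) * a) +
         indicator (not (f false true)) * b) + indicator (not (f false false)) * o ≡ k →
        ∣ Vec.zipWith f C D ∣ᶜ ≡ k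
      complement f eq = trans (count-zipWith (indicator ∘ not) f C D) eq

      ∣C∣ᶜ : ∣ C ∣ᶜ ≡ b + o
      ∣C∣ᶜ = trans (cong ∣_∣ᶜ (sym (zipWith-left C D))) (complement (λ x _ → x) (e i a b o))
        where
        e : ∀ i a b o → ((0 * i + 0 * a) + 1 * b) + 1 * o ≡ b + o
        e = solve-∀

      ∣D∣ᶜ : ∣ D ∣ᶜ ≡ a + o
      ∣D∣ᶜ = trans (cong ∣_∣ᶜ (sym (zipWith-right C D))) (complement (λ _ y → y) (e i a b o))
        where
        e : ∀ i a b o → ((0 * i + 1 * a) + 0 * b) + 1 * o ≡ a + o
        e = solve-∀

      ∣∩∣ᶜ : ∣ Vec.zipWith _∧_ C D ∣ᶜ ≡ (a + b) + o
      ∣∩∣ᶜ = complement _∧_ (e i a b o)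
        where
        e : ∀ i a b o → ((0 * i + 1 * a) + 1 * b) + 1 * o ≡ (a + b) + o
        e = solve-∀

      ∣∪∣ᶜ : ∣ Vec.zipWith _∨_ C D ∣ᶜ ≡ o
      ∣∪∣ᶜ = complement _∨_ (e i a b o)
        where
        e : ∀ i a b o → ((0 * i + 0 * a) + 0 * b) + 1 * o ≡ o
        e = solve-∀

      ∣C─D∣ᶜ : ∣ Vec.zipWith _without_ C D ∣ᶜ ≡ i + (b + o)
      ∣C─D∣ᶜ = complement _without_ (e i a b o)
        where
        e : ∀ i a b o → ((1 * i + 0 * a) + 1 * b) + 1 * o ≡ i + (b + o)
        e = solve-∀

      ∣D─C∣ᶜ : ∣ Vec.zipWith (flip _without_) C D ∣ᶜ ≡ i + (a + o)
      ∣D─C∣ᶜ = complement (flip _without_) (e i a b o)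
        where
        e : ∀ i a b o → ((1 * i + 1 * a) + 0 * b) + 1 * o ≡ i + (a + o)
        e = solve-∀

    -- If a and b are the sizes of the two differences, the gain is exactly 2 a b.
    potential-∩∪ : 0 < left-only C D → 0 < right-only C D →
      potential C + potential D < potential (Vec.zipWith _∧_ C D) + potential (Vec.zipWith _∨_ C D)
    potential-∩∪ 0<a 0<b rewrite ∣C∣ᶜ | ∣D∣ᶜ | ∣∩∣ᶜ | ∣∪∣ᶜ = begin-strict
        (b + o) * (b + o) + (a + o) * (a + o)           <⟨ m<m+n _ 0<gain ⟩
        ((b + o) * (b + o) + (a + o) * (a + o)) + 2 * (a * b)  ≡⟨ square a b o ⟩
        ((a + b) + o) * ((a + b) + o) + o * o           ∎
      where
      open ≤-Reasoning
      square : ∀ a b o → ((b + o) * (b + o) + (a + o) * (a + o)) + 2 * (a * b) ≡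
                         ((a + b) + o) * ((a + b) + o) + o * o
      square = solve-∀
      0<gain : 0 < 2 * (a * b)
      0<gain = *-mono-≤ {1} {2} (s≤s z≤n) (*-mono-≤ 0<a 0<b)

    -- Each of the two complements gains the elements of the intersection.
    potential-─ : 0 < both C D →
      potential C + potential D <
      potential (Vec.zipWith _without_ C D) + potential (Vec.zipWith (flip _without_) C D)
    potential-─ 0<i rewrite ∣C∣ᶜ | ∣D∣ᶜ | ∣C─D∣ᶜ | ∣D─C∣ᶜ =
        +-mono-<-≤ (*-mono-< (grow (b + o)) (grow (b + o))) (*-mono-≤ (m≤n+m _ i) (m≤n+m _ i))
      where
      grow : ∀ m → m < i + m
      grow m = m<n+m m 0<i

  potential-≤ : ∀ {n} (C : Subset n) → potential C ≤ n * n
  potential-≤ C = *-mono-≤ (count≤ C) (count≤ C)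
    where
    count≤ : ∀ {n} (C : Subset n) → ∣ C ∣ᶜ ≤ n
    count≤ []          = z≤n
    count≤ (true ∷ C)  = m≤n⇒m≤1+n (count≤ C)
    count≤ (false ∷ C) = s≤s (count≤ C)

  toList-zipWith : ∀ (f : Bool → Bool → Bool) {n} (C D : Subset n) →
                   zipWith f (toList C) (toList D) ≡ toList (Vec.zipWith f C D)
  toList-zipWith f []      []      = refl
  toList-zipWith f (x ∷ C) (y ∷ D) = cong (f x y ∷_) (toList-zipWith f C D)

  any-toList⇒0<count : ∀ {n} (C : Subset n) → any id (toList C) ≡ true → 0 < count indicator C
  any-toList⇒0<count (true ∷ C)  _  = z<s
  any-toList⇒0<count (false ∷ C) eq = any-toList⇒0<count C eq

  nonempty⇒any-toList : ∀ {n} {C : Subset n} → Nonempty C → any id (toList C) ≡ true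
  nonempty⇒any-toList (_ , Vec.here)               = refl
  nonempty⇒any-toList {C = true ∷ C}  (_ , Vec.there x∈C) = refl
  nonempty⇒any-toList {C = false ∷ C} (_ , Vec.there x∈C) = nonempty⇒any-toList (_ , x∈C)

  allBool? : {P : Bool → Set} → (∀ b → Dec (P b)) → Dec (∀ b → P b)
  allBool? P? = map′ (λ { (pt , pf) true → pt ; (pt , pf) false → pf }) (λ p → p true , p false)
                     (P? true ×-dec P? false)

  jump : Bool → Bool → ℕ
  jump x y = indicator (x xor y)

  module _ where
    private
      Uncrossing : (f g : Bool → Bool → Bool) → Set
      Uncrossing f g = ∀ x y x′ y′ →
        jump (f x y) (f x′ y′) + jump (g x y) (g x′ y′) ≤ jump x x′ + jump y y′

      uncrossing? : ∀ f g → Dec (Uncrossing f g)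
      uncrossing? f g = allBool? λ x → allBool? λ y → allBool? λ x′ → allBool? λ y′ → _ ≤? _

    -- Submodularity of the cut function, restricted to a single edge. Only four Booleans are
    -- involved, so evaluation at the sixteen assignments is a proof.
    jump-∩∪ : Uncrossing _∧_ _∨_
    jump-∩∪ = toWitness {a? = uncrossing? _∧_ _∨_} _

    -- Posimodularity of the cut function on a single edge. It relies on the symmetry of `jump`,
    -- that is, on the graph being undirected.
    jump-─ : Uncrossing _without_ (flip _without_)
    jump-─ = toWitness {a? = uncrossing? _without_ (flip _without_)} _

  ∈-─⇒∈-zipWith : ∀ {n} (C D : Subset n) {x} → x ∈ C ─ D → x ∈ Vec.zipWith _without_ C D
  ∈-─⇒∈-zipWith (true ∷ C)  (false ∷ D) Vec.here      = Vec.here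
  ∈-─⇒∈-zipWith (true ∷ C)  (false ∷ D) (Vec.there x∈) = Vec.there (∈-─⇒∈-zipWith C D x∈)
  ∈-─⇒∈-zipWith (false ∷ C) (false ∷ D) (Vec.there x∈) = Vec.there (∈-─⇒∈-zipWith C D x∈)
  ∈-─⇒∈-zipWith (_ ∷ C)     (true ∷ D)  (Vec.there x∈) = Vec.there (∈-─⇒∈-zipWith C D x∈)

  module _ {n : ℕ} where

    cross⇒crossing : (C D : Subset n) → Cross C D → crossing (toList C) (toList D) ≡ true
    cross⇒crossing C D (C∩D , (x , x∈C─D) , (y , y∈D─C))
      rewrite toList-zipWith _∧_ C D | toList-zipWith _without_ C D | toList-zipWith (flip _without_) C D
            | nonempty⇒any-toList C∩D
            | nonempty⇒any-toList (x , ∈-─⇒∈-zipWith C D x∈C─D)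
            | nonempty⇒any-toList {C = Vec.zipWith (flip _without_) C D}
                (y , subst (y ∈_) (zipWith-comm (λ _ _ → refl) D C) (∈-─⇒∈-zipWith D C y∈D─C))
      = refl

    ¬crossing⇒¬cross : (C D : Subset n) → crossing (toList C) (toList D) ≡ false → ¬ Cross C D × ¬ Cross D C
    ¬crossing⇒¬cross C D eq =
      (λ cr → contradiction (trans (sym eq) (cross⇒crossing C D cr)) λ ()) ,
      (λ (D∩C , D─C , C─D) → contradiction
        (trans (sym eq) (cross⇒crossing C D (subst Nonempty (∩-comm D C) D∩C , C─D , D─C))) λ ())

    crossing⇒cells : (C D : Subset n) → crossing (toList C) (toList D) ≡ true →
                     0 < both C D × 0 < left-only C D × 0 < right-only C D
    crossing⇒cells C D eq
      rewrite toList-zipWith _∧_ C D | toList-zipWith _without_ C D | toList-zipWith (flip _without_) C D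
      with any id (toList (Vec.zipWith _∧_ C D)) in ∩≡
         | any id (toList (Vec.zipWith _without_ C D)) in C─D≡
         | any id (toList (Vec.zipWith (flip _without_) C D)) in D─C≡ | eq
    ... | true | true | true | _ = any-toList⇒0<count (Vec.zipWith _∧_ C D) ∩≡ ,
      any-toList⇒0<count (Vec.zipWith _without_ C D) C─D≡ , any-toList⇒0<count (Vec.zipWith (flip _without_) C D) D─C≡

  nth-toList : ∀ {n} (C : Subset n) v → nth false (toList C) (toℕ v) ≡ lookup C v
  nth-toList (x ∷ C) zero    = refl
  nth-toList (x ∷ C) (suc v) = nth-toList C v

  -- Uncrossing of labelled subsets

  module _ {n k : ℕ} (s : Fin k → Fin n) where

    LabelledSet : Set
    LabelledSet = Fin k × Subset n

    toCut : LabelledSet → Cut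
    toCut (a , C) = toℕ a , toℕ (s a) , toList C

    uncrossedSets : Fin n → Subset n → Fin n → Subset n → Subset n × Subset n
    uncrossedSets r C q D =
      if lookup D r then (Vec.zipWith _∧_ C D , Vec.zipWith _∨_ C D) else
      if lookup C q then (Vec.zipWith _∨_ C D , Vec.zipWith _∧_ C D) else
      (Vec.zipWith _without_ C D , Vec.zipWith (flip _without_) C D)

    uncrossSets : LabelledSet × LabelledSet → LabelledSet × LabelledSet
    uncrossSets x@((a , C) , (b , D)) =
      if crossing (toList C) (toList D)
      then ((a , proj₁ (uncrossedSets (s a) C (s b) D)) , (b , proj₂ (uncrossedSets (s a) C (s b) D)))
      else x

    uncross-toCut : ∀ x y → uncross (toCut x , toCut y) ≡
                    (toCut (proj₁ (uncrossSets (x , y))) , toCut (proj₂ (uncrossSets (x , y))))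
    uncross-toCut (a , C) (b , D) with crossing (toList C) (toList D)
    ... | false = refl
    ... | true rewrite nth-toList D (s a) | nth-toList C (s b) with lookup D (s a)
    ...   | true rewrite toList-zipWith _∧_ C D | toList-zipWith _∨_ C D = refl
    ...   | false with lookup C (s b)
    ...     | true rewrite toList-zipWith _∧_ C D | toList-zipWith _∨_ C D = refl
    ...     | false rewrite toList-zipWith _without_ C D | toList-zipWith (flip _without_) C D = refl

    Separates : Fin n → LabelledSet → Set
    Separates t (a , C) = lookup C (s a) ≡ true × lookup C t ≡ false

    uncrossSets-Separates : ∀ t x y → Separates t x → Separates t y →
      Separates t (proj₁ (uncrossSets (x , y))) × Separates t (proj₂ (uncrossSets (x , y)))
    uncrossSets-Separates t (a , C) (b , D) (a∈C , t∉C) (b∈D , t∉D) with crossing (toList C) (toList D)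
    ... | false = (a∈C , t∉C) , (b∈D , t∉D)
    ... | true with lookup D (s a) in a∈D
    ...   | true =
      (trans (lookup-zipWith _∧_ (s a) C D) (cong₂ _∧_ a∈C a∈D) ,
       trans (lookup-zipWith _∧_ t C D) (cong₂ _∧_ t∉C t∉D)) ,
      (trans (lookup-zipWith _∨_ (s b) C D) (trans (cong (lookup C (s b) ∨_) b∈D) (∨-zeroʳ _)) ,
       trans (lookup-zipWith _∨_ t C D) (cong₂ _∨_ t∉C t∉D))
      where open import Data.Bool.Properties using (∨-zeroʳ)
    ...   | false with lookup C (s b) in b∈C
    ...     | true =
      (trans (lookup-zipWith _∨_ (s a) C D) (cong (_∨ lookup D (s a)) a∈C) ,
       trans (lookup-zipWith _∨_ t C D) (cong₂ _∨_ t∉C t∉D)) ,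
      (trans (lookup-zipWith _∧_ (s b) C D) (cong₂ _∧_ b∈C b∈D) ,
       trans (lookup-zipWith _∧_ t C D) (cong₂ _∧_ t∉C t∉D))
    -- Both tests have failed, so `s a` lies outside `D` and `s b` outside `C`, and each difference
    -- keeps the source of its commodity.
    ...     | false =
      (trans (lookup-zipWith _without_ (s a) C D) (cong₂ _without_ a∈C a∈D) ,
       trans (lookup-zipWith _without_ t C D) (cong₂ _without_ t∉C t∉D)) ,
      (trans (lookup-zipWith (flip _without_) (s b) C D) (cong₂ (flip _without_) b∈C b∈D) ,
       trans (lookup-zipWith (flip _without_) t C D) (cong₂ (flip _without_) t∉C t∉D))

    hasLabel : Fin k → LabelledSet → ℕ
    hasLabel a (b , _) = indicator (does (b Finₚ.≟ a))

    -- Labels stay in place and only the sets are exchanged. As all weights are equal, the total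
    -- weight of each commodity is preserved.
    uncrossSets-label : ∀ a x y →
      hasLabel a (proj₁ (uncrossSets (x , y))) + hasLabel a (proj₂ (uncrossSets (x , y))) ≡
      hasLabel a x + hasLabel a y
    uncrossSets-label a (_ , C) (_ , D) with crossing (toList C) (toList D)
    ... | true  = refl
    ... | false = refl

    cuts-edge : Fin n → Fin n → LabelledSet → ℕ
    cuts-edge u v (_ , C) = jump (lookup C u) (lookup C v)

    uncrossSets-edge : ∀ u v x y →
      cuts-edge u v (proj₁ (uncrossSets (x , y))) + cuts-edge u v (proj₂ (uncrossSets (x , y))) ≤
      cuts-edge u v x + cuts-edge u v y
    uncrossSets-edge u v (a , C) (b , D) with crossing (toList C) (toList D)
    ... | false = ≤-refl
    ... | true with lookup D (s a)
    ...   | true rewrite lookup-zipWith _∧_ u C D | lookup-zipWith _∧_ v C D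
                       | lookup-zipWith _∨_ u C D | lookup-zipWith _∨_ v C D =
      jump-∩∪ (lookup C u) (lookup D u) (lookup C v) (lookup D v)
    ...   | false with lookup C (s b)
    ...     | true rewrite lookup-zipWith _∧_ u C D | lookup-zipWith _∧_ v C D
                         | lookup-zipWith _∨_ u C D | lookup-zipWith _∨_ v C D =
      ≤-trans (≤-reflexive (+-comm (jump (lookup C u ∨ lookup D u) (lookup C v ∨ lookup D v)) _))
        (jump-∩∪ (lookup C u) (lookup D u) (lookup C v) (lookup D v))
    ...     | false rewrite lookup-zipWith _without_ u C D | lookup-zipWith _without_ v C D
                          | lookup-zipWith (flip _without_) u C D | lookup-zipWith (flip _without_) v C D =
      jump-─ (lookup C u) (lookup D u) (lookup C v) (lookup D v)

    NotCrossing : LabelledSet → LabelledSet → Set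
    NotCrossing (_ , C) (_ , D) = crossing (toList C) (toList D) ≡ false

    labelledPotential : LabelledSet → ℕ
    labelledPotential (_ , C) = potential C

    uncrossSets-progress : ∀ x y →
      labelledPotential x + labelledPotential y <
      labelledPotential (proj₁ (uncrossSets (x , y))) + labelledPotential (proj₂ (uncrossSets (x , y)))
      ⊎ (uncrossSets (x , y) ≡ (x , y) × NotCrossing x y)
    uncrossSets-progress (a , C) (b , D) with crossing (toList C) (toList D) in eq
    ... | false = inj₂ (refl , refl)
    ... | true with crossing⇒cells C D eq
    ...   | 0<i , 0<a , 0<b with lookup D (s a)
    ...     | true = inj₁ (potential-∩∪ C D 0<a 0<b)
    ...     | false with lookup C (s b)
    ...       | true  = inj₁ (subst (potential C + potential D <_)
                  (+-comm (potential (Vec.zipWith _∧_ C D)) _) (potential-∩∪ C D 0<a 0<b))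
    ...       | false = inj₁ (potential-─ C D 0<i)

-- Rounding of distances to multiples of 1 / N

module Rounding where

  open import Defs using (fromℕ; ∑; TendsToZero)
  open import Data.Fin.Base using (Fin; zero; suc)
  open import Data.Integer.Base as ℤ using (+_; -[1+_])
  import Data.Integer.Properties as ℤₚ
  open import Data.List.Base using (tabulate)
  open import Data.Nat.Base as ℕ using (ℕ; zero; suc)
  open import Data.Nat.Coprimality using (1-coprimeTo)
  open import Data.Nat.DivMod using (m/n*n≤m; m≡m%n+[m/n]*n; m%n<n)
  open import Data.Nat.ListAction using (sum)
  import Data.Nat.Properties as ℕₚ
  open import Data.Product.Base using (_,_)
  open import Data.Rational.Base
  open import Data.Rational.Properties
  open import Data.Rational.Solver using (module +-*-Solver)
  open import Data.Rational.Unnormalised.Base as ℚᵘ using (mkℚᵘ; *≡*)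
  import Data.Rational.Unnormalised.Properties as ℚᵘₚ
  open import Data.Sum.Base using (inj₁; inj₂)
  open import Relation.Binary.PropositionalEquality

  open Algorithm using (scaledFloor)

  toℚᵘ-fromℕ : ∀ a → toℚᵘ (fromℕ a) ℚᵘ.≃ mkℚᵘ (+ a) 0
  toℚᵘ-fromℕ a = toℚᵘ-fromℚᵘ (mkℚᵘ (+ a) 0)

  fromℕ-+ : ∀ a b → fromℕ (a ℕ.+ b) ≡ fromℕ a + fromℕ b
  fromℕ-+ a b = toℚᵘ-injective (begin
    toℚᵘ (fromℕ (a ℕ.+ b))                  ≈⟨ toℚᵘ-fromℕ (a ℕ.+ b) ⟩
    mkℚᵘ (+ (a ℕ.+ b)) 0                    ≈⟨ *≡* (cong (ℤ._* + 1) (sym (cong₂ ℤ._+_ (ℤₚ.*-identityʳ (+ a)) (ℤₚ.*-identityʳ (+ b))))) ⟩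
    mkℚᵘ (+ a) 0 ℚᵘ.+ mkℚᵘ (+ b) 0          ≈⟨ ℚᵘₚ.+-cong (toℚᵘ-fromℕ a) (toℚᵘ-fromℕ b) ⟨
    toℚᵘ (fromℕ a) ℚᵘ.+ toℚᵘ (fromℕ b)      ≈⟨ toℚᵘ-homo-+ (fromℕ a) (fromℕ b) ⟨
    toℚᵘ (fromℕ a + fromℕ b)                ∎)
    where open ℚᵘₚ.≃-Reasoning

  fromℕ-* : ∀ a b → fromℕ (a ℕ.* b) ≡ fromℕ a * fromℕ b
  fromℕ-* zero    b = sym (*-zeroˡ (fromℕ b))
  fromℕ-* (suc a) b = begin
    fromℕ (b ℕ.+ a ℕ.* b)               ≡⟨ fromℕ-+ b (a ℕ.* b) ⟩
    fromℕ b + fromℕ (a ℕ.* b)           ≡⟨ cong₂ _+_ (*-identityˡ (fromℕ b)) (sym (fromℕ-* a b)) ⟨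
    1ℚ * fromℕ b + fromℕ a * fromℕ b    ≡⟨ *-distribʳ-+ (fromℕ b) 1ℚ (fromℕ a) ⟨
    (1ℚ + fromℕ a) * fromℕ b            ≡⟨ cong (_* fromℕ b) (fromℕ-+ 1 a) ⟨
    fromℕ (suc a) * fromℕ b             ∎
    where open ≡-Reasoning

  0≤fromℕ : ∀ a → 0ℚ ≤ fromℕ a
  0≤fromℕ zero    = ≤-refl
  0≤fromℕ (suc a) = begin
    0ℚ             ≤⟨ 0≤fromℕ a ⟩
    fromℕ a        ≡⟨ +-identityˡ (fromℕ a) ⟨
    0ℚ + fromℕ a   ≤⟨ +-monoˡ-≤ (fromℕ a) (nonNegative⁻¹ 1ℚ) ⟩
    1ℚ + fromℕ a   ≡⟨ fromℕ-+ 1 a ⟨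
    fromℕ (suc a)  ∎
    where open ≤-Reasoning

  fromℕ-mono-≤ : ∀ a b → a ℕ.≤ b → fromℕ a ≤ fromℕ b
  fromℕ-mono-≤ a b a≤b = begin
    fromℕ a                       ≡⟨ +-identityʳ (fromℕ a) ⟨
    fromℕ a + 0ℚ                  ≤⟨ +-monoʳ-≤ (fromℕ a) (0≤fromℕ (b ℕ.∸ a)) ⟩
    fromℕ a + fromℕ (b ℕ.∸ a)     ≡⟨ fromℕ-+ a (b ℕ.∸ a) ⟨
    fromℕ (a ℕ.+ (b ℕ.∸ a))       ≡⟨ cong fromℕ (ℕₚ.m+[n∸m]≡n a≤b) ⟩
    fromℕ b                       ∎
    where open ≤-Reasoning

  fromℕ-mono-< : ∀ a b → a ℕ.< b → fromℕ a < fromℕ b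
  fromℕ-mono-< a b a<b = begin-strict
    fromℕ a                       ≡⟨ +-identityˡ (fromℕ a) ⟨
    0ℚ + fromℕ a                  <⟨ +-monoˡ-< (fromℕ a) (positive⁻¹ 1ℚ) ⟩
    1ℚ + fromℕ a                  ≡⟨ fromℕ-+ 1 a ⟨
    fromℕ (suc a)                 ≤⟨ fromℕ-mono-≤ (suc a) b a<b ⟩
    fromℕ b                       ∎
    where open ≤-Reasoning

  fromℕ-nonNegative : ∀ a → NonNegative (fromℕ a)
  fromℕ-nonNegative a = nonNegative (0≤fromℕ a)

  fromℕ-suc-positive : ∀ a → Positive (fromℕ (suc a))
  fromℕ-suc-positive a = positive (fromℕ-mono-< 0 (suc a) (ℕ.s≤s ℕ.z≤n))

  *-denominator : ∀ q → 0ℚ ≤ q → q * fromℕ (↧ₙ q) ≡ fromℕ (ℤ.∣ ↥ q ∣)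
  *-denominator q@(mkℚ (+ p) d-1 _) _ = toℚᵘ-injective (begin
    toℚᵘ (q * fromℕ (suc d-1))              ≈⟨ toℚᵘ-homo-* q (fromℕ (suc d-1)) ⟩
    toℚᵘ q ℚᵘ.* toℚᵘ (fromℕ (suc d-1))      ≈⟨ ℚᵘₚ.*-congˡ {toℚᵘ q} (toℚᵘ-fromℕ (suc d-1)) ⟩
    mkℚᵘ (+ p) d-1 ℚᵘ.* mkℚᵘ (+ suc d-1) 0  ≈⟨ *≡* (trans (ℤₚ.*-identityʳ (+ p ℤ.* + suc d-1))
                                                 (cong (λ d → + p ℤ.* + suc d) (sym (ℕₚ.*-identityʳ d-1)))) ⟩
    mkℚᵘ (+ p) 0                            ≈⟨ toℚᵘ-fromℕ p ⟨
    toℚᵘ (fromℕ p)                          ∎)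
    where open ℚᵘₚ.≃-Reasoning
  *-denominator q@(mkℚ -[1+ _ ] _ _) 0≤q with nonNegative 0≤q
  ... | ()

  module _ (N : ℕ) (q : ℚ) (0≤q : 0ℚ ≤ q) where

    private
      d : ℕ
      d = ↧ₙ q

      scaled : fromℕ N * q * fromℕ d ≡ fromℕ (N ℕ.* ℤ.∣ ↥ q ∣)
      scaled = begin
        fromℕ N * q * fromℕ d               ≡⟨ *-assoc (fromℕ N) q (fromℕ d) ⟩
        fromℕ N * (q * fromℕ d)             ≡⟨ cong (fromℕ N *_) (*-denominator q 0≤q) ⟩
        fromℕ N * fromℕ ℤ.∣ ↥ q ∣           ≡⟨ fromℕ-* N ℤ.∣ ↥ q ∣ ⟨
        fromℕ (N ℕ.* ℤ.∣ ↥ q ∣)             ∎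
        where open ≡-Reasoning

    floor-≤ : fromℕ (scaledFloor N q) ≤ fromℕ N * q
    floor-≤ = *-cancelʳ-≤-pos (fromℕ d) ⦃ fromℕ-suc-positive (ℕ.pred d) ⦄ (begin
      fromℕ (scaledFloor N q) * fromℕ d           ≡⟨ fromℕ-* (scaledFloor N q) d ⟨
      fromℕ (scaledFloor N q ℕ.* d)               ≤⟨ fromℕ-mono-≤ (scaledFloor N q ℕ.* d) (N ℕ.* ℤ.∣ ↥ q ∣) (m/n*n≤m (N ℕ.* ℤ.∣ ↥ q ∣) d) ⟩
      fromℕ (N ℕ.* ℤ.∣ ↥ q ∣)               ≡⟨ scaled ⟨
      fromℕ N * q * fromℕ d                 ∎)
      where open ≤-Reasoning

    <-1+floor : fromℕ N * q < fromℕ (suc (scaledFloor N q))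
    <-1+floor = *-cancelʳ-<-nonNeg (fromℕ d) ⦃ fromℕ-nonNegative d ⦄ (begin-strict
      fromℕ N * q * fromℕ d                 ≡⟨ scaled ⟩
      fromℕ m                               <⟨ fromℕ-mono-< m (suc (scaledFloor N q) ℕ.* d) m<[1+m/d]*d ⟩
      fromℕ (suc (scaledFloor N q) ℕ.* d)         ≡⟨ fromℕ-* (suc (scaledFloor N q)) d ⟩
      fromℕ (suc (scaledFloor N q)) * fromℕ d     ∎)
      where
      open ≤-Reasoning
      m : ℕ
      m = N ℕ.* ℤ.∣ ↥ q ∣
      m<[1+m/d]*d : m ℕ.< suc (scaledFloor N q) ℕ.* d
      m<[1+m/d]*d = ℕₚ.≤-trans (ℕ.s≤s (ℕₚ.≤-reflexive (m≡m%n+[m/n]*n m d)))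
                               (ℕₚ.+-monoˡ-≤ (scaledFloor N q ℕ.* d) (m%n<n m d))

  -- This keeps the sink, at distance at least 1 from every source, out of all balls with index at
  -- most `N`.
  floor-1≤ : ∀ N q → 1ℚ ≤ q → N ℕ.≤ scaledFloor N q
  floor-1≤ N q 1≤q = ℕₚ.≮⇒≥ λ floor<N → <-irrefl refl (<-≤-trans (<-1+floor N q (≤-trans (nonNegative⁻¹ 1ℚ) 1≤q)) (begin
    fromℕ (suc (scaledFloor N q))   ≤⟨ fromℕ-mono-≤ (suc (scaledFloor N q)) N floor<N ⟩
    fromℕ N                   ≡⟨ *-identityʳ (fromℕ N) ⟨
    fromℕ N * 1ℚ              ≤⟨ *-monoˡ-≤-nonNeg (fromℕ N) ⦃ fromℕ-nonNegative N ⦄ 1≤q ⟩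
    fromℕ N * q               ∎))
    where open ≤-Reasoning

  -- The rounded value of `y` is at most N y, and that of `x` exceeds N x - 1. Rounding therefore
  -- weakens the triangle inequality by at most one unit, which is the error of one commodity on one
  -- edge.
  floor-gap : ∀ N {x y z} → 0ℚ ≤ x → 0ℚ ≤ y → y ≤ x + z → scaledFloor N x ℕ.≤ scaledFloor N y →
              fromℕ (scaledFloor N y ℕ.∸ scaledFloor N x) ≤ fromℕ N * z + 1ℚ
  floor-gap N {x} {y} {z} 0≤x 0≤y y≤x+z X≤Y = ≮⇒≥ λ lt → <-irrefl refl (<-≤-trans (+-monoˡ-< (fromℕ X) lt) (begin
    fromℕ (Y ℕ.∸ X) + fromℕ X             ≡⟨ fromℕ-+ (Y ℕ.∸ X) X ⟨
    fromℕ (Y ℕ.∸ X ℕ.+ X)                 ≡⟨ cong fromℕ (ℕₚ.m∸n+n≡m X≤Y) ⟩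
    fromℕ Y                               ≤⟨ floor-≤ N y 0≤y ⟩
    fromℕ N * y                           ≤⟨ *-monoˡ-≤-nonNeg (fromℕ N) ⦃ fromℕ-nonNegative N ⦄ y≤x+z ⟩
    fromℕ N * (x + z)                     ≡⟨ *-distribˡ-+ (fromℕ N) x z ⟩
    fromℕ N * x + fromℕ N * z             ≤⟨ +-monoˡ-≤ (fromℕ N * z) (<⇒≤ (<-1+floor N x 0≤x)) ⟩
    fromℕ (suc X) + fromℕ N * z           ≡⟨ cong (_+ fromℕ N * z) (fromℕ-+ 1 X) ⟩
    (1ℚ + fromℕ X) + fromℕ N * z          ≡⟨ rearrange (fromℕ N * z) (fromℕ X) ⟩
    (fromℕ N * z + 1ℚ) + fromℕ X          ∎))
    where
    open ≤-Reasoning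
    X Y : ℕ
    X = scaledFloor N x
    Y = scaledFloor N y
    rearrange : ∀ a b → (1ℚ + b) + a ≡ (a + 1ℚ) + b
    rearrange = solve 2 (λ a b → (con 1ℚ :+ b) :+ a := (a :+ con 1ℚ) :+ b) refl
      where open +-*-Solver

  floor-difference : ∀ N {x y z} → 0ℚ ≤ x → 0ℚ ≤ y → x ≤ y + z → y ≤ x + z →
                     fromℕ ℕ.∣ scaledFloor N x - scaledFloor N y ∣ ≤ fromℕ N * z + 1ℚ
  floor-difference N {x} {y} {z} 0≤x 0≤y x≤y+z y≤x+z with ℕₚ.≤-total (scaledFloor N x) (scaledFloor N y)
  ... | inj₁ X≤Y = subst (λ m → fromℕ m ≤ fromℕ N * z + 1ℚ) (sym (ℕₚ.m≤n⇒∣m-n∣≡n∸m X≤Y))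
                     (floor-gap N 0≤x 0≤y y≤x+z X≤Y)
  ... | inj₂ Y≤X = subst (λ m → fromℕ m ≤ fromℕ N * z + 1ℚ) (sym (ℕₚ.m≤n⇒∣n-m∣≡n∸m Y≤X))
                     (floor-gap N 0≤y 0≤x x≤y+z Y≤X)

  -- The number 1 / (m + 1), given directly in lowest terms so that its numerator and denominator,
  -- and hence its encoding, are known by computation.
  recip : ℕ → ℚ
  recip m = mkℚ (+ 1) m (1-coprimeTo (suc m))

  0≤recip : ∀ m → 0ℚ ≤ recip m
  0≤recip m = nonNegative⁻¹ (recip m)

  recip-* : ∀ m → recip m * fromℕ (suc m) ≡ 1ℚ
  recip-* m = *-denominator (recip m) (0≤recip m)

  recip-tendsToZero : TendsToZero recip
  -- A positive rational is at least the reciprocal of its denominator, so the denominator can serve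
  -- as the threshold.
  recip-tendsToZero η 0<η = ↧ₙ η , λ N d≤N → *-cancelʳ-<-nonNeg (fromℕ (suc N)) ⦃ fromℕ-nonNegative (suc N) ⦄ (begin-strict
    recip N * fromℕ (suc N)        ≡⟨ recip-* N ⟩
    fromℕ 1                        ≤⟨ fromℕ-mono-≤ 1 ℤ.∣ ↥ η ∣ (numerator-positive η 0<η) ⟩
    fromℕ (ℤ.∣ ↥ η ∣)              ≡⟨ *-denominator η (<⇒≤ 0<η) ⟨
    η * fromℕ (↧ₙ η)               <⟨ *-monoʳ-<-pos η ⦃ positive 0<η ⦄ (fromℕ-mono-< (↧ₙ η) (suc N) (ℕ.s≤s d≤N)) ⟩
    η * fromℕ (suc N)              ∎)
    where
    open ≤-Reasoning
    numerator-positive : ∀ q → 0ℚ < q → 1 ℕ.≤ ℤ.∣ ↥ q ∣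
    numerator-positive (mkℚ (+ suc _) _ _) _   = ℕ.s≤s ℕ.z≤n
    numerator-positive (mkℚ -[1+ _ ] _ _)  _   = ℕ.s≤s ℕ.z≤n
    numerator-positive (mkℚ (+ 0) _ _)     0<q with positive 0<q
    ... | ()

  ∑-bound : ∀ N {k} (f : Fin k → ℕ) (g : Fin k → ℚ) → (∀ a → fromℕ (f a) ≤ fromℕ N * g a + 1ℚ) →
            fromℕ (sum (tabulate f)) ≤ fromℕ N * ∑ g + fromℕ k
  ∑-bound N {zero}  f g f≤ = ≤-reflexive (sym (trans (+-identityʳ _) (*-zeroʳ (fromℕ N))))
  ∑-bound N {suc k} f g f≤ = begin
    fromℕ (f zero ℕ.+ sum (tabulate f′))            ≡⟨ fromℕ-+ (f zero) (sum (tabulate f′)) ⟩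
    fromℕ (f zero) + fromℕ (sum (tabulate f′))
      ≤⟨ +-mono-≤ (f≤ zero) (∑-bound N f′ g′ (λ a → f≤ (suc a))) ⟩
    (fromℕ N * g zero + 1ℚ) + (fromℕ N * ∑ g′ + fromℕ k)  ≡⟨ rearrange (fromℕ N) (g zero) (∑ g′) (fromℕ k) ⟩
    fromℕ N * ∑ g + (1ℚ + fromℕ k)                        ≡⟨ cong (λ m → fromℕ N * ∑ g + m) (fromℕ-+ 1 k) ⟨
    fromℕ N * ∑ g + fromℕ (suc k)                         ∎
    where
    open ≤-Reasoning
    f′ : Fin k → ℕ
    f′ a = f (suc a)
    g′ : Fin k → ℚ
    g′ a = g (suc a)
    rearrange : ∀ n x y k → (n * x + 1ℚ) + (n * y + k) ≡ n * (x + y) + (1ℚ + k)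
    rearrange = solve 4 (λ n x y k → (n :* x :+ con 1ℚ) :+ (n :* y :+ k) := n :* (x :+ y) :+ (con 1ℚ :+ k)) refl
      where open +-*-Solver

-- Counting thresholds, and matching the encoded input

module Feasibility where

  open import Defs renaming (sum to ℚsum)
  open import Data.Bool.Base using (true; false)
  open import Data.Fin.Base using (Fin; zero; suc; toℕ)
  open import Data.Fin.Properties as Finₚ using ()
  open import Data.Fin.Subset using (Subset; _∈_; _∉_; _─_)
  open import Data.Fin.Subset.Properties using (_∈?_; ∉⊥; ∈⊤; ⊥⊆; ⊆⊤)
  open import Data.Integer.Base as ℤ using ()
  open import Data.List.Base using (List; []; _∷_; _++_; map; length; concat; tabulate; filter)
  open import Data.List.Membership.Propositional using () renaming (_∈_ to _∈ˡ_)
  open import Data.List.Membership.Propositional.Properties using (∈-map⁻)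
  open import Data.List.Properties
    using (map-∘; map-cong; map-++; map-tabulate; length-tabulate; tabulate-cong; concat-map; length-map)
  open import Data.List.Relation.Unary.All as All using (All; []; _∷_)
  import Data.List.Relation.Unary.All.Properties as Allₚ
  open import Data.List.Relation.Unary.AllPairs as AllPairs using (AllPairs; []; _∷_)
  open import Data.List.Relation.Unary.Any using (here; there)
  open import Data.Nat.Base hiding (_/_; less)
  open import Data.Nat.Binary.Base as ℕᵇ using ()
  open import Data.Nat.DivMod using (_/_)
  open import Data.Nat.ListAction using (sum)
  open import Data.Nat.ListAction.Properties using (sum-++)
  open import Data.Nat.Properties
  open import Data.Product.Base using (_×_; _,_; proj₁; proj₂)
  open import Data.Rational.Base using (ℚ; 0ℚ; 1ℚ) renaming (_+_ to _+ℚ_; _*_ to _*ℚ_; _≤_ to _≤ℚ_)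
  import Data.Rational.Properties as ℚₚ
  open import Data.Rational.Solver using (module +-*-Solver)
  open import Data.Sum.Base using (inj₁; inj₂)
  open import Data.Vec.Base as Vec using (Vec; []; _∷_; lookup; toList)
  open import Data.Vec.Properties using (lookup∘tabulate; []=⇒lookup; lookup⇒[]=)
  open import Function.Base using (_∘_; id)
  open import Relation.Binary.PropositionalEquality
  open import Relation.Nullary.Decidable using (Dec; does)
  open import Relation.Nullary.Negation.Core using (¬_; contradiction)

  open PolynomialTime
  open Algorithm
  open Uncrossing
  open Rounding
  open PolyTime
  open Library

  total-map : {A B : Set} (φ : B → ℕ) (f : A → B) (xs : List A) → total φ (map f xs) ≡ total (φ ∘ f) xs
  total-map φ f xs = cong sum (sym (map-∘ xs))

  total-cong : {A : Set} {φ ψ : A → ℕ} → (∀ x → φ x ≡ ψ x) → ∀ xs → total φ xs ≡ total ψ xs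
  total-cong φ≗ψ xs = cong sum (map-cong φ≗ψ xs)

  total-++ : {A : Set} (φ : A → ℕ) (xs ys : List A) → total φ (xs ++ ys) ≡ total φ xs + total φ ys
  total-++ φ xs ys = trans (cong sum (map-++ φ xs ys)) (sum-++ (map φ xs) (map φ ys))

  total-concat : {A : Set} (φ : A → ℕ) {k : ℕ} (f : Fin k → List A) →
                 total φ (concat (tabulate f)) ≡ sum (tabulate (λ a → total φ (f a)))
  total-concat φ {zero}  f = refl
  total-concat φ {suc k} f = trans (total-++ φ (f zero) _) (cong (total φ (f zero) +_) (total-concat φ (f ∘ suc)))

  enumFrom-suc : ∀ i n → enumFrom (suc i) n ≡ map suc (enumFrom i n)
  enumFrom-suc i zero    = refl
  enumFrom-suc i (suc n) = cong (suc i ∷_) (enumFrom-suc (suc i) n)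

  length-enumFrom : ∀ i n → total (λ _ → 1) (enumFrom i n) ≡ n
  length-enumFrom i zero    = refl
  length-enumFrom i (suc n) = cong suc (length-enumFrom (suc i) n)

  enumFrom-bounds : ∀ i n → All (λ j → i ≤ j × j < i + n) (enumFrom i n)
  enumFrom-bounds i zero    = []
  enumFrom-bounds i (suc n) = (≤-refl , m<m+n i z<s) ∷
    All.map (λ (i<j , j<) → <⇒≤ i<j , ≤-trans j< (≤-reflexive (sym (+-suc i n)))) (enumFrom-bounds (suc i) n)

  -- The tests `m <ᵇ j` and `n <ᵇ j` disagree exactly when `j` exceeds one of `m` and `n` but not
  -- the other, which happens for `∣ m - n ∣` integers. Those above `N` are not counted, hence the
  -- inequality.
  thresholds-between : ∀ m n N → total (λ j → jump (m <ᵇ j) (n <ᵇ j)) (enumFrom 1 N) ≤ ∣ m - n ∣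
  thresholds-between m n N = subst (_≤ ∣ m - n ∣)
    (sym (trans (cong (total _) (enumFrom-suc 0 N)) (total-map _ suc (enumFrom 0 N)))) (go m n N)
    where
    go : ∀ m n N → total (λ i → jump (m <ᵇ suc i) (n <ᵇ suc i)) (enumFrom 0 N) ≤ ∣ m - n ∣
    shifted : ∀ m n N → total (λ i → jump (m <ᵇ suc i) (n <ᵇ suc i)) (enumFrom 1 N) ≤
              total (λ i → jump (m <ᵇ suc (suc i)) (n <ᵇ suc (suc i))) (enumFrom 0 N)
    shifted m n N = ≤-reflexive (trans (cong (total _) (enumFrom-suc 0 N)) (total-map _ suc (enumFrom 0 N)))
    go m       n       zero    = z≤n
    go zero    zero    (suc N) = ≤-trans (shifted 0 0 N) (go 0 0 N)
    go zero    (suc n) (suc N) = s≤s (≤-trans (shifted 0 (suc n) N) (go 0 n N))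
    go (suc m) zero    (suc N) = s≤s (≤-trans (shifted (suc m) 0 N)
      (≤-trans (go m 0 N) (≤-reflexive (∣-∣-identityʳ m))))
    go (suc m) (suc n) (suc N) = ≤-trans (shifted (suc m) (suc n) N) (go m n N)

  encodeTable-cong : {A B : Set} {f : A → Tree} {f′ : B → Tree} {n : ℕ} {g : Fin n → A} {g′ : Fin n → B} →
                     (∀ i → f (g i) ≡ f′ (g′ i)) → encodeTable f g ≡ encodeTable f′ g′
  encodeTable-cong {n = zero}  eq = refl
  encodeTable-cong {n = suc n} eq = cong₂ _∙_ (eq zero) (encodeTable-cong (eq ∘ suc))

  -- The edge table is read off the encoded input, since its encoder is local to `encodeInput` and
  -- the algorithm treats the table as an opaque tree.
  secondComponent : Tree → Tree
  secondComponent (_ ∙ (y ∙ _)) = y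
  secondComponent _             = nil

  module _ (I : Instance) (d : LPPoint I) where
    open Instance I

    input : Input
    input = n , secondComponent (encodeInput I d) , encodeFin t , tabulate (toℕ ∘ s) ,
            tabulate (λ a → tabulate (λ u → tabulate (d a u)))

    encode-input : encodeInput I d ≡ encode input
    encode-input = cong₂ (λ x y → encodeUnary n ∙ secondComponent (encodeInput I d) ∙ encodeFin t ∙ x ∙ y) (encodeTable-cong λ _ → refl)
      (encodeTable-cong λ _ → encodeTable-cong λ _ → refl)

  nth-tabulate : {A : Set} ⦃ _ : Encodable A ⦄ (x : A) {n : ℕ} (f : Fin n → A) (i : Fin n) →
                 nth x (tabulate f) (toℕ i) ≡ f i
  nth-tabulate x f zero    = refl
  nth-tabulate x f (suc i) = nth-tabulate x (f ∘ suc) i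

  allBallCuts-tabulate : ∀ N i {k} (ss : Fin k → ℕ) (Ds : Fin k → List (List ℚ)) →
    allBallCuts N i (tabulate ss) (tabulate Ds) ≡
    concat (tabulate (λ a → ballCuts N (i + toℕ a) (ss a) (Ds a)))
  allBallCuts-tabulate N i {zero}  ss Ds = refl
  allBallCuts-tabulate N i {suc k} ss Ds = cong₂ _++_
    (cong (λ j → ballCuts N j (ss zero) (Ds zero)) (sym (+-identityʳ i)))
    (trans (allBallCuts-tabulate N (suc i) (ss ∘ suc) (Ds ∘ suc))
      (cong concat (tabulate-cong λ a → cong (λ j → ballCuts N j (ss (suc a)) (Ds (suc a))) (sym (+-suc i (toℕ a))))))

  toList-tabulate : {A : Set} {n : ℕ} (f : Fin n → A) → toList (Vec.tabulate f) ≡ tabulate f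
  toList-tabulate {n = zero}  f = refl
  toList-tabulate {n = suc n} f = cong (f zero ∷_) (toList-tabulate (f ∘ suc))

  -- The initial family of balls

  module Balls {n k : ℕ} (s : Fin k → Fin n) (d : Fin k → Fin n → Fin n → ℚ) (N : ℕ) where

    ball : Fin k → ℕ → Subset n
    ball a j = Vec.tabulate λ v → below N j (d a (s a) v)

    ballsAround : Fin k → List (LabelledSet s)
    ballsAround a = map (λ j → a , ball a j) (enumFrom 1 N)

    balls : List (LabelledSet s)
    balls = concat (tabulate ballsAround)

    ballCuts-toCut : ∀ a → ballCuts N (toℕ a) (toℕ (s a)) (tabulate (λ u → tabulate (d a u))) ≡
                     map (toCut s) (ballsAround a)
    ballCuts-toCut a = trans (map-cong (λ j → cong (λ C → toℕ a , toℕ (s a) , C) (cut j)) (enumFrom 1 N))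
                             (map-∘ (enumFrom 1 N))
      where
      cut : ∀ j → map (below N j) (nth [] (tabulate (λ u → tabulate (d a u))) (toℕ (s a))) ≡ toList (ball a j)
      cut j = trans (cong (map (below N j)) (nth-tabulate [] (λ u → tabulate (d a u)) (s a)))
        (trans (map-tabulate (d a (s a)) (below N j)) (sym (toList-tabulate _)))

    allBallCuts-toCut : allBallCuts N 0 (tabulate (toℕ ∘ s)) (tabulate (λ a → tabulate (λ u → tabulate (d a u)))) ≡
                        map (toCut s) balls
    allBallCuts-toCut = trans (allBallCuts-tabulate N 0 (toℕ ∘ s) (λ a → tabulate (λ u → tabulate (d a u))))
      (trans (cong concat (trans (tabulate-cong ballCuts-toCut) (sym (map-tabulate ballsAround (map (toCut s))))))
             (concat-map (tabulate ballsAround)))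

    lookup-ball : ∀ a j v → lookup (ball a j) v ≡ (scaledFloor N (d a (s a) v) <ᵇ j)
    lookup-ball a j v = trans (lookup∘tabulate _ v) (below-scaledFloor N j (d a (s a) v))

    balls-edge : ∀ u v → total (cuts-edge s u v) balls ≤
      sum (tabulate (λ a → ∣ scaledFloor N (d a (s a) u) - scaledFloor N (d a (s a) v) ∣))
    balls-edge u v = ≤-trans (≤-reflexive (total-concat (cuts-edge s u v) ballsAround)) (sum-mono λ a →
      ≤-trans (≤-reflexive (trans (total-map (cuts-edge s u v) (λ j → a , ball a j) (enumFrom 1 N))
        (total-cong (λ j → cong₂ jump (lookup-ball a j u) (lookup-ball a j v)) (enumFrom 1 N))))
      (thresholds-between _ _ N))
      where
      sum-mono : ∀ {k} {f g : Fin k → ℕ} → (∀ a → f a ≤ g a) → sum (tabulate f) ≤ sum (tabulate g)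
      sum-mono {zero}  f≤g = z≤n
      sum-mono {suc k} f≤g = +-mono-≤ (f≤g zero) (sum-mono (f≤g ∘ suc))

    balls-label : ∀ a → total (hasLabel s a) balls ≡ N
    balls-label a = trans (total-concat (hasLabel s a) ballsAround)
      (trans (cong sum (tabulate-cong λ b → trans (total-map (hasLabel s a) (λ j → b , ball b j) (enumFrom 1 N))
        (total-const (indicator (does (b Finₚ.≟ a))))))
      (single a))
      where
      total-const : ∀ c → total (λ _ → c) (enumFrom 1 N) ≡ c * N
      total-const c = trans (go 1 N) (*-comm N c)
        where
        go : ∀ i N → total (λ _ → c) (enumFrom i N) ≡ N * c
        go i zero    = refl
        go i (suc N) = cong (c +_) (go (suc i) N)
      zeros : ∀ k → sum (tabulate {n = k} (λ _ → 0)) ≡ 0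
      zeros zero    = refl
      zeros (suc k) = zeros k
      single : ∀ {k} (a : Fin k) → sum (tabulate (λ b → indicator (does (b Finₚ.≟ a)) * N)) ≡ N
      single {suc k} zero    = trans (cong₂ _+_ (+-identityʳ N) (zeros k)) (+-identityʳ N)
      single {suc k} (suc a) = single a

    balls-Separates : ∀ t → (∀ a v → d a v v ≡ 0ℚ) → (∀ a → 1ℚ ≤ℚ d a (s a) t) → All (Separates s t) balls
    balls-Separates t diagonal far = Allₚ.concat⁺ (Allₚ.tabulate⁺ λ a → Allₚ.map⁺
      (All.map (separates a) (enumFrom-bounds 1 N)))
      where
      separates : ∀ a {j} → 1 ≤ j × j < 1 + N → Separates s t (a , ball a j)
      separates a {j@(suc _)} (_ , j≤N) =
        trans (lookup-ball a j (s a)) (cong (_<ᵇ j) (trans (cong (scaledFloor N) (diagonal a (s a))) zero-floor)) ,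
        trans (lookup-ball a j t) (≥⇒≮ᵇ (≤-trans (s≤s⁻¹ j≤N) (floor-1≤ N (d a (s a) t) (far a))))
        where
        zero-floor : scaledFloor N 0ℚ ≡ 0
        zero-floor = cong (λ m → m / 1) (*-zeroʳ N)
        ≥⇒≮ᵇ : ∀ {m n} → n ≤ m → (m <ᵇ n) ≡ false
        ≥⇒≮ᵇ {m}     {zero}  _         = refl
        ≥⇒≮ᵇ {suc m} {suc n} (s≤s n≤m) = ≥⇒≮ᵇ n≤m

  -- `AllPairs` compares different positions of the list, whereas two membership proofs may point to
  -- the same position; reflexivity covers that case.
  AllPairs⇒laminar : {A : Set} {R : A → A → Set} → (∀ x → R x x) → ∀ {xs} →
                     AllPairs (λ x y → R x y × R y x) xs → ∀ {x y} → x ∈ˡ xs → y ∈ˡ xs → R x y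
  AllPairs⇒laminar R-refl (_ ∷ _)   (here refl)  (here refl)  = R-refl _
  AllPairs⇒laminar R-refl (rs ∷ _)  (here refl)  (there y∈)   = proj₁ (All.lookup rs y∈)
  AllPairs⇒laminar R-refl (rs ∷ _)  (there x∈)   (here refl)  = proj₂ (All.lookup rs x∈)
  AllPairs⇒laminar R-refl (_ ∷ rss) (there x∈)   (there y∈)   = AllPairs⇒laminar R-refl rss x∈ y∈

  -- Feasibility of the family produced by the algorithm

  module Solution (I : Instance) (d : LPPoint I) (lp : MCP-LP I d) where
    open Instance I
    open MCP-LP lp

    M N : ℕ
    M = n * k
    N = units n k

    -- This is 1 / N: by computation `N`, the square of `suc M`, is the successor of
    -- `M + M * suc M`, and `recip` adds one to its argument.
    weightOfCut : ℚ
    weightOfCut = recip (M + M * suc M)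

    open Balls s d N

    u : LabelledSet s × LabelledSet s → LabelledSet s × LabelledSet s
    u = uncrossSets s

    open SweepProperties u
    open Sweep u using () renaming (sweeps to sweepSets)

    T : ℕ
    T = suc (length balls * (n * n))

    sets : List (LabelledSet s)
    sets = sweepSets T balls

    weighted : LabelledSet s → WeightedCut I
    weighted (a , C) = record { terminal = source a ; weight = weightOfCut ; set = C }

    family : Family I
    family = map weighted sets

    output-family : encodeFamily I family ≡ encode (algorithm (input I d))
    output-family = trans (go sets) (sym (cong encode algorithm≡))
      where
      algorithm≡ : algorithm (input I d) ≡ output (N , map (toCut s) sets)
      algorithm≡ rewrite length-tabulate (toℕ ∘ s) | allBallCuts-toCut | length-map (toCut s) balls =
        cong (λ cs → output (N , cs)) (sweeps-map u uncross (toCut s) (uncross-toCut s) T balls)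
      go : ∀ xs → encodeFamily I (map weighted xs) ≡ encode (output (N , map (toCut s) xs))
      go []             = refl
      go ((a , C) ∷ xs) = cong₂ _∙_
        (cong (λ w → encodeTerminal (source a) ∙ (encodeℤ (ℤ.+ 1) ∙ w) ∙ encode (toList C))
              (encode-digits (ℕᵇ.fromℕ N)))
        (go xs)

    -- Since all cuts weigh the same, any filtered sum of weights is a count times that weight.
    -- Loads and total weights are both reduced to counts by this.
    sum-weights : {P : WeightedCut I → Set} (P? : ∀ C → Dec (P C)) (f : LabelledSet s → ℕ) →
                  (∀ x → indicator (does (P? (weighted x))) ≡ f x) → ∀ xs →
                  ℚsum (map weight (filter P? (map weighted xs))) ≡ fromℕ (total f xs) *ℚ weightOfCut
    sum-weights P? f eq []       = sym (ℚₚ.*-zeroˡ weightOfCut)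
    sum-weights P? f eq (x ∷ xs) with does (P? (weighted x)) | eq x
    ... | true  | fx = begin
      weightOfCut +ℚ ℚsum (map weight (filter P? (map weighted xs)))
        ≡⟨ cong₂ _+ℚ_ (sym (ℚₚ.*-identityˡ weightOfCut)) (sum-weights P? f eq xs) ⟩
      1ℚ *ℚ weightOfCut +ℚ fromℕ (total f xs) *ℚ weightOfCut
        ≡⟨ ℚₚ.*-distribʳ-+ weightOfCut 1ℚ (fromℕ (total f xs)) ⟨
      (1ℚ +ℚ fromℕ (total f xs)) *ℚ weightOfCut
        ≡⟨ cong (_*ℚ weightOfCut) (fromℕ-+ 1 (total f xs)) ⟨
      fromℕ (1 + total f xs) *ℚ weightOfCut
        ≡⟨ cong (λ m → fromℕ (m + total f xs) *ℚ weightOfCut) fx ⟩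
      fromℕ (f x + total f xs) *ℚ weightOfCut ∎
      where open ≡-Reasoning
    ... | false | fx = trans (sum-weights P? f eq xs)
      (cong (λ m → fromℕ (m + total f xs) *ℚ weightOfCut) fx)

    separated : All (Separates s t) sets
    separated = sweeps-All (Separates s t) (uncrossSets-Separates s t) T
      (balls-Separates t diagonal (λ a → separate a (source a) (sink a) refl refl λ ()))

    noCrossing : AllPairs (NotCrossing s) sets
    noCrossing with sweeps-progress {NotCrossing s} (labelledPotential s) (uncrossSets-progress s) T balls
    ... | inj₂ (_ , pairs) = pairs
    ... | inj₁ T≤          = contradiction T≤ (<⇒≱ (s≤s (begin
      total (labelledPotential s) sets   ≤⟨ total-potential sets ⟩
      total (λ _ → 1) sets * (n * n)
        -- The constant function 1 is preserved by every exchange, so sweeping does not change the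
        -- number of sets, in terms of which `T` was chosen.
        ≡⟨ cong (_* (n * n)) (sweeps-total {_≡_} refl trans (cong₂ _+_) (λ _ → 1) (λ _ _ → refl) T balls) ⟩
      total (λ _ → 1) balls * (n * n)    ≡⟨ cong (_* (n * n)) (total-one balls) ⟩
      length balls * (n * n)             ∎)))
      where
      open ≤-Reasoning
      total-potential : ∀ xs → total (labelledPotential s) xs ≤ total (λ _ → 1) xs * (n * n)
      total-potential []             = z≤n
      total-potential ((_ , C) ∷ xs) = +-mono-≤ (potential-≤ C) (total-potential xs)
      total-one : ∀ {A : Set} (xs : List A) → total (λ _ → 1) xs ≡ length xs
      total-one []       = refl
      total-one (_ ∷ xs) = cong suc (total-one xs)

    -- In units of 1 / N: uncrossing does not raise the number of cuts that `e` crosses, and the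
    -- balls of commodity `a` contribute at most the difference of two rounded distances. The
    -- triangle inequality in both directions, with symmetry, bounds this by N d_a(e) + 1.
    edge-load : ∀ e → let u , v = ends e in
                fromℕ (total (cuts-edge s u v) sets) ≤ℚ fromℕ N *ℚ ∑ (λ a → dᵉ a e) +ℚ fromℕ k
    edge-load e = begin
      fromℕ (total (cuts-edge s x y) sets)   ≤⟨ fromℕ-mono-≤ _ _ (≤-trans
        (sweeps-total {_≤_} ≤-refl ≤-trans +-mono-≤ (cuts-edge s x y) (uncrossSets-edge s x y) T balls)
        (balls-edge x y)) ⟩
      fromℕ (sum (tabulate (λ a → ∣ scaledFloor N (d a (s a) x) - scaledFloor N (d a (s a) y) ∣)))
        ≤⟨ ∑-bound N (λ a → ∣ scaledFloor N (d a (s a) x) - scaledFloor N (d a (s a) y) ∣) (λ a → dᵉ a e)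
             (λ a → floor-difference N (nonneg a (s a) x) (nonneg a (s a) y)
               (subst (λ z → d a (s a) x ≤ℚ d a (s a) y +ℚ z) (symm a y x) (triangle a (s a) x y))
               (triangle a (s a) y x)) ⟩
      fromℕ N *ℚ ∑ (λ a → dᵉ a e) +ℚ fromℕ k ∎
      where
      open ℚₚ.≤-Reasoning
      x y : Fin n
      x = proj₁ (ends e)
      y = proj₂ (ends e)

    N*weight : fromℕ N *ℚ weightOfCut ≡ 1ℚ
    N*weight = trans (ℚₚ.*-comm (fromℕ N) weightOfCut) (recip-* (M + M * suc M))

    -- The sink shows that n is positive, so k is at most M + 1 and k / (M + 1)² at most 1 / (M +
    -- 1). This is why `N` is a square: one factor absorbs the sum over the commodities and the
    -- other tends to infinity with n k.
    k*weight≤ : fromℕ k *ℚ weightOfCut ≤ℚ recip M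
    k*weight≤ = begin
      fromℕ k *ℚ weightOfCut
        ≤⟨ ℚₚ.*-monoʳ-≤-nonNeg weightOfCut (fromℕ-mono-≤ k (suc M) (m≤n⇒m≤1+n (k≤n*k n t))) ⟩
      fromℕ (suc M) *ℚ weightOfCut                       ≡⟨ ℚₚ.*-identityˡ _ ⟨
      1ℚ *ℚ (fromℕ (suc M) *ℚ weightOfCut)               ≡⟨ cong (_*ℚ (fromℕ (suc M) *ℚ weightOfCut)) (recip-* M) ⟨
      (recip M *ℚ fromℕ (suc M)) *ℚ (fromℕ (suc M) *ℚ weightOfCut)
        ≡⟨ regroup (recip M) (fromℕ (suc M)) weightOfCut ⟩
      recip M *ℚ ((fromℕ (suc M) *ℚ fromℕ (suc M)) *ℚ weightOfCut)
        ≡⟨ cong (λ m → recip M *ℚ (m *ℚ weightOfCut)) (fromℕ-* (suc M) (suc M)) ⟨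
      recip M *ℚ (fromℕ N *ℚ weightOfCut)                ≡⟨ cong (recip M *ℚ_) N*weight ⟩
      recip M *ℚ 1ℚ                                      ≡⟨ ℚₚ.*-identityʳ (recip M) ⟩
      recip M                                            ∎
      where
      open ℚₚ.≤-Reasoning
      k≤n*k : ∀ n → Fin n → k ≤ n * k
      k≤n*k (suc n) _ = m≤m+n k (n * k)
      regroup : ∀ a b c → (a *ℚ b) *ℚ (b *ℚ c) ≡ a *ℚ ((b *ℚ b) *ℚ c)
      regroup = solve 3 (λ a b c → (a :* b) :* (b :* c) := a :* ((b :* b) :* c)) refl
        where open +-*-Solver

    family-loads : ∀ e → load I family e ≤ℚ fromℕ (c e) +ℚ recip M
    family-loads e = begin
      load I family e
        ≡⟨ sum-weights (λ C → e ∈? δ (set C)) (cuts-edge s x y) indicates sets ⟩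
      fromℕ (total (cuts-edge s x y) sets) *ℚ weightOfCut
        ≤⟨ ℚₚ.*-monoʳ-≤-nonNeg weightOfCut (edge-load e) ⟩
      (fromℕ N *ℚ D +ℚ fromℕ k) *ℚ weightOfCut
        ≡⟨ regroup (fromℕ N) D (fromℕ k) weightOfCut ⟩
      D *ℚ (fromℕ N *ℚ weightOfCut) +ℚ fromℕ k *ℚ weightOfCut
        ≡⟨ cong (λ z → D *ℚ z +ℚ fromℕ k *ℚ weightOfCut) N*weight ⟩
      D *ℚ 1ℚ +ℚ fromℕ k *ℚ weightOfCut
        ≡⟨ cong (_+ℚ fromℕ k *ℚ weightOfCut) (ℚₚ.*-identityʳ D) ⟩
      D +ℚ fromℕ k *ℚ weightOfCut
        ≤⟨ ℚₚ.+-mono-≤ (capacity e) k*weight≤ ⟩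
      fromℕ (c e) +ℚ recip M ∎
      where
      open ℚₚ.≤-Reasoning
      x y : Fin n
      x = proj₁ (ends e)
      y = proj₂ (ends e)
      D : ℚ
      D = ∑ (λ a → dᵉ a e)
      regroup : ∀ n d k w → (n *ℚ d +ℚ k) *ℚ w ≡ d *ℚ (n *ℚ w) +ℚ k *ℚ w
      regroup = solve 4 (λ n d k w → (n :* d :+ k) :* w := d :* (n :* w) :+ k :* w) refl
        where open +-*-Solver
      does-∈? : ∀ {m} (i : Fin m) S → does (i ∈? S) ≡ lookup S i
      does-∈? zero    (true ∷ S)  = refl
      does-∈? zero    (false ∷ S) = refl
      does-∈? (suc i) (_ ∷ S)     = does-∈? i S
      indicates : ∀ z → indicator (does (e ∈? δ (proj₂ z))) ≡ cuts-edge s x y z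
      indicates (_ , C) = cong indicator (trans (does-∈? e (δ C)) (lookup∘tabulate _ e))

    feasible : FeasibleFamily I (λ e → fromℕ (c e) +ℚ recip M) family
    feasible = record
      { isFamily = record
        { cuts      = λ C C∈ → on-members (λ C → IsCut (set C)) (λ x (a∈C , t∉C) →
            (⊥⊆ , _ , lookup⇒[]= _ _ a∈C , ∉⊥) ,
            (⊆⊤ , t , ∈⊤ , not-in t∉C)) C C∈
        ; laminar   = λ C D C∈ D∈ → laminar C D C∈ D∈
        ; terminals = λ C C∈ → on-members (λ C → r (terminal C) ≢ t) (λ (a , _) _ → s≢t a) C C∈
        ; nonneg    = λ C C∈ → on-members (λ C → 0ℚ ≤ℚ weight C) (λ _ _ → 0≤recip (M + M * suc M)) C C∈
        ; contains  = λ C C∈ → on-members (λ C → r (terminal C) ∈ set C)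
            (λ _ (a∈C , _) → lookup⇒[]= _ _ a∈C) C C∈
        ; total     = λ { (source a) _ → total-weight a ; (sink a) t≢t → contradiction refl t≢t }
        }
      ; avoidsSink = λ C C∈ → on-members (λ C → t ∉ set C) (λ _ (_ , t∉C) → not-in t∉C) C C∈
      ; loads      = family-loads
      }
      where
      not-in : ∀ {C : Subset n} {v} → lookup C v ≡ false → v ∉ C
      not-in v∉C v∈C = contradiction (trans (sym v∉C) ([]=⇒lookup v∈C)) λ ()
      on-members : (P : WeightedCut I → Set) → (∀ x → Separates s t x → P (weighted x)) →
                   ∀ C → C ∈ˡ family → P C
      on-members P p C C∈ with ∈-map⁻ weighted C∈
      ... | x , x∈ , refl = p x (All.lookup separated x∈)
      laminar : ∀ C D → C ∈ˡ family → D ∈ˡ family → ¬ Cross (set C) (set D)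
      laminar C D C∈ D∈ with ∈-map⁻ weighted C∈ | ∈-map⁻ weighted D∈
      ... | x , x∈ , refl | y , y∈ , refl =
        AllPairs⇒laminar {R = λ x y → ¬ Cross (proj₂ x) (proj₂ y)}
          (λ (_ , C) (_ , (v , v∈C─C) , _) → ─-irrefl C v v∈C─C)
          (AllPairs.map (λ {x} {y} → ¬crossing⇒¬cross (proj₂ x) (proj₂ y)) noCrossing) x∈ y∈
        where
        ─-irrefl : ∀ {n} (C : Subset n) v → v ∉ C ─ C
        ─-irrefl (true ∷ C)  (suc v) (Vec.there v∈) = ─-irrefl C v v∈
        ─-irrefl (false ∷ C) (suc v) (Vec.there v∈) = ─-irrefl C v v∈
      total-weight : ∀ a → ℚsum (map weight (cutsOf {I} (source a) family)) ≡ 1ℚ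
      total-weight a = trans
        (sum-weights (λ C → terminal C ≟ᵀ source a) (hasLabel s a) (λ _ → refl) sets)
        (trans (cong (λ m → fromℕ m *ℚ weightOfCut)
          (trans (sweeps-total {_≡_} refl trans (cong₂ _+_) (hasLabel s a) (uncrossSets-label s a) T balls)
                 (balls-label a)))
          N*weight)

  program : {A B : Set} ⦃ _ : Encodable A ⦄ ⦃ _ : Encodable B ⦄ {f : A → B} → PolyTime f → Program
  program F = record
    { functions = functions (library F)
    ; body      = body (library F) id
    ; main      = code F id zero
    }

  program-outputs : {A B : Set} ⦃ _ : Encodable A ⦄ ⦃ _ : Encodable B ⦄ {f : A → B} (F : PolyTime f) →
                    ∀ x {v w} → v ≡ encode x → w ≡ encode (f x) →
                    OutputsWithin (program F) (⟦ bound F ⟧ (size v)) v w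
  program-outputs F x refl refl = runs F (links λ _ → refl) zero x refl , small F x

open import Defs
open import Data.Nat.Base using (ℕ; _*_)
open import Data.Product.Base using (Σ-syntax; _×_; _,_)
open import Data.Rational.Base using (ℚ; 0ℚ; _+_; _≤_)

open PolynomialTime
open PolyTime
open Algorithm
open Rounding
open Feasibility

lemma1 : Σ[ P ∈ Program ] Σ[ p ∈ Polynomial ] Σ[ ε ∈ (ℕ → ℚ) ]
    (∀ N → 0ℚ ≤ ε N) ×
    TendsToZero ε ×
    (∀ (I : Instance) (d : LPPoint I) → MCP-LP I d →
    let open Instance I in
    Σ[ 𝒞 ∈ Family I ]
    OutputsWithin P (⟦ p ⟧ (size (encodeInput I d)))
    (encodeInput I d) (encodeFamily I 𝒞) ×
    FeasibleFamily I (λ e → fromℕ (c e) + ε (n * k)) 𝒞)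
lemma1 = program algorithmᴾ , bound algorithmᴾ , recip , 0≤recip , recip-tendsToZero , λ I d lp →
  let open Solution I d lp in
  family ,
  program-outputs algorithmᴾ (input I d) (encode-input I d) output-family ,
  feasible
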